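{- Suppose there is a language $L \in \mathrm{NP}$ and a constant $\epsilon > 0$ such that for all but finitely many $n$, $CC(L_n) > 2^{n^{\epsilon}}$. Then every $\mathrm{NP}$-complete language $A$ is complete for $\mathrm{NP}$ via length-increasing $\mathrm{P/poly}$ reductions; that is, for every $B \in \mathrm{NP}$ there is a function $f$ computable in polynomial time with polynomial-length advice (equivalently, by a polynomial-size circuit family) such that for all $x$, $x \in B \iff f(x) \in A$, and $|f(x)| > |x|$.
   Context: All languages are over $\Sigma=\{0,1\}$. For a language $L$, $L_n$ denotes the characteristic function of $L$ restricted to $\{0,1\}^n$, viewed as a boolean function $\{0,1\}^n \to \{0,1\}$. For a boolean function $g$, $CC(g)$ is the smallest $s$ such that some circuit of size $s$ computes $g$. $\mathrm{NP}$-complete means complete for $\mathrm{NP}$ under polynomial-time many-one reductions. -}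

module Defs where

open import Data.Nat using (ℕ; zero; suc; _+_; _*_; _^_; _≤_; _<_; _≡ᵇ_)
open import Data.Bool using (Bool; true; false; if_then_else_)
open import Data.Fin using (Fin; zero; suc)
open import Data.List using (List; []; _∷_; length; _++_)
open import Data.Vec using (Vec; toList; lookup; _∷_; [])
open import Data.Sum using (_⊎_; inj₁; inj₂)
open import Data.Product using (Σ; _×_; _,_; proj₁; proj₂; ∃; ∃-syntax)
open import Relation.Binary.PropositionalEquality using (_≡_)
open import Function.Bundles using (_⇔_)

Word : Set
Word = List Bool

Language : Set
Language = Word → Bool

slice : Language → (n : ℕ) → Vec Bool n → Bool
slice L n v = L (toList v)

-- Boolean circuits (fan-in ≤ 2, gates AND / OR / NOT), as straight-line
-- programs. A circuit on n inputs with s gates: gate i may read any of the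
-- n inputs or the previous i gates. The output is a designated wire.
-- Size = number of gates.

data Gate (m : ℕ) : Set where
  AND : Fin m → Fin m → Gate m
  OR  : Fin m → Fin m → Gate m
  NOT : Fin m → Gate m

data Gates (n : ℕ) : ℕ → Set where
  []  : Gates n 0
  _▷_ : {k : ℕ} → Gates n k → Gate (k + n) → Gates n (suc k)

record Circuit (n s : ℕ) : Set where
  constructor circuit
  field
    gates  : Gates n s
    output : Fin (s + n)

evalGate : {m : ℕ} → Gate m → Vec Bool m → Bool
evalGate (AND i j) v = Data.Bool._∧_ (lookup v i) (lookup v j)
evalGate (OR i j)  v = Data.Bool._∨_ (lookup v i) (lookup v j)
evalGate (NOT i)   v = Data.Bool.not (lookup v i)

-- values of all wires: gates (most recent first) followed by the inputs
wires : {n k : ℕ} → Gates n k → Vec Bool n → Vec Bool (k + n)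
wires [] x = x
wires (g ▷ a) x = let w = wires g x in evalGate a w ∷ w

evalCircuit : {n s : ℕ} → Circuit n s → Vec Bool n → Bool
evalCircuit (circuit g o) x = lookup (wires g x) o

Computes : {n s : ℕ} → Circuit n s → (Vec Bool n → Bool) → Set
Computes C g = ∀ x → evalCircuit C x ≡ g x

-- Deterministic single-tape Turing machines, semi-infinite tape.
-- Tape alphabet Fin (3 + nΓ): 0 = blank, 1 = bit 0, 2 = bit 1, rest extra.
-- States Fin (suc nQ), start state zero; halting states acc / rej.

data Move : Set where
  left right stay : Move

data Halt : Set where
  acc rej : Halt

record TM : Set where
  field
    nQ : ℕ
    nΓ : ℕ
    δ  : Fin (suc nQ) → Fin (3 + nΓ) → (Fin (suc nQ) ⊎ Halt) × Fin (3 + nΓ) × Move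

module _ (M : TM) where
  open TM M

  Sym : Set
  Sym = Fin (3 + nΓ)

  blank : Sym
  blank = zero

  bitSym : Bool → Sym
  bitSym false = suc zero
  bitSym true  = suc (suc zero)

  Tape : Set
  Tape = ℕ → Sym

  Config : Set
  Config = (Fin (suc nQ) ⊎ Halt) × ℕ × Tape

  initTape : Word → Tape
  initTape []      _       = blank
  initTape (b ∷ w) zero    = bitSym b
  initTape (b ∷ w) (suc i) = initTape w i

  initConfig : Word → Config
  initConfig w = inj₁ zero , 0 , initTape w

  move : Move → ℕ → ℕ
  move left zero    = zero
  move left (suc p) = p
  move right p      = suc p
  move stay p       = p

  step : Config → Config
  step (inj₂ h , p , t) = inj₂ h , p , t
  step (inj₁ q , p , t) with δ q (t p)
  ... | q' , a , d = q' , move d p , (λ j → if j ≡ᵇ p then a else t j)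

  run : ℕ → Config → Config
  run zero    c = c
  run (suc k) c = run k (step c)

  stateAfter : Word → ℕ → Fin (suc nQ) ⊎ Halt
  stateAfter w t = proj₁ (run t (initConfig w))

  tapeAfter : Word → ℕ → Tape
  tapeAfter w t = proj₂ (proj₂ (run t (initConfig w)))

  readBits : ℕ → ℕ → Tape → Word
  readBits zero    i t = []
  readBits (suc k) i t with t i
  ... | suc zero       = false ∷ readBits k (suc i) t
  ... | suc (suc zero) = true ∷ readBits k (suc i) t
  ... | _              = []

  -- the output of M on w, if read at time t: the maximal block of bits at
  -- the beginning of the tape (cells beyond t + |w| are blank anyway)
  outputAfter : Word → ℕ → Word
  outputAfter w t = readBits (suc (t + length w)) 0 (tapeAfter w t)

  HaltsWithin : Word → ℕ → Halt → Set
  HaltsWithin w t h = stateAfter w t ≡ inj₂ h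

  OutputsWithin : Word → ℕ → Word → Set
  OutputsWithin w t y = Σ Halt (λ h → HaltsWithin w t h) × (outputAfter w t ≡ y)

poly : ℕ → ℕ → ℕ
poly c n = n ^ c + c

double : Word → Word
double []      = []
double (b ∷ w) = b ∷ b ∷ double w

pair : Word → Word → Word
pair x y = double x ++ (false ∷ true ∷ y)

InNP : Language → Set
InNP L = Σ TM λ V → Σ ℕ λ c →
    (∀ x y → Σ Halt λ h → HaltsWithin V (pair x y) (poly c (length (pair x y))) h)
  × (∀ x → (L x ≡ true) ⇔
       (Σ Word λ y → (length y ≤ poly c (length x))
                   × HaltsWithin V (pair x y) (poly c (length (pair x y))) acc))

PolyTimeComputable : (Word → Word) → Set
PolyTimeComputable f = Σ TM λ M → Σ ℕ λ c →
  ∀ x → OutputsWithin M x (poly c (length x)) (f x)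

PPolyComputable : (Word → Word) → Set
PPolyComputable f = Σ TM λ M → Σ ℕ λ c → Σ (ℕ → Word) λ adv →
    (∀ n → length (adv n) ≤ poly c n)
  × (∀ x → OutputsWithin M (pair x (adv (length x)))
                          (poly c (length (pair x (adv (length x))))) (f x))

_≤ₚ_ : Language → Language → Set
B ≤ₚ A = Σ (Word → Word) λ f → PolyTimeComputable f × (∀ x → B x ≡ A (f x))

NPComplete : Language → Set
NPComplete A = InNP A × (∀ B → InNP B → B ≤ₚ A)

NPCompleteLIPPoly : Language → Set
NPCompleteLIPPoly A = ∀ B → InNP B → Σ (Word → Word) λ f →
    PPolyComputable f × (∀ x → B x ≡ A (f x)) × (∀ x → length x < length (f x))

-- Hypothesis: ∃ L ∈ NP, ∃ ε > 0, for all but finitely many n,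
-- CC(L_n) > 2^(n^ε).
-- With ε = 1/q (q ≥ 1), and "s > 2^(n^(1/q))" relaxed to
-- "s > 2^t for every natural t with t^q ≤ n".

ExpHardNP : Set
ExpHardNP = Σ Language λ L → InNP L × (Σ ℕ λ q → (1 ≤ q) × (Σ ℕ λ N →
  ∀ n → N ≤ n → ∀ s (C : Circuit n s) → Computes C (slice L n) →
  ∀ t → t ^ q ≤ n → 2 ^ t < s))

{-# OPTIONS --safe #-}
module Submission where

-- Let B be in NP, A be NP-complete and L the hard language. The language S of all words
-- pair y (pair x (pair z ...)) with (y ∈ B and x ∈ L) or z ∈ L is in NP; let f reduce it to A.
-- If x ∈ L and z ∉ L, then y ↦ f (pair y (pair x (pair z ...))) reduces B to A, so x and z can
-- serve as advice and the machine for f does the rest. It remains to choose, for each n, words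
-- x and z of a suitable length m polynomial in n such that this output is longer than n for all
-- y of length n at once.
-- If there were no such pair, each (x , z) would have a y with short output, in B or outside B.
-- By a domination argument, either m + 1 words z give every x ∈ L a short output with some
-- y ∈ B, where f lands in A exactly when x ∈ L, or m + 1 words x give every z ∉ L a short output
-- with some y ∉ B, where f lands in A exactly when z ∈ L. Trying all y, and looking up short
-- outputs in a table of A, decides L on length m by a circuit of size 2^(2n) poly(m), which is
-- too small.

-- With `B y ∧ L x` alone, a reduction could send every y outside B to one short word and reveal
-- nothing. The disjunct `L z` makes a short output informative there too: inside B it decides x,
-- outside B it decides z. Short outputs are what a circuit can exploit. A itself may be hard, but
-- its values on words of length at most n form a table of fewer than 2 ^ (n + 1) bits, while
-- running the machine of f costs only polynomially many gates. The lower bound to beat is 2 ^ t at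
-- length m = t ^ q; a t linear in n suffices, with a slope given by the degree of the polynomial
-- overhead. A short output speaks about x only for a particular z, and conversely. A circuit can
-- hardwire few such partners, so a cover logarithmic in the number of words is required, and
-- domination supplies one on one of the two sides. NP is defined by concrete single-tape machines,
-- so a verifier for S has to be built by hand. It runs the given verifiers in place, each on the
-- cells of the common input that belong to it.

open import Defs
open import Data.Bool using (Bool; true; false; if_then_else_; not; _∧_; _∨_)
open import Data.Bool.ListAction using (any)
open import Data.Bool.Properties using (∧-identityʳ; ∨-identityʳ; ∧-inverseʳ; ∨-inverseʳ; not-injective; not-involutive)
open import Data.Empty using (⊥; ⊥-elim)
open import Data.Fin using (Fin; zero; suc; toℕ; fromℕ<; splitAt; join; combine; remQuot)
open import Data.Fin.Properties using (splitAt-join; remQuot-combine; toℕ-fromℕ<; toℕ-injective)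
open import Data.List using (List; []; _∷_; length; _++_; map; _ʳ++_; replicate)
import Data.List as List
open import Data.List.Membership.Propositional using (_∈_)
open import Data.List.Membership.Propositional.Properties using (∈-++⁺ˡ; ∈-++⁺ʳ; ∈-++⁻; ∈-map⁺; ∈-map⁻)
open import Data.List.Properties using (length-++; length-map; length-replicate; ++-identityʳ; map-tabulate; map-∘; map-id)
open import Data.List.Relation.Unary.Any using (here; there)
open import Data.Maybe using (Maybe; just; nothing; is-just)
open import Data.Nat
open import Data.Nat.Properties
open import Data.Nat.Solver using (module +-*-Solver)
open import Data.Product using (Σ; ∃-syntax; _×_; _,_; proj₁; proj₂)
import Data.Product as Prod
open import Data.Sum using (_⊎_; inj₁; inj₂)
import Data.Sum as Sum
open import Data.Unit using (tt)
open import Data.Vec using (Vec; []; _∷_; lookup; toList)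
open import Data.Vec.Properties using (length-toList)
open import Function using (_∘_; id; flip)
open import Function.Bundles using (mk⇔; module Equivalence)
open import Relation.Binary.PropositionalEquality

-- Turing machines over finite types

record Finite (A : Set) : Set where
  constructor finite
  field
    size    : ℕ
    enc     : A → Fin size
    dec     : Fin size → A
    dec-enc : ∀ a → dec (enc a) ≡ a

open Finite

finite-Fin : ∀ n → Finite (Fin n)
finite-Fin n = finite n id id (λ _ → refl)

-- A machine only has to recover what it encoded, so an injection with a left inverse is enough and
-- no bijection with an initial segment is asked for. Codes outside the image are never written.
finite-retract : {A B : Set} (f : A → B) (g : B → A) → (∀ a → g (f a) ≡ a) → Finite B → Finite A
finite-retract f g gf F = finite (size F) (enc F ∘ f) (g ∘ dec F)
  (λ a → trans (cong g (dec-enc F (f a))) (gf a))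

finite-⊎ : {A B : Set} → Finite A → Finite B → Finite (A ⊎ B)
finite-⊎ F G = finite-retract (Sum.map (enc F) (enc G)) (Sum.map (dec F) (dec G))
  (λ { (inj₁ a) → cong inj₁ (dec-enc F a) ; (inj₂ b) → cong inj₂ (dec-enc G b) })
  (finite (size F + size G) (join (size F) (size G)) (splitAt (size F)) (splitAt-join (size F) (size G)))

finite-× : {A B : Set} → Finite A → Finite B → Finite (A × B)
finite-× F G = finite-retract (Prod.map (enc F) (enc G)) (Prod.map (dec F) (dec G))
  (λ { (a , b) → cong₂ _,_ (dec-enc F a) (dec-enc G b) })
  (finite (size F * size G) (λ { (i , j) → combine i j }) (remQuot (size G)) (λ { (i , j) → remQuot-combine i j }))

finite-Bool : Finite Bool
finite-Bool = finite 2 (λ { false → zero ; true → suc zero }) (λ { zero → false ; (suc _) → true })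
  (λ { false → refl ; true → refl })

finite-Maybe : {A : Set} → Finite A → Finite (Maybe A)
finite-Maybe F = finite (suc (size F)) (λ { nothing → zero ; (just a) → suc (enc F a) })
  (λ { zero → nothing ; (suc i) → just (dec F i) })
  (λ { nothing → refl ; (just a) → cong just (dec-enc F a) })

data Cell (Γ : Set) : Set where
  blk : Cell Γ
  bit : Bool → Cell Γ
  ext : Γ → Cell Γ

moveHead : Move → ℕ → ℕ
moveHead left  zero    = zero
moveHead left  (suc p) = p
moveHead right p       = suc p
moveHead stay  p       = p

_[_≔_] : {A : Set} → (ℕ → A) → ℕ → A → ℕ → A
(τ [ p ≔ a ]) j = if j ≡ᵇ p then a else τ j

isAcc : Halt → Bool
isAcc acc = true
isAcc rej = false

verdict : Bool → Halt
verdict true  = acc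
verdict false = rej

tapeOf : {Γ : Set} → List (Cell Γ) → ℕ → Cell Γ
tapeOf []       _       = blk
tapeOf (c ∷ cs) zero    = c
tapeOf (c ∷ cs) (suc j) = tapeOf cs j

-- Tapes are handled as zippers: `ls` lists the cells left of the head, nearest first, so
-- `ls ʳ++ rs` is the tape and `length ls` the head position. A move then merely shifts one cell
-- between the two lists.
tapeOf-ʳ++ : {Γ : Set} (ls rs : List (Cell Γ)) (i : ℕ) → tapeOf (ls ʳ++ rs) (length ls + i) ≡ tapeOf rs i
tapeOf-ʳ++ []       rs i = refl
tapeOf-ʳ++ (c ∷ ls) rs i = trans (cong (tapeOf (ls ʳ++ (c ∷ rs))) (sym (+-suc (length ls) i))) (tapeOf-ʳ++ ls (c ∷ rs) (suc i))

tapeOf-head : {Γ : Set} (ls rs : List (Cell Γ)) → tapeOf (ls ʳ++ rs) (length ls) ≡ tapeOf rs 0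
tapeOf-head ls rs = trans (cong (tapeOf (ls ʳ++ rs)) (sym (+-identityʳ (length ls)))) (tapeOf-ʳ++ ls rs 0)

tapeOf-update : {Γ : Set} {b : Cell Γ} (ls {rs rs′} : List (Cell Γ)) (i : ℕ) →
                (∀ j → (tapeOf rs [ i ≔ b ]) j ≡ tapeOf rs′ j) →
                ∀ j → (tapeOf (ls ʳ++ rs) [ length ls + i ≔ b ]) j ≡ tapeOf (ls ʳ++ rs′) j
tapeOf-update [] i h = h
tapeOf-update {b = b} (c ∷ ls) {rs} {rs′} i h j =
  trans (cong (λ n → (tapeOf (ls ʳ++ (c ∷ rs)) [ n ≔ b ]) j) (sym (+-suc (length ls) i)))
        (tapeOf-update ls (suc i) h′ j)
  where
  h′ : ∀ j → (tapeOf (c ∷ rs) [ suc i ≔ b ]) j ≡ tapeOf (c ∷ rs′) j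
  h′ zero    = refl
  h′ (suc j) = h j

run-split : ∀ M j k c → run M (j + k) c ≡ run M k (run M j c)
run-split M zero    k c = refl
run-split M (suc j) k c = run-split M j k (step M c)

run-halted : ∀ M k {h p t} → run M k (inj₂ h , p , t) ≡ (inj₂ h , p , t)
run-halted M zero    = refl
run-halted M (suc k) = run-halted M k

run-halted-later : ∀ M {w j k h} → j ≤ k → HaltsWithin M w j h →
                   run M k (initConfig M w) ≡ run M j (initConfig M w)
run-halted-later M {w} {j} {k} {h} j≤k halts = trans (cong (λ n → run M n (initConfig M w)) (sym (m+[n∸m]≡n j≤k)))
  (trans (run-split M j (k ∸ j) (initConfig M w)) (stays (k ∸ j) (run M j (initConfig M w)) halts))
  where
  stays : ∀ n (c : Config M) → proj₁ c ≡ inj₂ h → run M n c ≡ c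
  stays n (.(inj₂ h) , p , t) refl = run-halted M n

halted-later : ∀ M {w j k h} → j ≤ k → HaltsWithin M w j h → HaltsWithin M w k h
halted-later M {w} j≤k halts = trans (cong proj₁ (run-halted-later M {w} j≤k halts)) halts

move-≤ : ∀ M d p → move M d p ≤ suc p
move-≤ M left  zero    = z≤n
move-≤ M left  (suc p) = ≤-trans (n≤1+n p) (n≤1+n _)
move-≤ M right p       = ≤-refl
move-≤ M stay  p       = n≤1+n p

move≡moveHead : ∀ M d p → move M d p ≡ moveHead d p
move≡moveHead M left  zero    = refl
move≡moveHead M left  (suc p) = refl
move≡moveHead M right p       = refl
move≡moveHead M stay  p       = refl

-- Machines over arbitrary finite state and symbol types; the initial state is nothing.
module Compile {Q Γ : Set} (FQ : Finite Q) (FΓ : Finite Γ)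
               (δ : Maybe Q → Cell Γ → (Q ⊎ Halt) × Cell Γ × Move) where

  decState : Fin (suc (size FQ)) → Maybe Q
  decState zero    = nothing
  decState (suc i) = just (dec FQ i)

  encState : Maybe Q ⊎ Halt → Fin (suc (size FQ)) ⊎ Halt
  encState (inj₁ nothing)  = inj₁ zero
  encState (inj₁ (just q)) = inj₁ (suc (enc FQ q))
  encState (inj₂ h)        = inj₂ h

  decCell : Fin (3 + size FΓ) → Cell Γ
  decCell zero                = blk
  decCell (suc zero)          = bit false
  decCell (suc (suc zero))    = bit true
  decCell (suc (suc (suc i))) = ext (dec FΓ i)

  encCell : Cell Γ → Fin (3 + size FΓ)
  encCell blk         = zero
  encCell (bit false) = suc zero
  encCell (bit true)  = suc (suc zero)
  encCell (ext c)     = suc (suc (suc (enc FΓ c)))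

  decCell-encCell : ∀ c → decCell (encCell c) ≡ c
  decCell-encCell blk         = refl
  decCell-encCell (bit false) = refl
  decCell-encCell (bit true)  = refl
  decCell-encCell (ext c)     = cong ext (dec-enc FΓ c)

  next : Q ⊎ Halt → Maybe Q ⊎ Halt
  next = Sum.map just id

  machine : TM
  machine = record
    { nQ = size FQ
    ; nΓ = size FΓ
    ; δ  = λ i a → let (q , c , d) = δ (decState i) (decCell a) in encState (next q) , encCell c , d
    }

  AbsConfig : Set
  AbsConfig = (Maybe Q ⊎ Halt) × ℕ × (ℕ → Cell Γ)

  -- Tapes are functions, so they are compared cell by cell, which avoids function extensionality.
  -- Cells are compared after decoding, states after encoding.
  Represents : Config machine → AbsConfig → Set
  Represents (s , p' , t) (q , p , τ) = s ≡ encState q × p' ≡ p × (∀ j → decCell (t j) ≡ τ j)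

  -- The number is only an upper bound for the time, so estimates can be rounded up along the way
  -- instead of being computed exactly.
  record Steps (n : ℕ) (a b : AbsConfig) : Set where
    constructor steps
    field
      reach : ∀ c → Represents c a → Σ ℕ λ k → k ≤ n × Represents (run machine k c) b
  open Steps public

  steps-refl : ∀ {a} → Steps 0 a a
  steps-refl .reach c r = 0 , z≤n , r

  steps-trans : ∀ {m n a b c} → Steps m a b → Steps n b c → Steps (m + n) a c
  steps-trans {m} {n} f g .reach x r with reach f x r
  ... | j , j≤ , r₁ with reach g _ r₁
  ... | k , k≤ , r₂ = j + k , +-mono-≤ j≤ k≤ , subst (λ y → Represents y _) (sym (run-split machine j k x)) r₂

  steps-weaken : ∀ {m n a b} → m ≤ n → Steps m a b → Steps n a b
  steps-weaken m≤n f .reach c r with reach f c r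
  ... | k , k≤ , r′ = k , ≤-trans k≤ m≤n , r′

  decState-encState : ∀ q {i} → inj₁ i ≡ encState (inj₁ q) → decState i ≡ q
  decState-encState nothing  refl = refl
  decState-encState (just q) refl = cong just (dec-enc FQ q)

  steps-one : ∀ {q p τ q′ a d} → δ q (τ p) ≡ (q′ , a , d) →
              Steps 1 (inj₁ q , p , τ) (next q′ , moveHead d p , τ [ p ≔ a ])
  steps-one {q} eq .reach (inj₂ h , _ , t) (e , refl , r) with q
  steps-one eq .reach (inj₂ h , _ , t) (() , refl , r) | nothing
  steps-one eq .reach (inj₂ h , _ , t) (() , refl , r) | just _
  steps-one {q} {p} {τ} {q′} {a} {d} eq .reach (inj₁ i , _ , t) (e , refl , r) = 1 , ≤-refl , r′
    where
    eq′ : δ (decState i) (decCell (t p)) ≡ (q′ , a , d)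
    eq′ = trans (cong₂ δ (decState-encState q e) (r p)) eq
    r′ : Represents (step machine (inj₁ i , p , t)) (next q′ , moveHead d p , τ [ p ≔ a ])
    r′ rewrite eq′ = refl , move≡moveHead machine d p , tape
      where
      tape : ∀ j → decCell (if j ≡ᵇ p then encCell a else t j) ≡ (τ [ p ≔ a ]) j
      tape j with j ≡ᵇ p
      ... | true  = decCell-encCell a
      ... | false = r j

  steps-≗ : ∀ {n a q p τ τ′} → (∀ j → τ j ≡ τ′ j) → Steps n a (q , p , τ) → Steps n a (q , p , τ′)
  steps-≗ h f .reach c r with reach f c r
  ... | k , k≤ , e , e′ , r′ = k , k≤ , e , e′ , (λ j → trans (r′ j) (h j))

  steps-one-keep : ∀ {q p τ q′ d} → δ q (τ p) ≡ (q′ , τ p , d) →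
                   Steps 1 (inj₁ q , p , τ) (next q′ , moveHead d p , τ)
  steps-one-keep {q} {p} {τ} eq = steps-≗ same (steps-one eq)
    where
    same : ∀ j → (τ [ p ≔ τ p ]) j ≡ τ j
    same j with j ≡ᵇ p in e
    ... | true  = cong τ (sym (≡ᵇ⇒≡ j p (subst (λ b → Data.Bool.T b) (sym e) tt)))
    ... | false = refl

  steps-right : ∀ {q q′ a b} ls {rs} → δ q a ≡ (q′ , b , right) →
                Steps 1 (inj₁ q , length ls , tapeOf (ls ʳ++ (a ∷ rs)))
                        (next q′ , suc (length ls) , tapeOf ((b ∷ ls) ʳ++ rs))
  steps-right {q} {q′} {a} {b} ls {rs} eq =
    steps-≗ (λ j → trans (cong (λ n → (tapeOf (ls ʳ++ (a ∷ rs)) [ n ≔ b ]) j) (sym (+-identityʳ (length ls))))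
                         (tapeOf-update ls 0 (λ { zero → refl ; (suc j) → refl }) j))
            (steps-one (trans (cong (δ q) (tapeOf-head ls (a ∷ rs))) eq))

  steps-left : ∀ {q q′ a b c} ls {rs} → δ q a ≡ (q′ , b , left) →
               Steps 1 (inj₁ q , suc (length ls) , tapeOf ((c ∷ ls) ʳ++ (a ∷ rs)))
                       (next q′ , length ls , tapeOf (ls ʳ++ (c ∷ b ∷ rs)))
  steps-left {q} {q′} {a} {b} {c} ls {rs} eq =
    steps-≗ (λ j → trans (cong (λ n → (tapeOf (ls ʳ++ (c ∷ a ∷ rs)) [ n ≔ b ]) j) (sym (trans (+-suc (length ls) 0) (cong suc (+-identityʳ (length ls))))))
                         (tapeOf-update ls 1 (λ { zero → refl ; (suc zero) → refl ; (suc (suc j)) → refl }) j))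
            (steps-one (trans (cong (δ q) (tapeOf-head (c ∷ ls) (a ∷ rs))) eq))

  steps-stop : ∀ {q q′ d} ls rs → δ q (tapeOf rs 0) ≡ (q′ , tapeOf rs 0 , d) →
               Steps 1 (inj₁ q , length ls , tapeOf (ls ʳ++ rs)) (next q′ , moveHead d (length ls) , tapeOf (ls ʳ++ rs))
  steps-stop {q} {q′} {d} ls rs eq = steps-one-keep
    (subst (λ c → δ q c ≡ (q′ , c , d)) (sym (tapeOf-head ls rs)) eq)

  initConfig-represents : ∀ w → Represents (initConfig machine w) (inj₁ nothing , 0 , tapeOf (map bit w))
  initConfig-represents w = refl , refl , tape w
    where
    tape : ∀ w j → decCell (initTape machine w j) ≡ tapeOf (map bit w) j
    tape []          j       = refl
    tape (false ∷ w) zero    = refl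
    tape (true ∷ w)  zero    = refl
    tape (b ∷ w)     (suc j) = tape w j

  steps-halts : ∀ {n w h p τ} → Steps n (inj₁ nothing , 0 , tapeOf (map bit w)) (inj₂ h , p , τ) →
                HaltsWithin machine w n h
  steps-halts {n} {w} s with reach s _ (initConfig-represents w)
  ... | k , k≤ , halts , _ = halted-later machine {w} k≤ halts

-- Simulating several machines on the tracks of one tape

-- Besides the verifiers on ky, kx, kz, machines on cy and cx check the lengths of the witnesses:
-- a verifier may accept words outside the language with witnesses that are too long.
data Track : Set where
  ky kx kz cy cx : Track

Tuple : (Track → Set) → Set
Tuple P = P ky × P kx × P kz × P cy × P cx

finite-Σ-Track : {P : Track → Set} → (∀ k → Finite (P k)) → Finite (Σ Track P)
finite-Σ-Track {P} F = finite-retract to from from-to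
  (finite-⊎ (F ky) (finite-⊎ (F kx) (finite-⊎ (F kz) (finite-⊎ (F cy) (F cx)))))
  where
  to : Σ Track P → P ky ⊎ P kx ⊎ P kz ⊎ P cy ⊎ P cx
  to (ky , a) = inj₁ a
  to (kx , a) = inj₂ (inj₁ a)
  to (kz , a) = inj₂ (inj₂ (inj₁ a))
  to (cy , a) = inj₂ (inj₂ (inj₂ (inj₁ a)))
  to (cx , a) = inj₂ (inj₂ (inj₂ (inj₂ a)))
  from : P ky ⊎ P kx ⊎ P kz ⊎ P cy ⊎ P cx → Σ Track P
  from (inj₁ a)                      = ky , a
  from (inj₂ (inj₁ a))               = kx , a
  from (inj₂ (inj₂ (inj₁ a)))        = kz , a
  from (inj₂ (inj₂ (inj₂ (inj₁ a)))) = cy , a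
  from (inj₂ (inj₂ (inj₂ (inj₂ a)))) = cx , a
  from-to : ∀ a → from (to a) ≡ a
  from-to (ky , a) = refl
  from-to (kx , a) = refl
  from-to (kz , a) = refl
  from-to (cy , a) = refl
  from-to (cx , a) = refl

finite-Track : Finite Track
finite-Track = finite-retract (_, tt) proj₁ (λ _ → refl)
  (finite-Σ-Track (λ _ → finite 1 (λ _ → zero) (λ _ → tt) (λ _ → refl)))

-- The input is pair u v with u = pair y (pair x (pair z (pair c (pair d r)))), so that each
-- bit of y, x, z, c, d occupies four cells and each separator reads 0011; p0-p3 are the
-- positions in such a group.
-- e0, e1 skip r, and v0, v1 route the second bit of each two-bit group of v by the first.
data Mark : Set where
  p0    : Track → Mark
  p1 p2 : Track → Bool → Mark
  p3    : Track → Bool → Bool → Mark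
  e0    : Mark
  e1    : Bool → Mark
  v0    : Mark
  v1    : Bool → Mark

finite-Mark : Finite Mark
finite-Mark = finite-retract to from from-to
  (finite-⊎ (finite-× finite-Track (finite-Maybe (finite-× finite-Bool (finite-Maybe (finite-Maybe finite-Bool)))))
            (finite-× finite-Bool (finite-Maybe finite-Bool)))
  where
  to : Mark → (Track × Maybe (Bool × Maybe (Maybe Bool))) ⊎ (Bool × Maybe Bool)
  to (p0 k)     = inj₁ (k , nothing)
  to (p1 k a)   = inj₁ (k , just (a , nothing))
  to (p2 k a)   = inj₁ (k , just (a , just nothing))
  to (p3 k a b) = inj₁ (k , just (a , just (just b)))
  to e0         = inj₂ (false , nothing)
  to (e1 a)     = inj₂ (false , just a)
  to v0         = inj₂ (true , nothing)
  to (v1 a)     = inj₂ (true , just a)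
  from : (Track × Maybe (Bool × Maybe (Maybe Bool))) ⊎ (Bool × Maybe Bool) → Mark
  from (inj₁ (k , nothing))                  = p0 k
  from (inj₁ (k , just (a , nothing)))       = p1 k a
  from (inj₁ (k , just (a , just nothing)))  = p2 k a
  from (inj₁ (k , just (a , just (just b)))) = p3 k a b
  from (inj₂ (false , nothing))              = e0
  from (inj₂ (false , just a))               = e1 a
  from (inj₂ (true , nothing))               = v0
  from (inj₂ (true , just a))                = v1 a
  from-to : ∀ q → from (to q) ≡ q
  from-to (p0 k)     = refl
  from-to (p1 k a)   = refl
  from-to (p2 k a)   = refl
  from-to (p3 k a b) = refl
  from-to e0         = refl
  from-to (e1 a)     = refl
  from-to v0         = refl
  from-to (v1 a)     = refl

only : Track → Track → Bool
only ky ky = true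
only kx kx = true
only kz kz = true
only cy cy = true
only cx cx = true
only _  _  = false

-- The witness v interleaves two words. The bits tagged true are the witness for y, read by its
-- verifier and by its length check; those tagged false are shared by x and z, because the
-- disjunction asks for a witness of only one of them.
tag : Track → Bool
tag ky = true
tag kx = false
tag kz = false
tag cy = true
tag cx = false

tagged : Bool → Track → Bool
tagged true  k = tag k
tagged false k = not (tag k)

none : Track → Bool
none _ = false

after : Track → Mark
after ky = p0 kx
after kx = p0 kz
after kz = p0 cy
after cy = p0 cx
after cx = e0

-- A bit of y is doubled once by the inner pair and once more by the outer one. Keeping the first
-- and third of its four cells live undoes exactly the outer doubling. The live cells of a track
-- thus spell doubled bits and the separator 01, and the routed bits of v continue them to the input
-- `pair (W k) (pick k v)` of a verifier, without any copying.
mark : Mark → Bool → Maybe (Mark × (Track → Bool))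
mark (p0 k) a = just (p1 k a , only k)
mark (p1 k false) false = just (p2 k false , none)
mark (p1 k true)  true  = just (p2 k true , none)
mark (p1 k _)     _     = nothing
mark (p2 k a) b = just (p3 k a b , only k)
mark (p3 k false false) false = just (p0 k , none)
mark (p3 k true  true)  true  = just (p0 k , none)
mark (p3 k false true)  true  = just (after k , none)
mark (p3 k _     _)     _     = nothing
mark e0 a = just (e1 a , none)
mark (e1 false) true = just (v0 , none)
mark (e1 _)     _    = just (e0 , none)
mark v0 t = just (v1 t , none)
mark (v1 t) b = just (v0 , tagged t)

-- The input of a track stays scattered over the common tape, and the simulation walks over the dead
-- cells in between. Past the flags all cells are live, which gives every track unlimited work
-- space.
liveCell : List Bool → ℕ → ℕ
liveCell []           j       = j
liveCell (true ∷ fl)  zero    = zero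
liveCell (true ∷ fl)  (suc j) = suc (liveCell fl j)
liveCell (false ∷ fl) j       = suc (liveCell fl j)

-- The tape t spread over the cells flagged true, and over all cells after the flags.
spread : {S : Set} → List Bool → (ℕ → S) → ℕ → Maybe S
spread []           t p       = just (t p)
spread (true ∷ fl)  t zero    = just (t zero)
spread (true ∷ fl)  t (suc p) = spread fl (t ∘ suc) p
spread (false ∷ fl) t zero    = nothing
spread (false ∷ fl) t (suc p) = spread fl t p

module _ {S : Set} where

  spread-live : ∀ fl (t : ℕ → S) j → spread fl t (liveCell fl j) ≡ just (t j)
  spread-live []           t j       = refl
  spread-live (true ∷ fl)  t zero    = refl
  spread-live (true ∷ fl)  t (suc j) = spread-live fl (t ∘ suc) j
  spread-live (false ∷ fl) t j       = spread-live fl t j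

  spread-update : ∀ fl (t : ℕ → S) j a p →
                  (spread fl t [ liveCell fl j ≔ just a ]) p ≡ spread fl (t [ j ≔ a ]) p
  spread-update [] t j a p with p ≡ᵇ j
  ... | true  = refl
  ... | false = refl
  spread-update (true ∷ fl)  t zero    a zero    = refl
  spread-update (true ∷ fl)  t zero    a (suc p) = refl
  spread-update (true ∷ fl)  t (suc j) a zero    = refl
  spread-update (true ∷ fl)  t (suc j) a (suc p) = spread-update fl (t ∘ suc) j a p
  spread-update (false ∷ fl) t j       a zero    = refl
  spread-update (false ∷ fl) t j       a (suc p) = spread-update fl t j a p

  spread-before : ∀ fl (t : ℕ → S) i → i < liveCell fl 0 → spread fl t i ≡ nothing
  spread-before (false ∷ fl) t zero    i<       = refl
  spread-before (false ∷ fl) t (suc i) (s≤s i<) = spread-before fl t i i<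

liveCell-≤ : ∀ fl j → liveCell fl j ≤ length fl + j
liveCell-≤ []           j       = ≤-refl
liveCell-≤ (true ∷ fl)  zero    = z≤n
liveCell-≤ (true ∷ fl)  (suc j) = s≤s (≤-trans (liveCell-≤ fl j) (+-monoʳ-≤ (length fl) (n≤1+n j)))
liveCell-≤ (false ∷ fl) j       = s≤s (liveCell-≤ fl j)

record Gap {S : Set} (fl : List Bool) (t : ℕ → S) (j : ℕ) : Set where
  constructor gap
  field
    width : ℕ
    next≡ : liveCell fl (suc j) ≡ suc (liveCell fl j + width)
    dead  : ∀ i → i < width → spread fl t (suc (liveCell fl j + i)) ≡ nothing
    small : width ≤ length fl

gaps : {S : Set} (fl : List Bool) (t : ℕ → S) (j : ℕ) → Gap fl t j
gaps [] t j = gap 0 (cong suc (sym (+-identityʳ j))) (λ _ ()) z≤n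
gaps (true ∷ fl) t zero = gap (liveCell fl 0) refl (spread-before fl (t ∘ suc))
  (m≤n⇒m≤1+n (≤-trans (liveCell-≤ fl 0) (≤-reflexive (+-identityʳ _))))
gaps (true ∷ fl) t (suc j) with gaps fl (t ∘ suc) j
... | gap g e d s = gap g (cong suc e) d (m≤n⇒m≤1+n s)
gaps (false ∷ fl) t j with gaps fl t j
... | gap g e d s = gap g (cong suc e) d (m≤n⇒m≤1+n s)

module Verifier (V : Track → TM) where

  Symbol : Track → Set
  Symbol k = Sym (V k)

  -- A machine cannot see the left end of its tape, where a left move has no effect. The flag
  -- `first` marks that end, both for rewinding and for a simulated left move from cell zero. On a
  -- track, `nothing` stands for a dead cell.
  record Cooked : Set where
    constructor cooked
    field
      first  : Bool
      tracks : Tuple (Maybe ∘ Symbol)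
  open Cooked

  get : ∀ k → Cooked → Maybe (Symbol k)
  get ky c = proj₁ (tracks c)
  get kx c = proj₁ (proj₂ (tracks c))
  get kz c = proj₁ (proj₂ (proj₂ (tracks c)))
  get cy c = proj₁ (proj₂ (proj₂ (proj₂ (tracks c))))
  get cx c = proj₂ (proj₂ (proj₂ (proj₂ (tracks c))))

  set : ∀ k → Maybe (Symbol k) → Cooked → Cooked
  set ky a (cooked f (_ , x , z , c , d)) = cooked f (a , x , z , c , d)
  set kx a (cooked f (y , _ , z , c , d)) = cooked f (y , a , z , c , d)
  set kz a (cooked f (y , x , _ , c , d)) = cooked f (y , x , a , c , d)
  set cy a (cooked f (y , x , z , _ , d)) = cooked f (y , x , z , a , d)
  set cx a (cooked f (y , x , z , c , _)) = cooked f (y , x , z , c , a)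

  hide : Track → Cooked → Cooked
  hide k = set k nothing

  get-set : ∀ k a c → get k (set k a c) ≡ a
  get-set ky a c = refl
  get-set kx a c = refl
  get-set kz a c = refl
  get-set cy a c = refl
  get-set cx a c = refl

  hide-set : ∀ k a c → hide k (set k a c) ≡ hide k c
  hide-set ky a c = refl
  hide-set kx a c = refl
  hide-set kz a c = refl
  hide-set cy a c = refl
  hide-set cx a c = refl

  first-hide : ∀ k c → first (hide k c) ≡ first c
  first-hide ky c = refl
  first-hide kx c = refl
  first-hide kz c = refl
  first-hide cy c = refl
  first-hide cx c = refl

  -- Uncooked cells occur only beyond the input, where every track is live and blank.
  view : Cell Cooked → Cooked
  view (ext c) = c
  view _       = cooked false (just zero , just zero , just zero , just zero , just zero)

  abstract
    cook : Bool → (Track → Bool) → Bool → Cooked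
    cook f live b = cooked f (on ky , on kx , on kz , on cy , on cx)
      where
      on : ∀ k → Maybe (Symbol k)
      on k = if live k then just (bitSym (V k) b) else nothing

    get-cook : ∀ k f l b → get k (cook f l b) ≡ (if l k then just (bitSym (V k) b) else nothing)
    get-cook ky f l b = refl
    get-cook kx f l b = refl
    get-cook kz f l b = refl
    get-cook cy f l b = refl
    get-cook cx f l b = refl

    first-cook : ∀ f l b → first (cook f l b) ≡ f
    first-cook f l b = refl

    tracks-cook : ∀ f g l b → cooked f (tracks (cook g l b)) ≡ cook f l b
    tracks-cook f g l b = refl

  data Q : Set where
    mk  : Mark → Q
    rw  : Track → Bool → Q
    -- simulate track k in state q; the first flag tells that live cells are sought leftwards,
    -- the second accumulates the verdicts of the previous tracks
    sim : (k : Track) → Fin (suc (TM.nQ (V k))) → Bool → Bool → Q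

  abstract
    finite-Q : Finite Q
    finite-Q = finite-retract to from from-to
      (finite-⊎ finite-Mark (finite-⊎ (finite-× finite-Track finite-Bool)
        (finite-Σ-Track (λ k → finite-× (finite-Fin (suc (TM.nQ (V k)))) (finite-× finite-Bool finite-Bool)))))
      where
      R : Set
      R = Mark ⊎ (Track × Bool) ⊎ Σ Track (λ k → Fin (suc (TM.nQ (V k))) × Bool × Bool)
      to : Q → R
      to (mk m)        = inj₁ m
      to (rw k β)      = inj₂ (inj₁ (k , β))
      to (sim k q d β) = inj₂ (inj₂ (k , q , d , β))
      from : R → Q
      from (inj₁ m)                      = mk m
      from (inj₂ (inj₁ (k , β)))       = rw k β
      from (inj₂ (inj₂ (k , q , d , β))) = sim k q d β
      from-to : ∀ q → from (to q) ≡ q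
      from-to (mk m)        = refl
      from-to (rw k β)      = refl
      from-to (sim k q d β) = refl

    finite-Cooked : Finite Cooked
    finite-Cooked = finite-retract (λ c → first c , tracks c) (λ { (f , t) → cooked f t }) (λ _ → refl)
      (finite-× finite-Bool (finite-× (F ky) (finite-× (F kx) (finite-× (F kz) (finite-× (F cy) (F cx))))))
      where
      F : ∀ k → Finite (Maybe (Symbol k))
      F k = finite-Maybe (finite-Fin _)

  -- The tracks are visited in an order in which the acceptance formula is evaluated from left to
  -- right, so a single accumulated bit is all that the state has to carry.
  afterSim : Track → Bool → Bool → Q ⊎ Halt
  afterSim ky a h = inj₁ (rw kx h)
  afterSim kx a h = inj₁ (rw kz (a ∧ h))
  afterSim kz a h = inj₁ (rw cy (a ∨ h))
  afterSim cy a h = inj₁ (rw cx (a ∧ h))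
  afterSim cx a h = inj₂ (verdict (a ∧ h))

  Action : Set
  Action = (Q ⊎ Halt) × Cell Cooked × Move

  markStep : Bool → Bool → Maybe (Mark × (Track → Bool)) → Action
  markStep f b nothing        = inj₂ rej , bit b , stay
  markStep f b (just (m , l)) = inj₁ (mk m) , ext (cook f l b) , right

  goesLeft : Move → Bool
  goesLeft left = true
  goesLeft _    = false

  -- A leftward search meets the flag `first` on a dead cell only if the simulated head was on its
  -- cell zero. The simulated move leaves it there, so the search turns round and returns to that
  -- cell.
  seek : ∀ k → Fin (suc (TM.nQ (V k))) → Bool → Bool → Bool → Cell Cooked → Action
  seek k q true  β true  c = inj₁ (sim k q false β) , c , right
  seek k q true  β false c = inj₁ (sim k q true β) , c , left
  seek k q false β f     c = inj₁ (sim k q false β) , c , right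

  act : ∀ k → Bool → Cell Cooked → (Fin (suc (TM.nQ (V k))) ⊎ Halt) × Symbol k × Move → Action
  act k β c (inj₁ q , s , d) = inj₁ (sim k q (goesLeft d) β) , ext (set k (just s) (view c)) , d
  act k β c (inj₂ h , s , d) = afterSim k β (isAcc h) , c , stay

  simStep : ∀ k → Fin (suc (TM.nQ (V k))) → Bool → Bool → Cell Cooked → Maybe (Symbol k) → Action
  simStep k q d β c nothing  = seek k q d β (first (view c)) c
  simStep k q d β c (just s) = act k β c (TM.δ (V k) q s)

  rewind : Track → Bool → Cell Cooked → Bool → Action
  rewind k β c true  = inj₁ (sim k zero false β) , c , stay
  rewind k β c false = inj₁ (rw k β) , c , left

  δ : Maybe Q → Cell Cooked → Action
  δ nothing (bit b)            = markStep true b (mark (p0 ky) b)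
  δ nothing c                  = inj₂ rej , c , stay
  δ (just (mk m)) (bit b)      = markStep false b (mark m b)
  δ (just (mk m)) c            = inj₁ (rw ky false) , c , left
  δ (just (rw k β)) c        = rewind k β c (first (view c))
  δ (just (sim k q d β)) c   = simStep k q d β c (get k (view c))

  open Compile finite-Q finite-Cooked δ public

  running : Q → Maybe Q ⊎ Halt
  running q = inj₁ (just q)

  rewinds : ∀ k β p {τ} → (∀ j → first (view (τ j)) ≡ (j ≡ᵇ 0)) →
            Steps (suc p) (running (rw k β) , p , τ) (running (sim k zero false β) , 0 , τ)
  rewinds k β zero h = steps-one-keep (cong (rewind k β _) (h 0))
  rewinds k β (suc p) h =
    steps-trans (steps-one-keep {d = left} (cong (rewind k β _) (h (suc p)))) (rewinds k β p h)

  module Simulation (k : Track) (O : ℕ → Cooked) (first-O : ∀ j → first (O j) ≡ (j ≡ᵇ 0)) (fl : List Bool) where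

    private
      M : TM
      M = V k
      e : ℕ → ℕ
      e = liveCell fl
      ℓ : ℕ
      ℓ = length fl

    -- This invariant allows the tracks to share one tape: while track k runs, the inputs of the
    -- tracks still to come, and the end marker, stay as they were.
    Frame : (ℕ → Cell Cooked) → Set
    Frame τ = ∀ j → hide k (view (τ j)) ≡ hide k (O j)

    Holds : (ℕ → Cell Cooked) → (ℕ → Symbol k) → Set
    Holds τ t = ∀ j → get k (view (τ j)) ≡ spread fl t j

    frame-first : ∀ {τ} → Frame τ → ∀ j → first (view (τ j)) ≡ (j ≡ᵇ 0)
    frame-first {τ} F j = trans (sym (first-hide k _)) (trans (cong first (F j)) (trans (first-hide k _) (first-O j)))

    scanRight : ∀ {q β τ} n p → (∀ i → i < n → get k (view (τ (p + i))) ≡ nothing) →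
                Steps n (running (sim k q false β) , p , τ) (running (sim k q false β) , p + n , τ)
    scanRight zero p h rewrite +-identityʳ p = steps-refl
    scanRight {q} {β} {τ} (suc n) p h rewrite +-suc p n =
      steps-trans (steps-one-keep {d = right} (cong (simStep k q false β (τ p)) (trans (cong (get k ∘ view ∘ τ) (sym (+-identityʳ p))) (h 0 (s≤s z≤n)))))
                  (scanRight n (suc p) (λ i i< → trans (cong (get k ∘ view ∘ τ) (sym (+-suc p i))) (h (suc i) (s≤s i<))))

    scanLeft : ∀ {q β τ} → Frame τ → ∀ n p → (∀ i → i < n → get k (view (τ (suc (p + i)))) ≡ nothing) →
               Steps n (running (sim k q true β) , p + n , τ) (running (sim k q true β) , p , τ)
    scanLeft F zero p h rewrite +-identityʳ p = steps-refl
    scanLeft {q} {β} {τ} F (suc n) p h rewrite +-suc p n =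
      steps-trans (steps-one-keep {d = left} (trans (cong (simStep k q true β (τ (suc (p + n)))) (h n ≤-refl))
                                          (cong (λ f → seek k q true β f _) (frame-first {τ} F (suc (p + n))))))
                  (scanLeft {τ = τ} F n p (λ i i< → h i (m≤n⇒m≤1+n i<)))

    -- The worst case is a left move from simulated cell zero: the dead cells in front of it are
    -- crossed to the end of the tape and back again.
    arrive : ∀ {q β τ t} → Frame τ → Holds τ t → ∀ m p →
            Σ Bool λ d → Steps (suc (ℓ + ℓ)) (running (sim k q (goesLeft m) β) , moveHead m (e p) , τ)
                                       (running (sim k q d β) , e (moveHead m p) , τ)
    arrive F H stay p = false , steps-weaken z≤n steps-refl
    arrive {q} {β} {τ} {t} F H right p with gaps fl t p
    ... | gap g eq dead g≤ = false , steps-weaken (m≤n⇒m≤1+n (≤-trans g≤ (m≤m+n ℓ ℓ)))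
      (subst (λ x → Steps g (running (sim k q false β) , suc (e p) , τ) (running (sim k q false β) , x , τ)) (sym eq) (scanRight g (suc (e p)) (λ i i< → trans (H _) (dead i i<))))
    arrive {q} {β} {τ} {t} F H left (suc p) with gaps fl t p
    ... | gap g eq dead g≤ rewrite eq = true , steps-weaken (m≤n⇒m≤1+n (≤-trans g≤ (m≤m+n ℓ ℓ)))
      (scanLeft {τ = τ} F g (e p) (λ i i< → trans (H _) (dead i i<)))
    arrive {q} {β} {τ} {t} F H left zero with e 0 in eq
    ... | zero  = true , steps-weaken z≤n steps-refl
    ... | suc g = false , steps-weaken bound (steps-trans (scanLeft {τ = τ} F g 0 (λ i i< → dead (suc i) (s≤s i<)))
                            (steps-trans (steps-one-keep {d = right} (trans (cong (simStep k q true β (τ 0)) (dead 0 (s≤s z≤n)))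
                                                (cong (λ f → seek k q true β f _) (frame-first {τ} F 0))))
                              (scanRight g 1 (λ i i< → dead (suc i) (s≤s i<)))))
      where
      dead : ∀ i → i < suc g → get k (view (τ i)) ≡ nothing
      dead i i< = trans (H i) (spread-before fl t i (subst (i <_) (sym eq) i<))
      g< : suc g ≤ ℓ
      g< = subst (_≤ ℓ) eq (≤-trans (liveCell-≤ fl 0) (≤-reflexive (+-identityʳ ℓ)))
      bound : g + (1 + g) ≤ suc (ℓ + ℓ)
      bound = m≤n⇒m≤1+n (+-mono-≤ (<⇒≤ g<) g<)

    -- The factor allows one step for acting and `suc (ℓ + ℓ)` for reaching the next live cell. The
    -- direction flag `d` is arbitrary since it is consulted on dead cells only. The bound on the
    -- final position limits the cost of the next rewinding.
    simulates : ∀ T {q p t h β τ} d → proj₁ (run M T (inj₁ q , p , t)) ≡ inj₂ h → Frame τ → Holds τ t →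
                Σ ℕ λ p′ → Σ (ℕ → Cell Cooked) λ τ′ → p′ ≤ ℓ + (p + T) × Frame τ′ ×
                Steps (T * (2 + (ℓ + ℓ))) (running (sim k q d β) , e p , τ) (next (afterSim k β (isAcc h)) , p′ , τ′)
    simulates (suc T) {q} {p} {t} {h} {β} {τ} d halts F H with TM.δ M q (t p) in eq
    ... | inj₂ h′ , a , m rewrite run-halted M T {h′} {move M m p} {λ j → if j ≡ᵇ p then a else t j} with refl ← halts =
      e p , τ , ≤-trans (liveCell-≤ fl p) (+-monoʳ-≤ ℓ (m≤m+n p (suc T))) , F ,
      steps-weaken (s≤s z≤n) (steps-one-keep {d = stay} (trans (cong (simStep k q d β (τ (e p))) (trans (H (e p)) (spread-live fl t p)))
                                               (cong (act k β (τ (e p))) eq)))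
    ... | inj₁ q′ , a , m = p″ , τ″ , ≤-trans p″≤ (+-monoʳ-≤ ℓ moved) , F″ ,
      steps-trans (steps-trans stp (proj₂ r)) sims
      where
      τ′ : ℕ → Cell Cooked
      τ′ = τ [ e p ≔ ext (set k (just a) (view (τ (e p)))) ]
      stp : Steps 1 (running (sim k q d β) , e p , τ) (running (sim k q′ (goesLeft m) β) , moveHead m (e p) , τ′)
      stp = steps-one (trans (cong (simStep k q d β (τ (e p))) (trans (H (e p)) (spread-live fl t p)))
                             (cong (act k β (τ (e p))) eq))
      F′ : Frame τ′
      F′ j with j ≡ᵇ e p in j≡
      ... | true  = trans (hide-set k _ _) (trans (F (e p)) (cong (hide k ∘ O) (sym (≡ᵇ⇒≡ j (e p) (subst Data.Bool.T (sym j≡) tt)))))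
      ... | false = F j
      H′ : Holds τ′ (t [ p ≔ a ])
      H′ j = trans (lem j) (spread-update fl t p a j)
        where
        lem : ∀ j → get k (view (τ′ j)) ≡ (spread fl t [ e p ≔ just a ]) j
        lem j with j ≡ᵇ e p
        ... | true  = get-set k _ _
        ... | false = H j
      r = arrive {q′} {β} F′ H′ m p
      ih = simulates T {q′} {move M m p} {t [ p ≔ a ]} {h} {β} {τ′} (proj₁ r) halts F′ H′
      p″ = proj₁ ih
      τ″ = proj₁ (proj₂ ih)
      p″≤ = proj₁ (proj₂ (proj₂ ih))
      F″ = proj₁ (proj₂ (proj₂ (proj₂ ih)))
      sims : Steps (T * (2 + (ℓ + ℓ))) (running (sim k q′ (proj₁ r) β) , e (moveHead m p) , τ′) (next (afterSim k β (isAcc h)) , p″ , τ″)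
      sims = subst (λ x → Steps (T * (2 + (ℓ + ℓ))) (running (sim k q′ (proj₁ r) β) , e x , τ′) (next (afterSim k β (isAcc h)) , p″ , τ″)) (move≡moveHead M m p) (proj₂ (proj₂ (proj₂ (proj₂ ih))))
      moved : move M m p + T ≤ p + suc T
      moved = ≤-trans (+-monoˡ-≤ T (move-≤ M m p)) (≤-reflexive (sym (+-suc p T)))

-- Comparing lengths

length-pair : ∀ x y → length (pair x y) ≡ length x + length x + suc (suc (length y))
length-pair []      y = refl
length-pair (b ∷ x) y = cong suc (trans (cong suc (length-pair x y)) (sym (cong (_+ suc (suc (length y))) (+-suc (length x) (length x)))))

-- A machine accepting pair r v exactly when v is no longer than r: each bit of r becomes a
-- token R, and then tokens and bits of v are erased (X) alternately. The first cell is L.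
module Comparison where

  data State : Set where
    a0    : State
    a1    : Bool → State
    sr sl : State

  data Token : Set where
    L R X : Token

  abstract
    finite-State : Finite State
    finite-State = finite-retract to from from-to (finite-× finite-Bool (finite-Maybe finite-Bool))
      where
      to : State → Bool × Maybe Bool
      to a0     = false , nothing
      to (a1 b) = false , just b
      to sr     = true , nothing
      to sl     = true , just true
      from : Bool × Maybe Bool → State
      from (false , nothing) = a0
      from (false , just b)  = a1 b
      from (true , nothing)  = sr
      from (true , just _)   = sl
      from-to : ∀ q → from (to q) ≡ q
      from-to a0     = refl
      from-to (a1 b) = refl
      from-to sr     = refl
      from-to sl     = refl

    finite-Token : Finite Token
    finite-Token = finite 3 (λ { L → zero ; R → suc zero ; X → suc (suc zero) })
      (λ { zero → L ; (suc zero) → R ; (suc (suc zero)) → X }) (λ { L → refl ; R → refl ; X → refl })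

  δ : Maybe State → Cell Token → (State ⊎ Halt) × Cell Token × Move
  δ nothing            (bit a)    = inj₁ (a1 a) , ext L , right
  δ (just a0)          (bit a)    = inj₁ (a1 a) , ext R , right
  δ (just (a1 false))  (bit true) = inj₁ sr , ext X , right
  δ (just (a1 _))      (bit _)    = inj₁ a0 , ext X , right
  δ (just sr)          (ext X)    = inj₁ sr , ext X , right
  δ (just sr)          (bit _)    = inj₁ sl , ext X , left
  δ (just sr)          blk        = inj₂ acc , blk , stay
  δ (just sl)          (ext X)    = inj₁ sl , ext X , left
  δ (just sl)          (ext R)    = inj₁ sr , ext X , right
  δ (just sl)          (ext L)    = inj₂ rej , ext L , stay
  δ _                  c          = inj₂ rej , c , stay

  open Compile finite-State finite-Token δ public

  a1-same : ∀ b → δ (just (a1 b)) (bit b) ≡ (inj₁ a0 , ext X , right)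
  a1-same false = refl
  a1-same true  = refl

  data Tokens : ℕ → List (Cell Token) → Set where
    end   : Tokens 0 (ext L ∷ [])
    used  : ∀ {c ls} → Tokens c ls → Tokens c (ext X ∷ ls)
    token : ∀ {c ls} → Tokens c ls → Tokens (suc c) (ext R ∷ ls)

  At : State → List (Cell Token) → List (Cell Token) → AbsConfig
  At q ls rs = inj₁ (just q) , length ls , tapeOf (ls ʳ++ rs)

  Halts : ℕ → AbsConfig → Halt → Set
  Halts n a h = Σ ℕ λ p → Σ (ℕ → Cell Token) λ τ → Steps n a (inj₂ h , p , τ)

  -- The separator yields a token as well, hence the `suc`. It makes up for the first pair of the
  -- input, whose leading cell was taken by the end marker `L`, so that a nonempty word ends up with
  -- as many tokens as bits.
  prepare : ∀ {c ls} r v → Tokens c ls → Σ (List (Cell Token)) λ ls′ → Tokens (c + suc (length r)) ls′ ×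
            length ls′ + length v ≡ length ls + length (pair r v) ×
            Steps (length r + length r + 2) (At a0 ls (map bit (pair r v))) (At sr ls′ (map bit v))
  prepare {c} {ls} [] v t rewrite +-comm c 1 = ext X ∷ ext R ∷ ls , used (token t) ,
    sym (trans (+-suc _ _) (cong suc (+-suc _ _))) ,
    steps-trans (steps-right ls refl) (steps-right (ext R ∷ ls) refl)
  prepare {c} {ls} (b ∷ r) v t with prepare r v (used (token t))
  ... | ls′ , t′ , e , s = ls′ , subst (λ n → Tokens n ls′) (sym (+-suc c (suc (length r)))) t′ ,
    trans e (sym (trans (+-suc _ _) (cong suc (+-suc _ _)))) ,
    steps-weaken (≤-reflexive (cong suc (cong (_+ 2) (sym (+-suc (length r) (length r))))))
      (steps-trans (steps-right ls refl) (steps-trans (steps-right (ext R ∷ ls) (a1-same b)) s))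

  skipUsed : ∀ {c ls} i rs → Tokens c ls → Σ (List (Cell Token)) λ ls′ → Tokens c ls′ ×
             length ls′ ≡ length ls + i × Steps i (At sr ls (replicate i (ext X) ++ rs)) (At sr ls′ rs)
  skipUsed {ls = ls} zero rs t = ls , t , sym (+-identityʳ _) , steps-refl
  skipUsed {ls = ls} (suc i) rs t with skipUsed i rs (used t)
  ... | ls′ , t′ , e , s = ls′ , t′ , trans e (sym (+-suc _ i)) , steps-trans (steps-right ls refl) s

  useToken : ∀ {c h ls} i rs → Tokens (suc c) (h ∷ ls) → Σ (List (Cell Token)) λ ls′ → Tokens c ls′ ×
             length ls′ ≡ suc (length ls + i) ×
             Steps (suc (length ls + (length ls + i))) (At sl ls (h ∷ replicate i (ext X) ++ rs)) (At sr ls′ rs)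
  useToken {ls = ls} i rs (token t) with skipUsed i rs (used t)
  ... | ls′ , t′ , e , s = ls′ , t′ , e , steps-weaken (s≤s (≤-trans (m≤n+m i (length ls)) (m≤n+m _ (length ls))))
                                                       (steps-trans (steps-right ls refl) s)
  useToken {ls = h ∷ ls} i rs (used t) with useToken (suc i) rs t
  ... | ls′ , t′ , e , s = ls′ , t′ , trans e (cong suc (+-suc _ i)) ,
    steps-weaken (s≤s (≤-reflexive (cong suc (cong (length ls +_) (+-suc _ i)))))
                 (steps-trans (steps-left ls refl) s)

  noToken : ∀ {h ls} i rs → Tokens 0 (h ∷ ls) →
            Halts (suc (length ls)) (At sl ls (h ∷ replicate i (ext X) ++ rs)) rej
  noToken {ls = []} i rs end = 0 , _ , steps-stop [] (ext L ∷ replicate i (ext X) ++ rs) refl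
  noToken {ls = h ∷ ls} i rs (used t) with noToken (suc i) rs t
  ... | p , τ , s = p , τ , steps-trans (steps-left ls refl) s

  -- Each bit of v costs one trip to the nearest remaining token and back over erased cells, all
  -- within the first n cells.
  cancels : ∀ {c ls n} v → Tokens c ls → length ls + length v ≤ n →
            Halts (length v * (2 + (n + n)) + 1) (At sr ls (map bit v)) (verdict (length v ≤ᵇ c))
  cancels {ls = ls} [] t n≥ = _ , _ , steps-stop ls [] refl
  cancels {zero} {h ∷ ls} {n} (b ∷ v) t n≥ with noToken 1 (map bit v) t
  ... | p , τ , s = p , τ , steps-weaken (s≤s (≤-trans bound (m≤m+n _ 1)))
                              (steps-trans (steps-left ls refl) s)
    where
    bound : suc (length ls) ≤ suc (n + n) + length v * (2 + (n + n))
    bound = ≤-trans (s≤s (≤-trans (≤-trans (m≤m+n _ _) (≤-trans (n≤1+n _) n≥)) (m≤m+n n n))) (m≤m+n _ _)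
  cancels {suc c} {h ∷ ls} {n} (b ∷ v) t n≥ with useToken 1 (map bit v) t
  ... | ls′ , t′ , e , s with cancels {n = n} v t′ (≤-trans (≤-reflexive lem) n≥)
    where
    lem : length ls′ + length v ≡ suc (length ls) + suc (length v)
    lem = trans (cong (_+ length v) (trans e (cong suc (+-comm (length ls) 1)))) (sym (+-suc (suc (length ls)) (length v)))
  ... | p , τ , s′ = subst (λ r → Halts (suc (length v) * (2 + (n + n)) + 1) (At sr (h ∷ ls) (map bit (b ∷ v))) (verdict r)) (sym (≤ᵇ-suc (length v) c))
    (p , τ , steps-weaken bound (steps-trans (steps-left ls refl) (steps-trans s s′)))
    where
    ≤ᵇ-suc : ∀ m n → (suc m ≤ᵇ suc n) ≡ (m ≤ᵇ n)
    ≤ᵇ-suc zero    n = refl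
    ≤ᵇ-suc (suc m) n = refl
    ls< : suc (length ls) ≤ n
    ls< = ≤-trans (m≤m+n _ _) n≥
    bound : 1 + (suc (length ls + (length ls + 1)) + (length v * (2 + (n + n)) + 1)) ≤ suc (length v) * (2 + (n + n)) + 1
    bound = ≤-trans (+-monoˡ-≤ (length v * (2 + (n + n)) + 1) (s≤s (s≤s (+-mono-≤ (<⇒≤ ls<) (≤-trans (≤-reflexive (+-comm (length ls) 1)) ls<)))))
                    (≤-reflexive (sym (+-assoc (2 + (n + n)) _ 1)))

  comparisonTime : ℕ → ℕ
  comparisonTime n = n + (n * (2 + (n + n)) + 1)

  comparison : ∀ r v → HaltsWithin machine (pair r v) (comparisonTime (length (pair r v))) (verdict (length v ≤ᵇ length r))
  comparison [] v with cancels {n = 2 + length v} v (used end) ≤-refl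
  ... | p , τ , s = steps-halts {w = pair [] v} (steps-weaken bound
      (steps-trans (steps-right [] refl) (steps-trans (steps-right (ext L ∷ []) refl) s)))
    where
    bound : 2 + (length v * (2 + (2 + length v + (2 + length v))) + 1) ≤ comparisonTime (2 + length v)
    bound = +-mono-≤ (s≤s (s≤s (z≤n {length v}))) (+-monoˡ-≤ 1 (*-monoˡ-≤ _ (m≤n+m (length v) 2)))
  comparison (b ∷ r) v with prepare r v (used end)
  ... | ls , t , e , s with cancels {n = length (pair (b ∷ r) v)} v t (≤-reflexive e)
  ... | p , τ , s′ = steps-halts {w = pair (b ∷ r) v} (steps-weaken bound
      (steps-trans (steps-right [] refl) (steps-trans (steps-right (ext L ∷ []) (a1-same b)) (steps-trans s s′))))
    where
    N = length (pair (b ∷ r) v)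
    v≤ : length v ≤ N
    v≤ = ≤-trans (m≤n+m (length v) 2) (≤-trans (m≤n+m (2 + length v) (length (b ∷ r) + length (b ∷ r))) (≤-reflexive (sym (length-pair (b ∷ r) v))))
    r≤ : 2 + (length r + length r + 2) ≤ N
    r≤ = s≤s (s≤s (≤-trans (+-monoʳ-≤ (length r + length r) (s≤s (s≤s z≤n))) (≤-reflexive (sym (length-pair r v)))))
    bound : 1 + (1 + (length r + length r + 2 + (length v * (2 + (N + N)) + 1))) ≤ comparisonTime N
    bound = ≤-trans (≤-reflexive (sym (+-assoc 2 (length r + length r + 2) _))) (+-mono-≤ r≤ (+-monoˡ-≤ 1 (*-monoˡ-≤ (2 + (N + N)) v≤)))

-- Tagged witnesses and bundled inputs

pick : Track → Word → Word
pick k []          = []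
pick k (_ ∷ [])    = []
pick k (t ∷ b ∷ v) = if tagged t k then b ∷ pick k v else pick k v

length-pick : ∀ k v → length (pick k v) ≤ length v
length-pick k []          = z≤n
length-pick k (_ ∷ [])    = z≤n
length-pick k (t ∷ b ∷ v) with tagged t k
... | true  = s≤s (m≤n⇒m≤1+n (length-pick k v))
... | false = m≤n⇒m≤1+n (m≤n⇒m≤1+n (length-pick k v))

tagWith : Bool → Word → Word
tagWith t []      = []
tagWith t (b ∷ w) = t ∷ b ∷ tagWith t w

length-tagWith : ∀ t w → length (tagWith t w) ≡ length w + length w
length-tagWith t []      = refl
length-tagWith t (b ∷ w) = cong suc (trans (cong suc (length-tagWith t w)) (sym (+-suc (length w) (length w))))

pick-tagged : ∀ k t w v → tagged t k ≡ true → pick k (tagWith t w ++ v) ≡ w ++ pick k v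
pick-tagged k t []      v e = refl
pick-tagged k t (b ∷ w) v e rewrite e = cong (b ∷_) (pick-tagged k t w v e)

pick-untagged : ∀ k t w v → tagged t k ≡ false → pick k (tagWith t w ++ v) ≡ pick k v
pick-untagged k t []      v e = refl
pick-untagged k t (b ∷ w) v e rewrite e = pick-untagged k t w v e

bundle : (Track → Word) → Word → Word
bundle W r = pair (W ky) (pair (W kx) (pair (W kz) (pair (W cy) (pair (W cx) r))))

-- The factor two comes from the doubling in `pair`. It pays for two things: the input of a verifier
-- repeats every bit of `W k`, and a tagged witness spends two cells on each bit.
bundled-≤ : ∀ W r k → length (W k) + length (W k) ≤ length (bundle W r)
bundled-≤ W r = λ { ky → inFirst (W ky) ; kx → inSecond (W ky) (inFirst (W kx))
  ; kz → inSecond (W ky) (inSecond (W kx) (inFirst (W kz)))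
  ; cy → inSecond (W ky) (inSecond (W kx) (inSecond (W kz) (inFirst (W cy))))
  ; cx → inSecond (W ky) (inSecond (W kx) (inSecond (W kz) (inSecond (W cy) (inFirst (W cx))))) }
  where
  inFirst : ∀ x {y} → length x + length x ≤ length (pair x y)
  inFirst x = ≤-trans (m≤m+n _ _) (≤-reflexive (sym (length-pair x _)))
  inSecond : ∀ x {y n} → n ≤ length y → n ≤ length (pair x y)
  inSecond x {y} n≤ = ≤-trans n≤ (≤-trans (m≤n+m (length y) 2) (≤-trans (m≤n+m _ (length x + length x)) (≤-reflexive (sym (length-pair x y)))))

-- Correctness and running time of the combined verifier

module Verification (V : Track → TM) where
  open Verifier V
  open Cooked

  data Trace : Mark → Word → List Cooked → Mark → Set where
    nil  : ∀ {q} → Trace q [] [] q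
    cons : ∀ {q q′ q″ b w l cs} → mark q b ≡ just (q′ , l) → Trace q′ w cs q″ →
           Trace q (b ∷ w) (cook false l b ∷ cs) q″

  data Rejects : Mark → Word → Set where
    now   : ∀ {q b w} → mark q b ≡ nothing → Rejects q (b ∷ w)
    later : ∀ {q q′ b w l} → mark q b ≡ just (q′ , l) → Rejects q′ w → Rejects q (b ∷ w)

  trace-length : ∀ {q w cs q′} → Trace q w cs q′ → length cs ≡ length w
  trace-length nil         = refl
  trace-length (cons _ tr) = cong suc (trace-length tr)

  trace-first : ∀ {q w cs q′} → Trace q w cs q′ → ∀ j → first (view (tapeOf (map ext cs) j)) ≡ false
  trace-first nil         j       = refl
  trace-first (cons _ tr) zero    = first-cook false _ _
  trace-first (cons _ tr) (suc j) = trace-first tr j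

  data Carries (k : Track) : List Cooked → Word → Set where
    empty : Carries k [] []
    live  : ∀ {c b cs w} → get k c ≡ just (bitSym (V k) b) → Carries k cs w → Carries k (c ∷ cs) (b ∷ w)
    dead  : ∀ {c cs w} → get k c ≡ nothing → Carries k cs w → Carries k (c ∷ cs) w

  cook-live : ∀ {k l b} → l k ≡ true → get k (cook false l b) ≡ just (bitSym (V k) b)
  cook-live {k} {l} {b} e = trans (get-cook k false l b) (cong (if_then just (bitSym (V k) b) else nothing) e)

  cook-dead : ∀ {k l b} → l k ≡ false → get k (cook false l b) ≡ nothing
  cook-dead {k} {l} {b} e = trans (get-cook k false l b) (cong (if_then just (bitSym (V k) b) else nothing) e)

  get-blank : ∀ k → get k (view blk) ≡ just zero
  get-blank ky = refl
  get-blank kx = refl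
  get-blank kz = refl
  get-blank cy = refl
  get-blank cx = refl

  flags : Track → List Cooked → List Bool
  flags k = map (is-just ∘ get k)

  carries-spread : ∀ {k cs w} → Carries k cs w → ∀ j →
                   get k (view (tapeOf (map ext cs) j)) ≡ spread (flags k cs) (initTape (V k) w) j
  carries-spread {k} empty  j       = get-blank k
  carries-spread (live g C) zero    rewrite g = refl
  carries-spread (live g C) (suc j) rewrite g = carries-spread C j
  carries-spread (dead g C) zero    rewrite g = refl
  carries-spread (dead g C) (suc j) rewrite g = carries-spread C j

  carries-group : ∀ k k′ {a a′ b b′ cs w w′} → Carries k′ cs (if only k k′ then w else w′) →
                  Carries k′ (cook false (only k) a ∷ cook false none a′ ∷ cook false (only k) b ∷ cook false none b′ ∷ cs)
                             (if only k k′ then a ∷ b ∷ w else w′)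
  carries-group k k′ C with only k k′ in e
  ... | true  = live (cook-live e) (dead (cook-dead refl) (live (cook-live e) (dead (cook-dead refl) C)))
  ... | false = dead (cook-dead e) (dead (cook-dead refl) (dead (cook-dead e) (dead (cook-dead refl) C)))

  prepend : Track → Word → (Track → Word) → Track → Word
  prepend k y W k′ = if only k k′ then pair y (W k′) else W k′

  double-trace : ∀ k y r rest {cs q} W → Trace (after k) (double r ++ rest) cs q → (∀ k′ → Carries k′ cs (W k′)) →
                 Σ (List Cooked) λ cs′ → Trace (p0 k) (double (pair y r) ++ rest) cs′ q ×
                 (∀ k′ → Carries k′ cs′ (prepend k y W k′))
  double-trace k [] r rest {cs} W tr C = _ , cons refl (cons refl (cons refl (cons refl tr))) ,
    λ k′ → carries-group k k′ (both k′)
    where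
    both : ∀ k′ → Carries k′ cs (if only k k′ then W k′ else W k′)
    both k′ with only k k′
    ... | true  = C k′
    ... | false = C k′
  double-trace k (false ∷ y) r rest W tr C with double-trace k y r rest W tr C
  ... | _ , tr′ , C′ = _ , cons refl (cons refl (cons refl (cons refl tr′))) , λ k′ → carries-group k k′ (C′ k′)
  double-trace k (true ∷ y) r rest W tr C with double-trace k y r rest W tr C
  ... | _ , tr′ , C′ = _ , cons refl (cons refl (cons refl (cons refl tr′))) , λ k′ → carries-group k k′ (C′ k′)

  double-rejects : ∀ k y r rest → Rejects (after k) (double r ++ rest) → Rejects (p0 k) (double (pair y r) ++ rest)
  double-rejects k [] r rest R = later refl (later refl (later refl (later refl R)))
  double-rejects k (false ∷ y) r rest R = later refl (later refl (later refl (later refl (double-rejects k y r rest R))))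
  double-rejects k (true ∷ y)  r rest R = later refl (later refl (later refl (later refl (double-rejects k y r rest R))))

  skip-trace : ∀ r rest {cs q} (W : Track → Word) → Trace v0 rest cs q → (∀ k → Carries k cs (W k)) →
               Σ (List Cooked) λ cs′ → Trace e0 (double r ++ false ∷ true ∷ rest) cs′ q × (∀ k → Carries k cs′ (W k))
  skip-trace [] rest W tr C = _ , cons refl (cons refl tr) , λ k → dead (cook-dead refl) (dead (cook-dead refl) (C k))
  skip-trace (false ∷ r) rest W tr C with skip-trace r rest W tr C
  ... | _ , tr′ , C′ = _ , cons refl (cons refl tr′) , λ k → dead (cook-dead refl) (dead (cook-dead refl) (C′ k))
  skip-trace (true ∷ r) rest W tr C with skip-trace r rest W tr C
  ... | _ , tr′ , C′ = _ , cons refl (cons refl tr′) , λ k → dead (cook-dead refl) (dead (cook-dead refl) (C′ k))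

  witness-trace : ∀ v → Σ (List Cooked) λ cs → Σ Mark λ q → Trace v0 v cs q × (∀ k → Carries k cs (pick k v))
  witness-trace []      = _ , _ , nil , λ k → empty
  witness-trace (t ∷ []) = _ , _ , cons refl nil , λ k → dead (cook-dead refl) empty
  witness-trace (t ∷ b ∷ v) with witness-trace v
  ... | cs , q , tr , C = _ , q , cons refl (cons refl tr) , λ k → dead (cook-dead refl) (route k)
    where
    route : ∀ k → Carries k (cook false (tagged t) b ∷ cs) (if tagged t k then b ∷ pick k v else pick k v)
    route k with tagged t k in e
    ... | true  = live (cook-live e) (C k)
    ... | false = dead (cook-dead e) (C k)

  bundle-trace : ∀ W r v → Σ (List Cooked) λ cs → Σ Mark λ q →
                 Trace (p0 ky) (pair (bundle W r) v) cs q × (∀ k → Carries k cs (pair (W k) (pick k v)))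
  bundle-trace W r v = proj₁ t₆ , proj₁ (proj₂ t₀) , proj₁ (proj₂ t₆) ,
    λ { ky → proj₂ (proj₂ t₆) ky ; kx → proj₂ (proj₂ t₆) kx ; kz → proj₂ (proj₂ t₆) kz
      ; cy → proj₂ (proj₂ t₆) cy ; cx → proj₂ (proj₂ t₆) cx }
    where
    rest = false ∷ true ∷ v
    W₁ = λ k → pick k v
    W₂ = prepend cx (W cx) W₁
    W₃ = prepend cy (W cy) W₂
    W₄ = prepend kz (W kz) W₃
    W₅ = prepend kx (W kx) W₄
    t₀ = witness-trace v
    t₁ = skip-trace r v W₁ (proj₁ (proj₂ (proj₂ t₀))) (proj₂ (proj₂ (proj₂ t₀)))
    t₂ = double-trace cx (W cx) r rest W₁ (proj₁ (proj₂ t₁)) (proj₂ (proj₂ t₁))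
    t₃ = double-trace cy (W cy) _ rest W₂ (proj₁ (proj₂ t₂)) (proj₂ (proj₂ t₂))
    t₄ = double-trace kz (W kz) _ rest W₃ (proj₁ (proj₂ t₃)) (proj₂ (proj₂ t₃))
    t₅ = double-trace kx (W kx) _ rest W₄ (proj₁ (proj₂ t₄)) (proj₂ (proj₂ t₄))
    t₆ = double-trace ky (W ky) _ rest W₅ (proj₁ (proj₂ t₅)) (proj₂ (proj₂ t₅))

  -- `InNP` asks the verifier to halt on every `pair u v`, so malformed u must be recognised. The
  -- marking pass stops at the first group that is neither a bit nor a separator; if u ends too
  -- early, the outer separator 01 appears where a doubled bit is due and is caught in the same way.
  unpair : ∀ u → (∃[ y ] ∃[ r ] u ≡ pair y r) ⊎ (∀ k v → Rejects (p0 k) (double u ++ false ∷ true ∷ v))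
  unpair []                  = inj₂ λ k v → later refl (now refl)
  unpair (false ∷ [])        = inj₂ λ k v → later refl (later refl (later refl (now refl)))
  unpair (true ∷ [])         = inj₂ λ k v → later refl (later refl (later refl (now refl)))
  unpair (true ∷ false ∷ u)  = inj₂ λ k v → later refl (later refl (later refl (now refl)))
  unpair (false ∷ true ∷ u)  = inj₁ ([] , u , refl)
  unpair (false ∷ false ∷ u) with unpair u
  ... | inj₁ (y , r , e) = inj₁ (false ∷ y , r , cong (λ u → false ∷ false ∷ u) e)
  ... | inj₂ R           = inj₂ λ k v → later refl (later refl (later refl (later refl (R k v))))
  unpair (true ∷ true ∷ u) with unpair u
  ... | inj₁ (y , r , e) = inj₁ (true ∷ y , r , cong (λ u → true ∷ true ∷ u) e)
  ... | inj₂ R           = inj₂ λ k v → later refl (later refl (later refl (later refl (R k v))))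

  unbundle : ∀ u → (∃[ W ] ∃[ r ] u ≡ bundle W r) ⊎ (∀ v → Rejects (p0 ky) (pair u v))
  unbundle u with unpair u
  ... | inj₂ R = inj₂ (R ky)
  ... | inj₁ (y , u₁ , refl) with unpair u₁
  ... | inj₂ R = inj₂ λ v → double-rejects ky y _ _ (R kx v)
  ... | inj₁ (x , u₂ , refl) with unpair u₂
  ... | inj₂ R = inj₂ λ v → double-rejects ky y _ _ (double-rejects kx x _ _ (R kz v))
  ... | inj₁ (z , u₃ , refl) with unpair u₃
  ... | inj₂ R = inj₂ λ v → double-rejects ky y _ _ (double-rejects kx x _ _ (double-rejects kz z _ _ (R cy v)))
  ... | inj₁ (c , u₄ , refl) with unpair u₄
  ... | inj₂ R = inj₂ λ v → double-rejects ky y _ _ (double-rejects kx x _ _ (double-rejects kz z _ _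
                              (double-rejects cy c _ _ (R cx v))))
  ... | inj₁ (d , r , refl) = inj₁ ((λ { ky → y ; kx → x ; kz → z ; cy → c ; cx → d }) , r , refl)

  runs-trace : ∀ {q w cs q′} done → Trace q w cs q′ →
               Steps (length w) (running (mk q) , length done , tapeOf (done ʳ++ map bit w))
                                (running (mk q′) , length done + length w , tapeOf (done ʳ++ map ext cs))
  runs-trace done nil rewrite +-identityʳ (length done) = steps-refl
  runs-trace {w = b ∷ w} done (cons e tr) rewrite +-suc (length done) (length w) =
    steps-trans (steps-right done (cong (markStep false b) e)) (runs-trace (ext (cook false _ b) ∷ done) tr)

  runs-rejects : ∀ {q w} done → Rejects q w → Σ ℕ λ p → Σ (ℕ → Cell Cooked) λ τ →
                 Steps (length w) (running (mk q) , length done , tapeOf (done ʳ++ map bit w)) (inj₂ rej , p , τ)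
  runs-rejects {q} {b ∷ w} done (now e) = _ , _ , steps-weaken (s≤s z≤n)
    (steps-stop {just (mk q)} {inj₂ rej} {stay} done (map bit (b ∷ w)) (cong (markStep false b) e))
  runs-rejects {w = b ∷ w} done (later e R) with runs-rejects (ext (cook false _ b) ∷ done) R
  ... | p , τ , s = p , τ , steps-trans (steps-right done (cong (markStep false b) e)) s

  start : Word → AbsConfig
  start w = inj₁ nothing , 0 , tapeOf (map bit w)

  -- A trace writes every cell with the flag `first` unset. Only cell zero differs, because it is
  -- written from the initial state of the machine.
  promote : List Cooked → List Cooked
  promote []       = []
  promote (c ∷ cs) = cooked true (tracks c) ∷ cs

  starts : ∀ {w cs q} → Trace (p0 ky) w cs q → 0 < length w →
           Steps (length w) (start w) (running (mk q) , length w , tapeOf (map ext (promote cs)))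
  starts {b ∷ w} {cs = _ ∷ cs} {q} (cons refl tr) _ =
    subst (λ c → Steps (suc (length w)) (start (b ∷ w)) (running (mk q) , suc (length w) , tapeOf (ext c ∷ map ext cs)))
          (sym (tracks-cook true false (only ky) b))
          (steps-trans (steps-right [] refl) (runs-trace (ext (cook true (only ky) b) ∷ []) tr))

  starts-rejects : ∀ {w} → Rejects (p0 ky) w → HaltsWithin machine w (length w) rej
  starts-rejects {b ∷ w} (later refl R) with runs-rejects (ext (cook true (only ky) b) ∷ []) R
  ... | p , τ , s = steps-halts {w = b ∷ w} (steps-trans (steps-right [] refl) s)

  promote-first : ∀ {q w cs q′} → 0 < length w → Trace q w cs q′ → ∀ j →
                  first (view (tapeOf (map ext (promote cs)) j)) ≡ (j ≡ᵇ 0)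
  promote-first _ (cons _ tr) zero    = refl
  promote-first _ (cons _ tr) (suc j) = trace-first tr j

  get-promote : ∀ k c → get k (cooked true (tracks c)) ≡ get k c
  get-promote ky c = refl
  get-promote kx c = refl
  get-promote kz c = refl
  get-promote cy c = refl
  get-promote cx c = refl

  promote-carries : ∀ {k cs w} → Carries k cs w → Carries k (promote cs) w
  promote-carries     empty              = empty
  promote-carries {k} (live {c = c} e C) = live (trans (get-promote k c) e) C
  promote-carries {k} (dead {c = c} e C) = dead (trans (get-promote k c) e) C

  promote-length : ∀ cs → length (promote cs) ≡ length cs
  promote-length []       = refl
  promote-length (c ∷ cs) = refl

  tapeOf-end : (cs : List (Cell Cooked)) → tapeOf cs (length cs) ≡ blk
  tapeOf-end []       = refl
  tapeOf-end (c ∷ cs) = tapeOf-end cs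

  -- The summands stand for rewinding from a position up to n + T, for finding the first live cell,
  -- and for T simulated steps.
  stageTime : ℕ → ℕ → ℕ
  stageTime n T = suc (n + T) + (n + T * (2 + (n + n)))

  stage : ∀ k {β τ p n T w h} fl → length fl ≡ n → p ≤ n + T →
          (∀ j → first (view (τ j)) ≡ (j ≡ᵇ 0)) →
          (∀ j → get k (view (τ j)) ≡ spread fl (initTape (V k) w) j) →
          HaltsWithin (V k) w T h →
          Σ ℕ λ p′ → Σ (ℕ → Cell Cooked) λ τ′ → p′ ≤ n + T ×
          (∀ j → hide k (view (τ′ j)) ≡ hide k (view (τ j))) ×
          (∀ j → first (view (τ′ j)) ≡ (j ≡ᵇ 0)) ×
          Steps (stageTime n T) (running (rw k β) , p , τ) (next (afterSim k β (isAcc h)) , p′ , τ′)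
  stage k {β} {τ} {p} {n} {T} {w} {h} fl refl p≤ first-τ holds halts
    with Simulation.simulates k (view ∘ τ) first-τ fl T {zero} {0} {initTape (V k) w} {h} {β} {τ} false halts (λ _ → refl) holds
  ... | p′ , τ′ , p′≤ , F , s = p′ , τ′ , p′≤ , F ,
    (λ j → trans (sym (first-hide k _)) (trans (cong first (F j)) (trans (first-hide k _) (first-τ j)))) ,
    steps-weaken (+-mono-≤ (s≤s p≤) (+-monoˡ-≤ _ e≤))
      (steps-trans (rewinds k β p first-τ)
        (steps-trans (Simulation.scanRight k (view ∘ τ) first-τ fl (liveCell fl 0) 0
                       (λ i i< → trans (holds i) (spread-before fl _ i i<))) s))
    where
    e≤ : liveCell fl 0 ≤ length fl
    e≤ = ≤-trans (liveCell-≤ fl 0) (≤-reflexive (+-identityʳ (length fl)))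

  -- Both length checks are required even if z alone is to be accepted; the witness for y can then
  -- be empty and passes its check.
  decide : (Track → Bool) → Bool
  decide a = (((a ky ∧ a kx) ∨ a kz) ∧ a cy) ∧ a cx

  verifierTime : ℕ → ℕ → ℕ
  verifierTime n T = n + (1 + (s + (s + (s + (s + s)))))
    where s = stageTime n T

  verifies : ∀ W r v T (h : Track → Halt) → (∀ k → HaltsWithin (V k) (pair (W k) (pick k v)) T (h k)) →
             HaltsWithin machine (pair (bundle W r) v) (verifierTime (length (pair (bundle W r) v)) T)
                                 (verdict (decide (isAcc ∘ h)))
  verifies W r v T h halts
    with cs , q , tr , C ← bundle-trace W r v
    = go
    where
    u = pair (bundle W r) v
    n = length u
    0<n : 0 < n
    0<n = ≤-trans (s≤s z≤n) (≤-trans (m≤n+m _ (length (bundle W r) + length (bundle W r))) (≤-reflexive (sym (length-pair (bundle W r) v))))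
    input : Track → Word
    input k = pair (W k) (pick k v)
    cs′ = promote cs
    τ₀ = tapeOf (map ext cs′)
    fl : Track → List Bool
    fl k = flags k cs′
    cs-length : length cs′ ≡ n
    cs-length = trans (promote-length cs) (trace-length tr)
    fl-length : ∀ k → length (fl k) ≡ n
    fl-length k = trans (length-map _ cs′) cs-length
    holds : ∀ k j → get k (view (τ₀ j)) ≡ spread (fl k) (initTape (V k) (input k)) j
    holds k = carries-spread (promote-carries (C k))
    first₀ : ∀ j → first (view (τ₀ j)) ≡ (j ≡ᵇ 0)
    first₀ = promote-first 0<n tr
    end : tapeOf (map ext cs′) n ≡ blk
    end = trans (cong (tapeOf (map ext cs′)) (sym (trans (length-map ext cs′) cs-length))) (tapeOf-end (map ext cs′))
    -- The first blank cell ends the marking pass in whatever state it is, so a trailing tag without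
    -- a bit in v is tolerated.
    enter : Steps 1 (running (mk q) , n , τ₀) (running (rw ky false) , moveHead left n , τ₀)
    enter = steps-one-keep {d = left} (trans (cong (δ (just (mk q))) end) (cong (λ c → inj₁ (rw ky false) , c , left) (sym end)))
    p₀≤ : moveHead left n ≤ n + T
    p₀≤ = ≤-trans (pred≤ n) (m≤m+n n T)
      where
      pred≤ : ∀ n → moveHead left n ≤ n
      pred≤ zero    = z≤n
      pred≤ (suc n) = n≤1+n n
    go : HaltsWithin machine u (verifierTime n T) (verdict (decide (isAcc ∘ h)))
    go with p₁ , τ₁ , p₁≤ , F₁ , f₁ , s₁ ← stage ky {false} {w = input ky} (fl ky) (fl-length ky) p₀≤ first₀ (holds ky) (halts ky)
       with p₂ , τ₂ , p₂≤ , F₂ , f₂ , s₂ ← stage kx {isAcc (h ky)} {w = input kx} (fl kx) (fl-length kx) p₁≤ f₁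
              (λ j → trans (cong (get kx) (F₁ j)) (holds kx j)) (halts kx)
       with p₃ , τ₃ , p₃≤ , F₃ , f₃ , s₃ ← stage kz {isAcc (h ky) ∧ isAcc (h kx)} {w = input kz} (fl kz) (fl-length kz) p₂≤ f₂
              (λ j → trans (cong (get kz) (F₂ j)) (trans (cong (get kz) (F₁ j)) (holds kz j))) (halts kz)
       with p₄ , τ₄ , p₄≤ , F₄ , f₄ , s₄ ← stage cy {(isAcc (h ky) ∧ isAcc (h kx)) ∨ isAcc (h kz)} {w = input cy} (fl cy) (fl-length cy) p₃≤ f₃
              (λ j → trans (cong (get cy) (F₃ j)) (trans (cong (get cy) (F₂ j)) (trans (cong (get cy) (F₁ j)) (holds cy j)))) (halts cy)
       with p₅ , τ₅ , p₅≤ , F₅ , f₅ , s₅ ← stage cx {((isAcc (h ky) ∧ isAcc (h kx)) ∨ isAcc (h kz)) ∧ isAcc (h cy)} {w = input cx} (fl cx) (fl-length cx) p₄≤ f₄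
              (λ j → trans (cong (get cx) (F₄ j)) (trans (cong (get cx) (F₃ j)) (trans (cong (get cx) (F₂ j))
                       (trans (cong (get cx) (F₁ j)) (holds cx j))))) (halts cx)
       = steps-halts {w = u} (steps-trans (starts tr 0<n) (steps-trans enter
           (steps-trans s₁ (steps-trans s₂ (steps-trans s₃ (steps-trans s₄ s₅))))))

-- Polynomial bounds

-- The base is 2 + n rather than n, so that constants are powers of it even at n = 0.
PolyBounded : (ℕ → ℕ) → Set
PolyBounded g = ∃[ c ] ∀ n → g n ≤ (2 + n) ^ c

n<2^n : ∀ n → n < 2 ^ n
n<2^n zero    = s≤s z≤n
n<2^n (suc n) = ≤-trans (+-mono-≤ {1} {2 ^ n} (m^n>0 2 n) (n<2^n n)) (≤-reflexive (cong (2 ^ n +_) (sym (+-identityʳ (2 ^ n)))))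

pb-const : ∀ k → PolyBounded (λ _ → k)
pb-const k = k , λ n → ≤-trans (<⇒≤ (n<2^n k)) (^-monoˡ-≤ k (m≤m+n 2 n))

pb-id : PolyBounded (λ n → n)
pb-id = 1 , λ n → ≤-trans (m≤n+m n 2) (≤-reflexive (sym (^-identityʳ (2 + n))))

pb-* : ∀ {f g} → PolyBounded f → PolyBounded g → PolyBounded (λ n → f n * g n)
pb-* (c , h) (d , i) = c + d , λ n → ≤-trans (*-mono-≤ (h n) (i n)) (≤-reflexive (sym (^-distribˡ-+-* (2 + n) c d)))

pb-+ : ∀ {f g} → PolyBounded f → PolyBounded g → PolyBounded (λ n → f n + g n)
pb-+ {f} {g} (c , h) (d , i) = 1 + (c + d) , λ n → begin
  f n + g n                         ≤⟨ +-mono-≤ (h n) (i n) ⟩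
  (2 + n) ^ c + (2 + n) ^ d         ≤⟨ +-mono-≤ (^-monoʳ-≤ (2 + n) (m≤m+n c d)) (^-monoʳ-≤ (2 + n) (m≤n+m d c)) ⟩
  (2 + n) ^ (c + d) + (2 + n) ^ (c + d) ≡⟨ cong ((2 + n) ^ (c + d) +_) (sym (+-identityʳ _)) ⟩
  2 * (2 + n) ^ (c + d)             ≤⟨ *-monoˡ-≤ ((2 + n) ^ (c + d)) (m≤m+n 2 n) ⟩
  (2 + n) ^ (1 + (c + d))           ∎
  where open ≤-Reasoning

pb-^ : ∀ {f} k → PolyBounded f → PolyBounded (λ n → f n ^ k)
pb-^ zero    p = pb-const 1
pb-^ (suc k) p = pb-* p (pb-^ k p)

pb-poly : ∀ {f} c → PolyBounded f → PolyBounded (λ n → poly c (f n))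
pb-poly c p = pb-+ (pb-^ c p) (pb-const c)

pb-suc : ∀ {f} → PolyBounded f → PolyBounded (λ n → suc (f n))
pb-suc = pb-+ (pb-const 1)

poly-mono : ∀ c {m n} → m ≤ n → poly c m ≤ poly c n
poly-mono c m≤n = +-monoˡ-≤ c (^-monoˡ-≤ c m≤n)

-- For n at least 2, the inequality 2 + n ≤ n * n turns the exponent c into 2 * c. For n = 0 and n =
-- 1 the additive constant of `poly` takes over, which is why `d` contains `3 ^ c`.
pb⇒poly : ∀ {f} → PolyBounded f → ∃[ c ] ∀ n → f n ≤ poly c n
pb⇒poly {f} (c , h) = d , λ n → ≤-trans (h n) (bound n)
  where
  d = (c + c) + 3 ^ c
  bound : ∀ n → (2 + n) ^ c ≤ poly d n
  bound 0 = ≤-trans (^-monoˡ-≤ c (n≤1+n 2)) (≤-trans (m≤n+m (3 ^ c) (c + c)) (m≤n+m d (0 ^ d)))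
  bound 1 = ≤-trans (m≤n+m (3 ^ c) (c + c)) (m≤n+m d (1 ^ d))
  bound n@(suc (suc m)) = begin
    (2 + n) ^ c       ≤⟨ ^-monoˡ-≤ c 2+n≤n*n ⟩
    (n * n) ^ c       ≡⟨ cong (λ x → (n * x) ^ c) (sym (*-identityʳ n)) ⟩
    (n ^ 2) ^ c       ≡⟨ ^-*-assoc n 2 c ⟩
    n ^ (2 * c)       ≤⟨ ^-monoʳ-≤ n (≤-trans (≤-reflexive (cong (c +_) (+-identityʳ c))) (m≤m+n (c + c) (3 ^ c))) ⟩
    n ^ d             ≤⟨ m≤m+n (n ^ d) d ⟩
    poly d n          ∎
    where
    open ≤-Reasoning
    2+n≤n*n : 2 + n ≤ n * n
    2+n≤n*n = ≤-trans (+-monoˡ-≤ n (s≤s (s≤s (z≤n {m})))) (≤-trans (≤-reflexive (cong (n +_) (sym (+-identityʳ n)))) (*-monoˡ-≤ n (s≤s (s≤s (z≤n {m})))))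

-- Boolean connectives and exhaustive search over words

∧-true : ∀ {a b} → a ∧ b ≡ true → a ≡ true × b ≡ true
∧-true {true} e = refl , e

∨-true : ∀ {a b} → a ∨ b ≡ true → a ≡ true ⊎ b ≡ true
∨-true {true}  e = inj₁ refl
∨-true {false} e = inj₂ e

∨-introˡ : ∀ {a b} → a ≡ true → a ∨ b ≡ true
∨-introˡ refl = refl

∨-introʳ : ∀ {a b} → b ≡ true → a ∨ b ≡ true
∨-introʳ {true}  e = refl
∨-introʳ {false} e = e

bool-ext : ∀ {a b} → (a ≡ true → b ≡ true) → (b ≡ true → a ≡ true) → a ≡ b
bool-ext {true}          f g = sym (f refl)
bool-ext {false} {true}  f g = g refl
bool-ext {false} {false} f g = refl

-- Languages are Boolean functions, so quantifiers over words have to be computed. The recursion on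
-- length has the shape of the disjunction trees by which circuits later carry out the same
-- searches.
anyOfLength anyUpTo : ℕ → (Word → Bool) → Bool
anyOfLength zero    P = P []
anyOfLength (suc n) P = anyOfLength n (P ∘ (false ∷_)) ∨ anyOfLength n (P ∘ (true ∷_))
anyUpTo zero    P = P []
anyUpTo (suc n) P = P [] ∨ (anyUpTo n (P ∘ (false ∷_)) ∨ anyUpTo n (P ∘ (true ∷_)))

anyOfLength-sound : ∀ n P → anyOfLength n P ≡ true → ∃[ w ] (length w ≡ n × P w ≡ true)
anyOfLength-sound zero    P e = [] , refl , e
anyOfLength-sound (suc n) P e with ∨-true e
... | inj₁ e′ = let (w , l , p) = anyOfLength-sound n _ e′ in false ∷ w , cong suc l , p
... | inj₂ e′ = let (w , l , p) = anyOfLength-sound n _ e′ in true ∷ w , cong suc l , p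

anyOfLength-complete : ∀ w P → P w ≡ true → anyOfLength (length w) P ≡ true
anyOfLength-complete []          P p = p
anyOfLength-complete (false ∷ w) P p = ∨-introˡ (anyOfLength-complete w _ p)
anyOfLength-complete (true ∷ w)  P p = ∨-introʳ (anyOfLength-complete w _ p)

anyUpTo-sound : ∀ n P → anyUpTo n P ≡ true → ∃[ w ] (length w ≤ n × P w ≡ true)
anyUpTo-sound zero    P e = [] , z≤n , e
anyUpTo-sound (suc n) P e with ∨-true e
... | inj₁ p = [] , z≤n , p
... | inj₂ e′ with ∨-true e′
... | inj₁ e″ = let (w , l , p) = anyUpTo-sound n _ e″ in false ∷ w , s≤s l , p
... | inj₂ e″ = let (w , l , p) = anyUpTo-sound n _ e″ in true ∷ w , s≤s l , p

anyUpTo-complete : ∀ {n} w P → length w ≤ n → P w ≡ true → anyUpTo n P ≡ true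
anyUpTo-complete {zero}  []          P l       p = p
anyUpTo-complete {suc n} []          P l       p = ∨-introˡ p
anyUpTo-complete {suc n} (false ∷ w) P (s≤s l) p = ∨-introʳ {P []} (∨-introˡ (anyUpTo-complete w _ l p))
anyUpTo-complete {suc n} (true ∷ w)  P (s≤s l) p = ∨-introʳ {P []} (∨-introʳ (anyUpTo-complete w _ l p))

-- The language S and its membership in NP

advice : ℕ → ℕ → Word → Word → Word
advice b a x z = pair x (pair z (pair (replicate b false) (pair (replicate a false) [])))

pick-cy : ∀ v → pick cy v ≡ pick ky v
pick-cy []              = refl
pick-cy (_ ∷ [])        = refl
pick-cy (false ∷ b ∷ v) = pick-cy v
pick-cy (true ∷ b ∷ v)  = cong (b ∷_) (pick-cy v)

pick-kx : ∀ v → pick kx v ≡ pick cx v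
pick-kx []              = refl
pick-kx (_ ∷ [])        = refl
pick-kx (true ∷ b ∷ v)  = pick-kx v
pick-kx (false ∷ b ∷ v) = cong (b ∷_) (pick-kx v)

pick-kz : ∀ v → pick kz v ≡ pick cx v
pick-kz []              = refl
pick-kz (_ ∷ [])        = refl
pick-kz (true ∷ b ∷ v)  = pick-kz v
pick-kz (false ∷ b ∷ v) = cong (b ∷_) (pick-kz v)

isAcc-verdict : ∀ b → isAcc (verdict b) ≡ b
isAcc-verdict true  = refl
isAcc-verdict false = refl

module Combination {B L : Language} (B∈NP : InNP B) (L∈NP : InNP L) where

  private
    VB = proj₁ B∈NP
    cB = proj₁ (proj₂ B∈NP)
    VL = proj₁ L∈NP
    cL = proj₁ (proj₂ L∈NP)

  V : Track → TM
  V ky = VB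
  V kx = VL
  V kz = VL
  V cy = Comparison.machine
  V cx = Comparison.machine

  open Verification V
  open Verifier V using (machine; steps-halts)

  time : Track → ℕ → ℕ
  time ky = poly cB
  time kx = poly cL
  time kz = poly cL
  time cy = Comparison.comparisonTime
  time cx = Comparison.comparisonTime

  opaque
    total : ∀ k x v → Σ Halt λ h → HaltsWithin (V k) (pair x v) (time k (length (pair x v))) h
    total ky x v = proj₁ (proj₂ (proj₂ B∈NP)) x v
    total kx x v = proj₁ (proj₂ (proj₂ L∈NP)) x v
    total kz x v = proj₁ (proj₂ (proj₂ L∈NP)) x v
    total cy x v = verdict (length v ≤ᵇ length x) , Comparison.comparison x v
    total cx x v = verdict (length v ≤ᵇ length x) , Comparison.comparison x v

    total-cy : ∀ x v → isAcc (proj₁ (total cy x v)) ≡ (length v ≤ᵇ length x)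
    total-cy x v = isAcc-verdict _

    total-cx : ∀ x v → isAcc (proj₁ (total cx x v)) ≡ (length v ≤ᵇ length x)
    total-cx x v = isAcc-verdict _

  trackTime : ℕ → ℕ
  trackTime n = poly cB n + (poly cL n + Comparison.comparisonTime n)

  comparisonTime-mono : ∀ {m n} → m ≤ n → Comparison.comparisonTime m ≤ Comparison.comparisonTime n
  comparisonTime-mono le = +-mono-≤ le (+-monoˡ-≤ 1 (*-mono-≤ le (s≤s (s≤s (+-mono-≤ le le)))))

  time≤ : ∀ k {m n} → m ≤ n → time k m ≤ trackTime n
  time≤ ky le = ≤-trans (poly-mono cB le) (m≤m+n _ _)
  time≤ kx {n = n} le = ≤-trans (≤-trans (poly-mono cL le) (m≤m+n _ _)) (m≤n+m _ (poly cB n))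
  time≤ kz {n = n} le = ≤-trans (≤-trans (poly-mono cL le) (m≤m+n _ _)) (m≤n+m _ (poly cB n))
  time≤ cy {n = n} le = ≤-trans (≤-trans (comparisonTime-mono le) (m≤n+m _ (poly cL n))) (m≤n+m _ (poly cB n))
  time≤ cx {n = n} le = ≤-trans (≤-trans (comparisonTime-mono le) (m≤n+m _ (poly cL n))) (m≤n+m _ (poly cB n))

  input≤ : ∀ W r v k → length (pair (W k) (pick k v)) ≤ length (pair (bundle W r) v)
  input≤ W r v k = subst₂ _≤_ (sym (length-pair (W k) _)) (sym (length-pair (bundle W r) v))
    (+-mono-≤ (≤-trans (bundled-≤ W r k) (m≤m+n _ _)) (s≤s (s≤s (length-pick k v))))

  result : (Track → Word) → Word → Track → Halt
  result W v k = proj₁ (total k (W k) (pick k v))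

  totalTime : ℕ → ℕ
  totalTime n = verifierTime n (trackTime n)

  bundle-halts : ∀ W r v → HaltsWithin machine (pair (bundle W r) v) (totalTime (length (pair (bundle W r) v)))
                                               (verdict (decide (isAcc ∘ result W v)))
  bundle-halts W r v = verifies W r v _ (result W v) λ k →
    halted-later (V k) {pair (W k) (pick k v)} {time k (length (pair (W k) (pick k v)))} {trackTime (length (pair (bundle W r) v))} {result W v k} (time≤ k (input≤ W r v k)) (proj₂ (total k (W k) (pick k v)))

  halts : ∀ u v → Σ Halt λ h → HaltsWithin machine (pair u v) (totalTime (length (pair u v))) h
  halts u v with unbundle u
  ... | inj₁ (W , r , refl) = _ , bundle-halts W r v
  ... | inj₂ R = rej , halted-later machine {pair u v} {length (pair u v)} {totalTime (length (pair u v))} {rej} (m≤m+n _ _) (starts-rejects {pair u v} (R v))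

  opaque
    -- `InNP` uses one constant for the running time and for the length of witnesses. The summand n
    -- + n covers the latter: a tagged witness is at most twice as long as the query.
    exponent : ∃[ c ] ∀ n → totalTime n + (n + n) ≤ poly c n
    exponent = pb⇒poly (pb-+ (pb-+ pb-id (pb-suc (pb-+ st (pb-+ st (pb-+ st (pb-+ st st)))))) (pb-+ pb-id pb-id))
      where
      tt′ : PolyBounded trackTime
      tt′ = pb-+ (pb-poly cB pb-id) (pb-+ (pb-poly cL pb-id)
              (pb-+ pb-id (pb-+ (pb-* pb-id (pb-+ (pb-const 2) (pb-+ pb-id pb-id))) (pb-const 1))))
      st : PolyBounded (λ n → stageTime n (trackTime n))
      st = pb-+ (pb-suc (pb-+ pb-id tt′)) (pb-+ pb-id (pb-* tt′ (pb-+ (pb-const 2) (pb-+ pb-id pb-id))))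

  private
    c : ℕ
    c = proj₁ exponent

  isAccepting : ∀ {n} → Fin n ⊎ Halt → Bool
  isAccepting (inj₁ _) = false
  isAccepting (inj₂ h) = isAcc h

  opaque
    accepts : Word → Word → Bool
    accepts u v = isAccepting (stateAfter machine (pair u v) (poly c (length (pair u v))))

    -- Defining S by what the machine accepts makes its membership in NP immediate. Its meaning is
    -- settled only on queries with the intended padding and x, z of equal length, and these are the
    -- only words to which the reduction is applied.
    S : Language
    S u = anyUpTo (poly c (length u)) (accepts u)

    halts-poly : ∀ u v {h} → HaltsWithin machine (pair u v) (totalTime (length (pair u v))) h →
            HaltsWithin machine (pair u v) (poly c (length (pair u v))) h
    halts-poly u v {h} = halted-later machine {pair u v} {totalTime (length (pair u v))} {poly c (length (pair u v))} {h} (≤-trans (m≤m+n _ (length (pair u v) + length (pair u v))) (proj₂ exponent (length (pair u v))))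

    accepting : ∀ {n} {s : Fin n ⊎ Halt} → isAccepting s ≡ true → s ≡ inj₂ acc
    accepting {s = inj₂ acc} e = refl

    S-elim : ∀ u → S u ≡ true → ∃[ v ] accepts u v ≡ true
    S-elim u e = let (v , _ , a) = anyUpTo-sound (poly c (length u)) (accepts u) e in v , a

    S-intro : ∀ u v → length v ≤ poly c (length u) → accepts u v ≡ true → S u ≡ true
    S-intro u v l a = anyUpTo-complete v (accepts u) l a

    S∈NP : InNP S
    S∈NP = machine , c , (λ u v → let (h , e) = halts u v in h , halts-poly u v e) ,
      λ u → mk⇔ (λ e → let (v , l , a) = anyUpTo-sound (poly c (length u)) (accepts u) e in v , l , accepting a)
                (λ (v , l , a) → anyUpTo-complete v (accepts u) l (cong isAccepting a))

    accepts-bundle : ∀ W r v → accepts (bundle W r) v ≡ decide (isAcc ∘ result W v)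
    accepts-bundle W r v = trans (cong isAccepting (halts-poly (bundle W r) v (bundle-halts W r v))) (isAcc-verdict _)

  -- The paddings are the witness bounds for B and L in unary. With them in the query, the verifier
  -- compares lengths instead of evaluating polynomials. Apart from y itself, the query depends on y
  -- only through its length, so the rest can be advice.
  query : Word → Word → Word → Word
  query y x z = pair y (advice (poly cB (length y)) (poly cL (length x)) x z)

  module _ (y x z : Word) (|z|≡|x| : length z ≡ length x) where

    private
      b = poly cB (length y)
      a = poly cL (length x)

      W : Track → Word
      W ky = y
      W kx = x
      W kz = z
      W cy = replicate b false
      W cx = replicate a false

      module B = Equivalence (proj₂ (proj₂ (proj₂ B∈NP)) y)
      module L (x : Word) = Equivalence (proj₂ (proj₂ (proj₂ L∈NP)) x)

      h₂ : Word → Track → Bool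
      h₂ v k = isAcc (result W v k)

      h₁ : Word → Bool
      h₁ v = (h₂ v ky ∧ h₂ v kx) ∨ h₂ v kz

      accepted : ∀ k {v} → isAcc (result W v k) ≡ true →
                 HaltsWithin (V k) (pair (W k) (pick k v)) (time k (length (pair (W k) (pick k v)))) acc
      accepted k {v} e with total k (W k) (pick k v)
      ... | acc , h = h

      acceptedBy : ∀ k {v w} → pick k v ≡ w → HaltsWithin (V k) (pair (W k) w) (time k (length (pair (W k) w))) acc →
                   isAcc (result W v k) ≡ true
      acceptedBy k {v} refl h with total k (W k) (pick k v)
      ... | h′ , e with refl ← trans (sym e) h = refl

      fits : ∀ {v : Word} {n} {t : Bool} → t ≡ (length v ≤ᵇ length (replicate n false)) → t ≡ true → length v ≤ n
      fits {v} {n} eq e = subst (length v ≤_) (length-replicate n) (≤ᵇ⇒≤ _ _ (subst Data.Bool.T (trans (sym e) eq) _))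

      fits-intro : ∀ {v : Word} {n} {t : Bool} → t ≡ (length v ≤ᵇ length (replicate n false)) → length v ≤ n → t ≡ true
      fits-intro {v} {n} eq le with length v ≤ᵇ length (replicate n false) in eq′
      ... | true  = eq
      ... | false with () ← subst Data.Bool.T eq′ (≤⇒≤ᵇ (subst (length v ≤_) (sym (length-replicate n)) le))

    -- An accepting run proves membership only if the witness obeys the bound in `InNP`, and the
    -- tracks `cy` and `cx` guarantee this. The single check `cx` is right for both x and z because
    -- their lengths agree.
    S-sound : S (query y x z) ≡ true → (B y ∧ L x) ∨ L z ≡ true
    S-sound e with S-elim (query y x z) e
    ... | v , acc-v with ∧-true {(h₁ v ∧ h₂ v cy)} {h₂ v cx} (trans (sym (accepts-bundle W [] v)) acc-v)
    ... | e₁ , ecx with ∧-true {h₁ v} {h₂ v cy} e₁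
    ... | e₂ , ecy with ∨-true {h₂ v ky ∧ h₂ v kx} {h₂ v kz} e₂
    ... | inj₂ ez = ∨-introʳ {B y ∧ L x} (L.from z (pick kz v ,
            subst₂ (λ w n → length w ≤ poly cL n) (sym (pick-kz v)) (sym |z|≡|x|) (fits {pick cx v} {a} (total-cx (W cx) (pick cx v)) ecx) , accepted kz {v} ez))
    ... | inj₁ e₃ with ∧-true {h₂ v ky} {h₂ v kx} e₃
    ... | ey , ex = ∨-introˡ (cong₂ _∧_
            (B.from (pick ky v , subst (λ w → length w ≤ b) (pick-cy v) (fits {pick cy v} {b} (total-cy (W cy) (pick cy v)) ecy) , accepted ky {v} ey))
            (L.from x (pick kx v , subst (λ w → length w ≤ a) (sym (pick-kx v)) (fits {pick cx v} {a} (total-cx (W cx) (pick cx v)) ecx) , accepted kx {v} ex)))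

    private
      witness : Word → Word → Word
      witness vy vx = tagWith true vy ++ (tagWith false vx ++ [])

      witness-length : ∀ vy vx → length vy ≤ b → length vx ≤ a →
                       length (witness vy vx) ≤ poly c (length (query y x z))
      witness-length vy vx l l′ = begin
        length (witness vy vx)                                      ≡⟨ cong (λ w → length (tagWith true vy ++ w)) (++-identityʳ _) ⟩
        length (tagWith true vy ++ tagWith false vx)                ≡⟨ length-++ (tagWith true vy) ⟩
        length (tagWith true vy) + length (tagWith false vx)        ≡⟨ cong₂ _+_ (length-tagWith true vy) (length-tagWith false vx) ⟩
        (length vy + length vy) + (length vx + length vx)           ≤⟨ +-mono-≤ (+-mono-≤ l₁ l₁) (+-mono-≤ l₂ l₂) ⟩
        (length (W cy) + length (W cy)) + (length (W cx) + length (W cx)) ≤⟨ +-mono-≤ (bundled-≤ W [] cy) (bundled-≤ W [] cx) ⟩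
        n + n                                                       ≤⟨ m≤n+m (n + n) (totalTime n) ⟩
        totalTime n + (n + n)                                       ≤⟨ proj₂ exponent n ⟩
        poly c n                                                    ∎
        where
        open ≤-Reasoning
        n = length (query y x z)
        l₁ : length vy ≤ length (W cy)
        l₁ = subst (length vy ≤_) (sym (length-replicate b)) l
        l₂ : length vx ≤ length (W cx)
        l₂ = subst (length vx ≤_) (sym (length-replicate a)) l′

      pick-true : ∀ k vy vx → tag k ≡ true → pick k (witness vy vx) ≡ vy
      pick-true k vy vx e = trans (pick-tagged k true vy _ e)
        (trans (cong (vy ++_) (pick-untagged k false vx [] (cong not e))) (++-identityʳ vy))

      pick-false : ∀ k vy vx → tag k ≡ false → pick k (witness vy vx) ≡ vx
      pick-false k vy vx e = trans (pick-untagged k true vy _ e)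
        (trans (pick-tagged k false vx [] (cong not e)) (++-identityʳ vx))

      conclude : ∀ vy vx → length vy ≤ b → length vx ≤ a →
                 let v = witness vy vx in
                 (isAcc (result W v ky) ∧ isAcc (result W v kx)) ∨ isAcc (result W v kz) ≡ true →
                 S (query y x z) ≡ true
      conclude vy vx l l′ e = S-intro (query y x z) v (witness-length vy vx l l′)
        (trans (accepts-bundle W [] v) (cong₂ _∧_ (cong₂ _∧_ e
          (fits-intro {pick cy v} {b} (total-cy (W cy) (pick cy v)) (subst (λ w → length w ≤ b) (sym (pick-true cy vy vx refl)) l)))
          (fits-intro {pick cx v} {a} (total-cx (W cx) (pick cx v)) (subst (λ w → length w ≤ a) (sym (pick-false cx vy vx refl)) l′))))
        where v = witness vy vx

    S-complete : (B y ∧ L x) ∨ L z ≡ true → S (query y x z) ≡ true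
    S-complete e with ∨-true e
    ... | inj₂ ez with L.to z ez
    ... | vz , l , h = conclude [] vz z≤n (subst (λ n → length vz ≤ poly cL n) |z|≡|x| l)
            (∨-introʳ {isAcc (result W (witness [] vz) ky) ∧ isAcc (result W (witness [] vz) kx)}
              (acceptedBy kz {witness [] vz} (pick-false kz [] vz refl) h))
    S-complete e | inj₁ e′ with ∧-true e′
    ... | ey , ex with B.to ey | L.to x ex
    ... | vy , l , h | vx , l′ , h′ = conclude vy vx l l′ (∨-introˡ (cong₂ _∧_
            (acceptedBy ky {witness vy vx} (pick-true ky vy vx refl) h) (acceptedBy kx {witness vy vx} (pick-false kx vy vx refl) h′)))

    S-query : S (query y x z) ≡ (B y ∧ L x) ∨ L z
    S-query = bool-ext S-sound S-complete

-- Equality and search on finite index sets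

open Finite

eqF : ∀ {n} → Fin n → Fin n → Bool
eqF i j = toℕ i ≡ᵇ toℕ j

≡ᵇ-refl : ∀ n → (n ≡ᵇ n) ≡ true
≡ᵇ-refl zero    = refl
≡ᵇ-refl (suc n) = ≡ᵇ-refl n

≡ᵇ-sound : ∀ m n → (m ≡ᵇ n) ≡ true → m ≡ n
≡ᵇ-sound m n e = ≡ᵇ⇒≡ m n (subst Data.Bool.T (sym e) _)

eqF-sound : ∀ {n} (i j : Fin n) → eqF i j ≡ true → i ≡ j
eqF-sound i j e = toℕ-injective (≡ᵇ-sound _ _ e)

eqF-refl : ∀ {n} (i : Fin n) → eqF i i ≡ true
eqF-refl i = ≡ᵇ-refl (toℕ i)

anyFin : ∀ n → (Fin n → Bool) → Bool
anyFin zero    P = false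
anyFin (suc n) P = P zero ∨ anyFin n (P ∘ suc)

anyFin-sound : ∀ n P → anyFin n P ≡ true → ∃[ i ] P i ≡ true
anyFin-sound (suc n) P e with ∨-true {P zero} e
... | inj₁ p = zero , p
... | inj₂ q = let (i , p) = anyFin-sound n (P ∘ suc) q in suc i , p

anyFin-complete : ∀ n P i → P i ≡ true → anyFin n P ≡ true
anyFin-complete (suc n) P zero    p = ∨-introˡ p
anyFin-complete (suc n) P (suc i) p = ∨-introʳ {P zero} (anyFin-complete n (P ∘ suc) i p)

-- Circuits for polynomial-time computations

module Circuits (m : ℕ) where

  Fn : Set
  Fn = Vec Bool m → Bool

  Wire : ∀ {s} → Gates m s → Fn → Set
  Wire {s} G φ = Σ (Fin (s + m)) λ i → ∀ x → lookup (wires G x) i ≡ φ x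

  -- Cost is measured in gates added to a circuit whose wires all remain available, so values once
  -- computed are shared and never recomputed.
  record Extension {s} (G : Gates m s) (b : ℕ) (P : ∀ {s′} → Gates m s′ → Set) : Set where
    constructor extension
    field
      {s′}  : ℕ
      G′    : Gates m s′
      size≤ : s′ ≤ s + b
      keeps : ∀ φ → Wire G φ → Wire G′ φ
      holds : P G′

  -- φ can be computed from the values ρ i with at most b additional gates.
  Cost : {I : Set} → (I → Fn) → ℕ → Fn → Set
  Cost ρ b φ = ∀ {s} (G : Gates m s) → (∀ i → Wire G (ρ i)) → Extension G b (λ G′ → Wire G′ φ)

  extend : ∀ {s} (G : Gates m s) g {φ} → (∀ x → evalGate g (wires G x) ≡ φ x) → Extension G 1 (λ G′ → Wire G′ φ)
  extend {s} G g e = extension (G ▷ g) (≤-reflexive (+-comm 1 s)) (λ φ (i , w) → suc i , w) (zero , e)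

  _then_ : ∀ {s} {G : Gates m s} {b c} {P Q : ∀ {s′} → Gates m s′ → Set} → Extension G b P →
         (∀ {s′} (G′ : Gates m s′) → (∀ φ → Wire G φ → Wire G′ φ) → P G′ → Extension G′ c Q) →
         Extension G (b + c) Q
  _then_ {s} {b = b} {c} (extension G′ sz keep p) f with f G′ keep p
  ... | extension G″ sz′ keep′ q = extension G″
        (≤-trans sz′ (≤-trans (+-monoˡ-≤ c sz) (≤-reflexive (+-assoc s b c)))) (λ φ → keep′ φ ∘ keep φ) q

  module _ {I : Set} {ρ : I → Fn} where

    cost-var : ∀ i → Cost ρ 0 (ρ i)
    cost-var i {s} G w = extension G (≤-reflexive (sym (+-identityʳ s))) (λ _ → id) (w i)

    cost-≤ : ∀ {b c φ} → b ≤ c → Cost ρ b φ → Cost ρ c φ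
    cost-≤ b≤c C {s} G w with C G w
    ... | extension G′ sz keep p = extension G′ (≤-trans sz (+-monoʳ-≤ s b≤c)) keep p

    cost-≗ : ∀ {b φ ψ} → (∀ x → φ x ≡ ψ x) → Cost ρ b φ → Cost ρ b ψ
    cost-≗ e C G w with C G w
    ... | extension G′ sz keep (i , p) = extension G′ sz keep (i , λ x → trans (p x) (e x))

    cost-gate₂ : ∀ {b c φ ψ} (gate : ∀ {k} → Fin k → Fin k → Gate k) (op : Bool → Bool → Bool) →
                 (∀ {k} i j (v : Vec Bool k) → evalGate (gate i j) v ≡ op (lookup v i) (lookup v j)) →
                 Cost ρ b φ → Cost ρ c ψ → Cost ρ (b + (c + 1)) (λ x → op (φ x) (ψ x))
    cost-gate₂ {φ = φ} gate op e C D G w =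
      C G w then λ G₁ k₁ p → D G₁ (λ i → k₁ _ (w i)) then λ G₂ k₂ (j , q) →
        let (i , p′) = k₂ φ p in
        extend G₂ (gate i j) (λ x → trans (e i j (wires G₂ x)) (cong₂ op (p′ x) (q x)))

    cost-∧ : ∀ {b c φ ψ} → Cost ρ b φ → Cost ρ c ψ → Cost ρ (b + (c + 1)) (λ x → φ x ∧ ψ x)
    cost-∧ C D = cost-gate₂ AND _∧_ (λ _ _ _ → refl) C D

    cost-∨ : ∀ {b c φ ψ} → Cost ρ b φ → Cost ρ c ψ → Cost ρ (b + (c + 1)) (λ x → φ x ∨ ψ x)
    cost-∨ C D = cost-gate₂ OR _∨_ (λ _ _ _ → refl) C D

    cost-not : ∀ {b φ} → Cost ρ b φ → Cost ρ (b + 1) (λ x → not (φ x))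
    cost-not C G w = C G w then λ G₁ _ (i , p) → extend G₁ (NOT i) (λ x → cong not (p x))

    private
      wires-all : ∀ n {b} (χ : Fin n → Fn) → (∀ i → Cost ρ b (χ i)) → ∀ {s} (G : Gates m s) →
                  (∀ i → Wire G (ρ i)) → Extension G (n * b) (λ G′ → ∀ i → Wire G′ (χ i))
      wires-all zero χ C {s} G w = extension G (≤-reflexive (sym (+-identityʳ s))) (λ _ → id) (λ ())
      wires-all (suc n) χ C G w = C zero G w then λ G₁ k₁ p →
        wires-all n (χ ∘ suc) (C ∘ suc) G₁ (λ i → k₁ _ (w i)) then′ p
        where
        _then′_ : ∀ {s} {G : Gates m s} {b} → Extension G b (λ G′ → ∀ i → Wire G′ (χ (suc i))) → Wire G (χ zero) →
                  Extension G b (λ G′ → ∀ i → Wire G′ (χ i))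
        extension G′ sz keep q then′ p = extension G′ sz keep (λ { zero → keep _ p ; (suc i) → q i })

    -- The values ψ are computed once and then read as often as desired. This sharing makes the
    -- costs of successive machine steps add up; substituting formulas into each other would
    -- multiply them.
    cost-let : ∀ {J b c φ} (F : Finite J) {ψ : J → Fn} → (∀ j → Cost ρ b (ψ j)) → Cost ψ c φ →
               Cost ρ (size F * b + c) φ
    cost-let F {ψ} C D G w = wires-all (size F) (ψ ∘ dec F) (λ i → C (dec F i)) G w then λ G₁ _ p →
      D G₁ (λ j → subst (λ i → Wire G₁ (ψ i)) (dec-enc F j) (p (enc F j)))

    module _ (i₀ : I) where

      -- There are no constant gates, so a constant is made from some existing wire. This is why the
      -- circuits for L are built at positive input length.
      cost-const : ∀ b → Cost ρ 2 (λ _ → b)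
      cost-const true  = cost-≗ (λ x → ∨-inverseʳ (ρ i₀ x)) (cost-∨ (cost-var i₀) (cost-not (cost-var i₀)))
      cost-const false = cost-≗ (λ x → ∧-inverseʳ (ρ i₀ x)) (cost-∧ (cost-var i₀) (cost-not (cost-var i₀)))

      -- The bit b is fixed when the circuit is built. In this way values of B, the table of A and
      -- the transition table are hardwired, however hard they are to compute.
      cost-guard : ∀ {c φ} b → Cost ρ c φ → Cost ρ (c + 2) (λ x → b ∧ φ x)
      cost-guard {c} true  C = cost-≤ (m≤m+n c 2) C
      cost-guard {c} false C = cost-≤ (m≤n+m 2 c) (cost-const false)

      cost-unary : ∀ {c φ} (g : Bool → Bool) → Cost ρ c φ → Cost ρ (c + 2) (λ x → g (φ x))
      cost-unary {c} {φ} g C with g true in t | g false in f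
      ... | true  | true  = cost-≗ (λ x → constant (φ x)) (cost-≤ (m≤n+m 2 c) (cost-const true))
        where constant : ∀ b → true ≡ g b
              constant true  = sym t
              constant false = sym f
      ... | false | false = cost-≗ (λ x → constant (φ x)) (cost-≤ (m≤n+m 2 c) (cost-const false))
        where constant : ∀ b → false ≡ g b
              constant true  = sym t
              constant false = sym f
      ... | true  | false = cost-≗ (λ x → same (φ x)) (cost-≤ (m≤m+n c 2) C)
        where same : ∀ b → b ≡ g b
              same true  = sym t
              same false = sym f
      ... | false | true  = cost-≗ (λ x → negated (φ x)) (cost-≤ (+-monoʳ-≤ c (n≤1+n 1)) (cost-not C))
        where negated : ∀ b → not b ≡ g b
              negated true  = sym t
              negated false = sym f

      cost-anyFin : ∀ n {b} {P : Fin n → Fn} → (∀ i → Cost ρ b (P i)) →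
                    Cost ρ (n * (b + 1) + 2) (λ x → anyFin n (λ i → P i x))
      cost-anyFin zero        C = cost-const false
      cost-anyFin (suc n) {b} C = cost-≤ (≤-reflexive eq) (cost-∨ (C zero) (cost-anyFin n (C ∘ suc)))
        where
        eq : b + (n * (b + 1) + 2 + 1) ≡ suc n * (b + 1) + 2
        eq = trans (cong (b +_) (+-comm (n * (b + 1) + 2) 1)) (trans (sym (+-assoc b 1 _)) (sym (+-assoc (b + 1) _ 2)))

      cost-any : ∀ {A : Set} {b} {P : A → Fn} (as : List A) → (∀ a → Cost ρ b (P a)) →
                 Cost ρ (length as * (b + 1) + 2) (λ x → any (λ a → P a x) as)
      cost-any []           C = cost-const false
      cost-any {b = b} (a ∷ as) C = cost-≤ (≤-reflexive eq) (cost-∨ (C a) (cost-any as C))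
        where
        eq : b + (length as * (b + 1) + 2 + 1) ≡ suc (length as) * (b + 1) + 2
        eq = trans (cong (b +_) (+-comm (length as * (b + 1) + 2) 1)) (trans (sym (+-assoc b 1 _)) (sym (+-assoc (b + 1) _ 2)))

    cost-anyOfLength : ∀ n {b} {P : Vec Bool m → Word → Bool} → (∀ w → length w ≡ n → Cost ρ b (λ x → P x w)) →
                       Cost ρ (2 ^ n * (b + 1)) (λ x → anyOfLength n (P x))
    cost-anyOfLength n {b} {P} C = cost-≤ (≤-trans (m≤m+n _ 1) (≤-reflexive (eq n))) (go n C)
      where
      K : ℕ → ℕ
      K zero    = b
      K (suc n) = K n + (K n + 1)
      eq : ∀ n → K n + 1 ≡ 2 ^ n * (b + 1)
      eq zero    = sym (+-identityʳ (b + 1))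
      eq (suc n) = trans (+-assoc (K n) (K n + 1) 1)
        (trans (cong (K n +_) (trans (cong (_+ 1) (+-comm (K n) 1)) (+-assoc 1 (K n) 1)))
        (trans (sym (+-assoc (K n) 1 (K n + 1)))
        (trans (cong₂ _+_ (eq n) (eq n)) (trans (cong (2 ^ n * (b + 1) +_) (sym (+-identityʳ _))) (sym (*-assoc 2 (2 ^ n) (b + 1)))))))
      go : ∀ n {P : Vec Bool m → Word → Bool} → (∀ w → length w ≡ n → Cost ρ b (λ x → P x w)) →
           Cost ρ (K n) (λ x → anyOfLength n (P x))
      go zero    C = C [] refl
      go (suc n) C = cost-∨ (go n (λ w l → C (false ∷ w) (cong suc l))) (go n (λ w l → C (true ∷ w) (cong suc l)))

    cost-anyUpTo : ∀ n {b} {P : Vec Bool m → Word → Bool} → (∀ w → length w ≤ n → Cost ρ b (λ x → P x w)) →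
                   Cost ρ (2 ^ n * (2 * (b + 1))) (λ x → anyUpTo n (P x))
    cost-anyUpTo n {b} {P} C = cost-≤ (≤-trans (m≤m+n _ (b + 2)) (≤-reflexive (eq n))) (go n C)
      where
      open ≡-Reasoning
      K : ℕ → ℕ
      K zero    = b
      K (suc n) = b + ((K n + (K n + 1)) + 1)
      open +-*-Solver
      eq : ∀ n → K n + (b + 2) ≡ 2 ^ n * (2 * (b + 1))
      eq zero    = solve 1 (λ b → b :+ (b :+ con 2) := (con 2 :* (b :+ con 1)) :+ con 0) refl b
      eq (suc n) = begin
        b + ((K n + (K n + 1)) + 1) + (b + 2)
          ≡⟨ solve 2 (λ k b → b :+ ((k :+ (k :+ con 1)) :+ con 1) :+ (b :+ con 2) := con 2 :* (k :+ (b :+ con 2))) refl (K n) b ⟩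
        2 * (K n + (b + 2))             ≡⟨ cong (2 *_) (eq n) ⟩
        2 * (2 ^ n * (2 * (b + 1)))     ≡⟨ sym (*-assoc 2 (2 ^ n) _) ⟩
        2 ^ suc n * (2 * (b + 1))       ∎
      go : ∀ n {P : Vec Bool m → Word → Bool} → (∀ w → length w ≤ n → Cost ρ b (λ x → P x w)) →
           Cost ρ (K n) (λ x → anyUpTo n (P x))
      go zero    C = C [] z≤n
      go (suc n) C = cost-∨ (C [] z≤n) (cost-∨ (go n (λ w l → C (false ∷ w) (s≤s l))) (go n (λ w l → C (true ∷ w) (s≤s l))))

  inputs : Fin m → Fn
  inputs i x = lookup x i

  cost⇒circuit : ∀ {b φ} → Cost inputs b φ → ∃[ s ] Σ (Circuit m s) λ C → s ≤ b × Computes C φ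
  cost⇒circuit C with C [] (λ i → i , λ _ → refl)
  ... | extension {s} G s≤ _ (o , e) = s , circuit G o , s≤ , e

  Literals : Set
  Literals = List (Bool ⊎ Fin m)

  literal : Vec Bool m → Bool ⊎ Fin m → Bool
  literal x (inj₁ b) = b
  literal x (inj₂ i) = lookup x i

  -- A query containing the circuit input is a fixed arrangement of constants and input bits. Each
  -- cell of the initial tape thus depends on at most one input bit and costs a constant number of
  -- gates.
  IsTemplate : (Vec Bool m → Word) → Set
  IsTemplate u = Σ Literals λ τ → ∀ x → u x ≡ map (literal x) τ

  template-const : ∀ w → IsTemplate (λ _ → w)
  template-const w = map inj₁ w , λ x → trans (sym (map-id w)) (map-∘ w)

  template-inputs : IsTemplate toList
  template-inputs = List.tabulate inj₂ , λ x → trans (tabulate-lookup x) (sym (map-tabulate inj₂ (literal x)))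
    where
    tabulate-lookup : ∀ {k} (x : Vec Bool k) → toList x ≡ List.tabulate (lookup x)
    tabulate-lookup []      = refl
    tabulate-lookup (b ∷ x) = cong (b ∷_) (tabulate-lookup x)

  template-pair : ∀ {u v} → IsTemplate u → IsTemplate v → IsTemplate (λ x → pair (u x) (v x))
  template-pair {u} {v} (σ , e) (τ , e′) = pairs σ , λ x → trans (cong₂ pair (e x) (e′ x)) (pairs-map σ x)
    where
    pairs : Literals → Literals
    pairs []      = inj₁ false ∷ inj₁ true ∷ τ
    pairs (l ∷ σ) = l ∷ l ∷ pairs σ
    pairs-map : ∀ σ x → pair (map (literal x) σ) (map (literal x) τ) ≡ map (literal x) (pairs σ)
    pairs-map []      x = refl
    pairs-map (l ∷ σ) x = cong (λ w → literal x l ∷ literal x l ∷ w) (pairs-map σ x)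

  -- The tableau of a Turing machine computation

  module Tableau (M : TM) (W : ℕ) (w₀ : Fin W) where
    open TM M using (nQ; nΓ)

    State : Set
    State = Fin (suc nQ)

    -- The first kind says that the head is on cell i in state q, the second that cell i holds a
    -- given symbol. A halted machine sets no variable of the first kind, so its tape simply
    -- persists from layer to layer.
    Var : Set
    Var = (Fin W × State) ⊎ (Fin W × Sym M)

    finite-Var : Finite Var
    finite-Var = finite-⊎ (finite-× (finite-Fin W) (finite-Fin _)) (finite-× (finite-Fin W) (finite-Fin _))

    isState : State → State ⊎ Halt → Bool
    isState q (inj₁ q′) = eqF q q′
    isState q (inj₂ _)  = false

    isState-sound : ∀ {q s} → isState q s ≡ true → s ≡ inj₁ q
    isState-sound {q} {inj₁ q′} e = cong inj₁ (sym (eqF-sound q q′ e))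

    value : Config M → Var → Bool
    value (s , p , t) (inj₁ (i , q)) = isState q s ∧ (p ≡ᵇ toℕ i)
    value (s , p , t) (inj₂ (i , a)) = eqF (t (toℕ i)) a

    position : Config M → ℕ
    position c = proj₁ (proj₂ c)

    arrives : Fin W → State → Fin W → (State ⊎ Halt) × Sym M × Move → Bool
    arrives i′ q′ i (s , a , d) = isState q′ s ∧ (move M d (toℕ i) ≡ᵇ toℕ i′)

    moved : (Var → Bool) → Fin W → State → Fin W → State → Sym M → Bool
    moved v i′ q′ i q a = arrives i′ q′ i (TM.δ M q a) ∧ (v (inj₁ (i , q)) ∧ v (inj₂ (i , a)))

    wrote : (Var → Bool) → Fin W → Sym M → State → Sym M → Bool
    wrote v i a′ q a = eqF (proj₁ (proj₂ (TM.δ M q a))) a′ ∧ (v (inj₁ (i , q)) ∧ v (inj₂ (i , a)))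

    anyMoved : (Var → Bool) → Fin W → State → Fin W → State → Bool
    anyMoved v i′ q′ i q = anyFin (3 + nΓ) (moved v i′ q′ i q)

    anyWrote : (Var → Bool) → Fin W → Sym M → State → Bool
    anyWrote v i a′ q = anyFin (3 + nΓ) (wrote v i a′ q)

    headAt : (Var → Bool) → Fin W → State → Bool
    headAt v i q = v (inj₁ (i , q))

    -- All cells of the window, and not just the neighbours, are tried as the previous head
    -- position. This is a polynomial loss and treats the left end of the tape like any other cell.
    nextValue : (Var → Bool) → Var → Bool
    nextValue v (inj₁ (i′ , q′)) = anyFin W λ i → anyFin (suc nQ) (anyMoved v i′ q′ i)
    nextValue v (inj₂ (i , a′))  =
      anyFin (suc nQ) (anyWrote v i a′) ∨ (v (inj₂ (i , a′)) ∧ not (anyFin (suc nQ) (headAt v i)))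

    next-head : ∀ c → position c < W → ∀ i′ q′ → nextValue (value c) (inj₁ (i′ , q′)) ≡ value (step M c) (inj₁ (i′ , q′))
    next-head c p< i′ q′ = bool-ext (⇒ c) (⇐ c p<)
      where
      ⇒ : ∀ c → nextValue (value c) (inj₁ (i′ , q′)) ≡ true → value (step M c) (inj₁ (i′ , q′)) ≡ true
      ⇒ (s , p , t) e with anyFin-sound W (λ i → anyFin (suc nQ) (anyMoved (value (s , p , t)) i′ q′ i)) e
      ... | i , e₁ with anyFin-sound (suc nQ) (anyMoved (value (s , p , t)) i′ q′ i) e₁
      ... | q , e₂ with anyFin-sound (3 + nΓ) (moved (value (s , p , t)) i′ q′ i q) e₂
      ... | a , e₃ with ∧-true {arrives i′ q′ i (TM.δ M q a)} e₃
      ... | e₄ , e₅ with ∧-true {value (s , p , t) (inj₁ (i , q))} e₅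
      ... | e₆ , e₇ with ∧-true {isState q s} e₆
      ... | e₈ , e₉ with refl ← isState-sound {q} {s} e₈ | refl ← ≡ᵇ-sound p (toℕ i) e₉
                       | refl ← eqF-sound (t (toℕ i)) a e₇ = e₄
      ⇐ : ∀ c → position c < W → value (step M c) (inj₁ (i′ , q′)) ≡ true → nextValue (value c) (inj₁ (i′ , q′)) ≡ true
      ⇐ (inj₁ q , p , t) p< e = anyFin-complete W (λ i → anyFin (suc nQ) (anyMoved v i′ q′ i)) i
        (anyFin-complete (suc nQ) (anyMoved v i′ q′ i) q (anyFin-complete (3 + nΓ) (moved v i′ q′ i q) (t p)
          (cong₂ _∧_ (trans (cong (λ n → isState q′ (proj₁ (TM.δ M q (t p))) ∧ (move M (proj₂ (proj₂ (TM.δ M q (t p)))) n ≡ᵇ toℕ i′)) i≡p) e)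
            (cong₂ _∧_ (cong₂ _∧_ (eqF-refl q) (trans (cong (p ≡ᵇ_) i≡p) (≡ᵇ-refl p)))
                       (trans (cong (λ n → eqF (t n) (t p)) i≡p) (eqF-refl (t p)))))))
        where
        v = value (inj₁ q , p , t)
        i = fromℕ< p<
        i≡p : toℕ i ≡ p
        i≡p = toℕ-fromℕ< p<

    next-cell : ∀ c i a′ → nextValue (value c) (inj₂ (i , a′)) ≡ value (step M c) (inj₂ (i , a′))
    next-cell (s , p , t) i a′ with anyFin (suc nQ) (headAt (value (s , p , t)) i) in headHere
    next-cell (inj₂ h , p , t) i a′ | true with anyFin-sound (suc nQ) (headAt (value (inj₂ h , p , t)) i) headHere
    ... | _ , ()
    next-cell (inj₁ q , p , t) i a′ | true with anyFin-sound (suc nQ) (headAt (value (inj₁ q , p , t)) i) headHere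
    ... | q₁ , e with ∧-true {eqF q₁ q} e
    ... | e₁ , e₂ with refl ← eqF-sound q₁ q e₁ | refl ← ≡ᵇ-sound p (toℕ i) e₂ = bool-ext ⇒ ⇐
      where
      c : Config M
      c = inj₁ q , toℕ i , t
      written : Sym M
      written = proj₁ (proj₂ (TM.δ M q (t (toℕ i))))
      rewritten : (if toℕ i ≡ᵇ toℕ i then written else t (toℕ i)) ≡ written
      rewritten = cong (if_then written else t (toℕ i)) (≡ᵇ-refl (toℕ i))
      ⇒ : anyFin (suc nQ) (anyWrote (value c) i a′) ∨ (value c (inj₂ (i , a′)) ∧ false) ≡ true →
          value (step M c) (inj₂ (i , a′)) ≡ true
      ⇒ e with ∨-true {anyFin (suc nQ) (anyWrote (value c) i a′)} e
      ... | inj₂ e′ with ∧-true {value c (inj₂ (i , a′))} e′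
      ... | _ , ()
      ⇒ e | inj₁ e′ with anyFin-sound (suc nQ) (anyWrote (value c) i a′) e′
      ... | q₂ , e₃ with anyFin-sound (3 + nΓ) (wrote (value c) i a′ q₂) e₃
      ... | a , e₄ with ∧-true {eqF (proj₁ (proj₂ (TM.δ M q₂ a))) a′} e₄
      ... | e₅ , e₆ with ∧-true {value c (inj₁ (i , q₂))} e₆
      ... | e₇ , e₈ with ∧-true {eqF q₂ q} e₇
      ... | e₉ , _ with refl ← eqF-sound q₂ q e₉ | refl ← eqF-sound (t (toℕ i)) a e₈ = trans (cong (λ b → eqF b a′) rewritten) e₅
      ⇐ : value (step M c) (inj₂ (i , a′)) ≡ true →
          anyFin (suc nQ) (anyWrote (value c) i a′) ∨ (value c (inj₂ (i , a′)) ∧ false) ≡ true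
      ⇐ e = ∨-introˡ (anyFin-complete (suc nQ) (anyWrote (value c) i a′) q
        (anyFin-complete (3 + nΓ) (wrote (value c) i a′ q) (t (toℕ i))
          (cong₂ _∧_ (trans (cong (λ b → eqF b a′) (sym rewritten)) e)
            (cong₂ _∧_ (cong₂ _∧_ (eqF-refl q) (≡ᵇ-refl (toℕ i))) (eqF-refl (t (toℕ i)))))))
    next-cell (s , p , t) i a′ | false = trans (cong₂ _∨_ unwritten (∧-identityʳ _)) (unchanged s away)
      where
      v = value (s , p , t)
      away : ∀ q → headAt v i q ≡ false
      away q with headAt v i q in e
      ... | false = refl
      ... | true with () ← trans (sym headHere) (anyFin-complete (suc nQ) (headAt v i) q e)
      unwritten : anyFin (suc nQ) (anyWrote v i a′) ≡ false
      unwritten = bool-ext ⇒ (λ ())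
        where
        ⇒ : anyFin (suc nQ) (anyWrote v i a′) ≡ true → false ≡ true
        ⇒ e with anyFin-sound (suc nQ) (anyWrote v i a′) e
        ... | q , e₁ with anyFin-sound (3 + nΓ) (wrote v i a′ q) e₁
        ... | a , e₂ with ∧-true {eqF (proj₁ (proj₂ (TM.δ M q a))) a′} e₂
        ... | _ , e₃ with ∧-true {headAt v i q} e₃
        ... | e₄ , _ = trans (sym (away q)) e₄
      unchanged : ∀ s → (∀ q → isState q s ∧ (p ≡ᵇ toℕ i) ≡ false) → eqF (t (toℕ i)) a′ ≡ value (step M (s , p , t)) (inj₂ (i , a′))
      unchanged (inj₂ h) _ = refl
      unchanged (inj₁ q) away with toℕ i ≡ᵇ p in e
      ... | false = refl
      ... | true with refl ← ≡ᵇ-sound (toℕ i) p e with () ← trans (sym (cong₂ _∧_ (eqF-refl q) (≡ᵇ-refl (toℕ i)))) (away q)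

    next-step : ∀ c → position c < W → ∀ j → nextValue (value c) j ≡ value (step M c) j
    next-step c p< (inj₁ (i , q)) = next-head c p< i q
    next-step c p< (inj₂ (i , a)) = next-cell c i a

    i₀ : Var
    i₀ = inj₂ (w₀ , zero)

    values : (Vec Bool m → Config M) → Var → Fn
    values κ j x = value (κ x) j

    anyCost : ℕ
    anyCost = suc nQ * ((3 + nΓ) * 4 + 2 + 1) + 2

    stepCost : ℕ
    stepCost = (W * (anyCost + 1) + 2) + (anyCost + ((suc nQ * 1 + 2 + 1) + 1 + 1))

    cost-step : ∀ κ → (∀ x → position (κ x) < W) → ∀ j → Cost (values κ) stepCost (values (step M ∘ κ) j)
    cost-step κ κ< j = cost-≗ (λ x → next-step (κ x) (κ< x) j) (formula j)
      where
      v : Vec Bool m → Var → Bool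
      v x = value (κ x)
      term : ∀ b i q a → Cost (values κ) 3 (λ x → b ∧ (v x (inj₁ (i , q)) ∧ v x (inj₂ (i , a))))
      term b i q a = cost-guard i₀ b (cost-∧ (cost-var (inj₁ (i , q))) (cost-var (inj₂ (i , a))))
      formula : ∀ j → Cost (values κ) stepCost (λ x → nextValue (v x) j)
      formula (inj₁ (i′ , q′)) = cost-≤ (m≤m+n _ _)
        (cost-anyFin i₀ W {P = λ i x → anyFin (suc nQ) (anyMoved (v x) i′ q′ i)} λ i →
          cost-anyFin i₀ (suc nQ) {P = λ q x → anyMoved (v x) i′ q′ i q} λ q →
            cost-anyFin i₀ (3 + nΓ) {P = λ a x → moved (v x) i′ q′ i q a} λ a → term (arrives i′ q′ i (TM.δ M q a)) i q a)
      formula (inj₂ (i , a′)) = cost-≤ (m≤n+m _ (W * (anyCost + 1) + 2)) (cost-∨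
        (cost-anyFin i₀ (suc nQ) {P = λ q x → anyWrote (v x) i a′ q} λ q →
          cost-anyFin i₀ (3 + nΓ) {P = λ a x → wrote (v x) i a′ q a} λ a → term (eqF (proj₁ (proj₂ (TM.δ M q a))) a′) i q a)
        (cost-∧ (cost-var (inj₂ (i , a′)))
          (cost-not (cost-anyFin i₀ (suc nQ) {P = λ q x → headAt (v x) i q} λ q → cost-var (inj₁ (i , q))))))

    position-step : ∀ c → position (step M c) ≤ suc (position c)
    position-step (inj₂ h , p , t) = n≤1+n p
    position-step (inj₁ q , p , t) = move-≤ M (proj₂ (proj₂ (TM.δ M q (t p)))) p

    cost-run : ∀ T κ {c φ} → (∀ x → position (κ x) + T < W) → Cost (values (run M T ∘ κ)) c φ →
               Cost (values κ) (T * (size finite-Var * stepCost) + c) φ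
    cost-run zero    κ h C = C
    cost-run (suc T) κ {c} h C = cost-≤ (≤-reflexive (sym (+-assoc (size finite-Var * stepCost) _ c)))
      (cost-let finite-Var (cost-step κ (λ x → ≤-trans (s≤s (m≤m+n _ (suc T))) (h x)))
        (cost-run T (step M ∘ κ) (λ x → ≤-trans (s≤s (≤-trans (+-monoˡ-≤ T (position-step (κ x))) (≤-reflexive (sym (+-suc _ T))))) (h x)) C))

    -- For a fixed word, being the output is a conjunction of tests on single cells. The closing
    -- test says that no further bit follows, so a proper prefix of the output does not match.
    matches : Word → ℕ → Tape M → Bool
    matches []      i t = not (eqF (t i) (bitSym M false)) ∧ not (eqF (t i) (bitSym M true))
    matches (b ∷ w) i t = eqF (t i) (bitSym M b) ∧ matches w (suc i) t

    cost-matches : ∀ w i κ → i + length w < W → Cost (values κ) (length w + 3) (λ x → matches w i (proj₂ (proj₂ (κ x))))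
    cost-matches w i κ h = go w i h
      where
      cell : ∀ j a → j < W → Cost (values κ) 0 (λ x → eqF (proj₂ (proj₂ (κ x)) j) a)
      cell j a j< = cost-≗ (λ x → cong (λ n → eqF (proj₂ (proj₂ (κ x)) n) a) (toℕ-fromℕ< j<)) (cost-var (inj₂ (fromℕ< j< , a)))
      go : ∀ w i → i + length w < W → Cost (values κ) (length w + 3) (λ x → matches w i (proj₂ (proj₂ (κ x))))
      go []      i h = cost-∧ (differs false) (differs true)
        where
        differs : ∀ b → Cost (values κ) 1 (λ x → not (eqF (proj₂ (proj₂ (κ x)) i) (bitSym M b)))
        differs b = cost-not (cell i (bitSym M b) (subst (_< W) (+-identityʳ i) h))
      go (b ∷ w) i h = cost-≤ (≤-reflexive (+-comm _ 1))
        (cost-∧ (cell i _ (≤-trans (s≤s (m≤m+n i _)) h)) (go w (suc i) (subst (_< W) (+-suc i (length w)) h)))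

    matches-complete : ∀ K i t w → length w < K → readBits M K i t ≡ w → matches w i t ≡ true
    matches-complete (suc K) i t w l e with t i in eq | e
    matches-complete (suc K) i t w       l       e | zero              | refl rewrite eq = refl
    matches-complete (suc K) i t (b ∷ w) (s≤s l) e | suc zero          | refl rewrite eq = matches-complete K (suc i) t w l refl
    matches-complete (suc K) i t (b ∷ w) (s≤s l) e | suc (suc zero)    | refl rewrite eq = matches-complete K (suc i) t w l refl
    matches-complete (suc K) i t w       l       e | suc (suc (suc a)) | refl rewrite eq = refl

    matches-sound : ∀ K i t w → length w < K → matches w i t ≡ true → readBits M K i t ≡ w
    matches-sound (suc K) i t [] l e with t i
    ... | zero              = refl
    ... | suc (suc (suc a)) = refl
    matches-sound (suc K) i t (false ∷ w) (s≤s l) e with t i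
    ... | suc zero = cong (false ∷_) (matches-sound K (suc i) t w l e)
    matches-sound (suc K) i t (true ∷ w) (s≤s l) e with t i
    ... | suc (suc zero) = cong (true ∷_) (matches-sound K (suc i) t w l e)

    cost-init : ∀ {u} → Fin m → IsTemplate u → ∀ j → Cost inputs 2 (values (initConfig M ∘ u) j)
    cost-init m₀ _       (inj₁ (i , q)) = cost-const m₀ _
    cost-init m₀ (τ , e) (inj₂ (i , a)) =
      cost-≗ (λ x → cong (λ w → eqF (initTape M w (toℕ i)) a) (sym (e x))) (go τ (toℕ i))
      where
      go : ∀ τ j → Cost inputs 2 (λ x → eqF (initTape M (map (literal x) τ) j) a)
      go []           j       = cost-const m₀ (eqF (blank M) a)
      go (inj₁ b ∷ τ) zero    = cost-const m₀ (eqF (bitSym M b) a)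
      go (inj₂ k ∷ τ) zero    = cost-unary m₀ (λ b → eqF (bitSym M b) a) (cost-var k)
      go (_ ∷ τ)      (suc j) = go τ j

    -- P is a table over all candidate outputs of length at most n. Longer outputs count as false;
    -- this loses nothing, because a short output is guaranteed for the inputs that must be
    -- accepted.
    outputIn : ℕ → ℕ → (Word → Bool) → Word → Bool
    outputIn n T P w = anyUpTo n (λ a → P a ∧ matches a 0 (tapeAfter M w T))

    outputCost : ℕ → ℕ → ℕ
    outputCost n T = size finite-Var * 2 + (T * (size finite-Var * stepCost) + 2 ^ n * (2 * (n + 3 + 2 + 1)))

    cost-output : ∀ {u} → Fin m → IsTemplate u → ∀ n T P → n < W → T < W →
                  Cost inputs (outputCost n T) (λ x → outputIn n T P (u x))
    cost-output {u} m₀ τ n T P n< T< = cost-let finite-Var (cost-init m₀ τ) (cost-run T (initConfig M ∘ u) (λ x → T<)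
      (cost-anyUpTo n λ a a≤n → cost-≤ (+-monoˡ-≤ 2 (+-monoˡ-≤ 3 a≤n))
        (cost-guard i₀ (P a) (cost-matches a 0 (run M T ∘ initConfig M ∘ u) (≤-trans (s≤s a≤n) n<)))))

    outputIn-sound : ∀ n T P w → n ≤ T → outputIn n T P w ≡ true → length (outputAfter M w T) ≤ n × P (outputAfter M w T) ≡ true
    outputIn-sound n T P w n≤ e with anyUpTo-sound n (λ a → P a ∧ matches a 0 (tapeAfter M w T)) e
    ... | a , a≤n , e′ with ∧-true {P a} e′
    ... | Pa , match with refl ← matches-sound (suc (T + length w)) 0 (tapeAfter M w T) a (s≤s (≤-trans a≤n (≤-trans n≤ (m≤m+n T _)))) match
      = a≤n , Pa

    outputIn-complete : ∀ n T P w → n ≤ T → length (outputAfter M w T) ≤ n → P (outputAfter M w T) ≡ true → outputIn n T P w ≡ true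
    outputIn-complete n T P w n≤ a≤n Pa = anyUpTo-complete (outputAfter M w T) (λ a → P a ∧ matches a 0 (tapeAfter M w T)) a≤n
      (cong₂ _∧_ Pa (matches-complete (suc (T + length w)) 0 (tapeAfter M w T) _ (s≤s (≤-trans a≤n (≤-trans n≤ (m≤m+n T _)))) refl))

-- Domination in bipartite graphs

module _ {A : Set} where

  any-sound : ∀ {P : A → Bool} xs → any P xs ≡ true → ∃[ x ] (x ∈ xs × P x ≡ true)
  any-sound {P} (x ∷ xs) e with ∨-true {P x} e
  ... | inj₁ p = x , here refl , p
  ... | inj₂ q = let (y , y∈ , p) = any-sound xs q in y , there y∈ , p

  any-complete : ∀ {P : A → Bool} {x xs} → x ∈ xs → P x ≡ true → any P xs ≡ true
  any-complete         (here refl)              p = ∨-introˡ p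
  any-complete {P} {x} {y ∷ xs} (there x∈xs) p = ∨-introʳ {P y} (any-complete x∈xs p)

  search : ∀ (P : A → Bool) xs → (∃[ x ] (x ∈ xs × P x ≡ true)) ⊎ (∀ x → x ∈ xs → P x ≡ false)
  search P []       = inj₂ λ _ ()
  search P (x ∷ xs) with P x in e | search P xs
  ... | true  | _                  = inj₁ (x , here refl , e)
  ... | false | inj₁ (y , y∈ , p)  = inj₁ (y , there y∈ , p)
  ... | false | inj₂ h             = inj₂ λ { y (here refl) → e ; y (there y∈) → h y y∈ }

  count : (A → Bool) → List A → ℕ
  count P []       = 0
  count P (x ∷ xs) = (if P x then 1 else 0) + count P xs

  remove : (A → Bool) → List A → List A
  remove P []       = []
  remove P (x ∷ xs) = if P x then remove P xs else x ∷ remove P xs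

  count-remove : ∀ P xs → count P xs + length (remove P xs) ≡ length xs
  count-remove P []       = refl
  count-remove P (x ∷ xs) with P x
  ... | true  = cong suc (count-remove P xs)
  ... | false = trans (+-suc (count P xs) _) (cong suc (count-remove P xs))

  remove-∈ : ∀ P xs {x} → x ∈ remove P xs → x ∈ xs
  remove-∈ P (y ∷ xs) x∈ with P y
  remove-∈ P (y ∷ xs) x∈          | true  = there (remove-∈ P xs x∈)
  remove-∈ P (y ∷ xs) (here refl) | false = here refl
  remove-∈ P (y ∷ xs) (there x∈)  | false = there (remove-∈ P xs x∈)

  ∈-remove : ∀ P xs {x} → x ∈ xs → P x ≡ true ⊎ x ∈ remove P xs
  ∈-remove P (y ∷ xs) (here refl) with P y
  ... | true  = inj₁ refl
  ... | false = inj₂ (here refl)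
  ∈-remove P (y ∷ xs) (there x∈) with P y | ∈-remove P xs x∈
  ... | true  | r       = r
  ... | false | inj₁ e  = inj₁ e
  ... | false | inj₂ x∈ = inj₂ (there x∈)

  sumOver : (A → ℕ) → List A → ℕ
  sumOver f []       = 0
  sumOver f (x ∷ xs) = f x + sumOver f xs

  sumOver-0 : ∀ xs → sumOver (λ _ → 0) xs ≡ 0
  sumOver-0 []       = refl
  sumOver-0 (_ ∷ xs) = sumOver-0 xs

  sumOver-+ : ∀ f g xs → sumOver (λ x → f x + g x) xs ≡ sumOver f xs + sumOver g xs
  sumOver-+ f g []       = refl
  sumOver-+ f g (x ∷ xs) = trans (cong (f x + g x +_) (sumOver-+ f g xs))
    (solve 4 (λ a b c d → (a :+ b) :+ (c :+ d) := (a :+ c) :+ (b :+ d)) refl (f x) (g x) (sumOver f xs) (sumOver g xs))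
    where open +-*-Solver

  sumOver-lower : ∀ {n} f xs → (∀ x → x ∈ xs → n ≤ 2 * f x) → length xs * n ≤ 2 * sumOver f xs
  sumOver-lower f []       h = z≤n
  sumOver-lower f (x ∷ xs) h = ≤-trans (+-mono-≤ (h x (here refl)) (sumOver-lower f xs (λ y → h y ∘ there)))
    (≤-reflexive (sym (*-distribˡ-+ 2 (f x) (sumOver f xs))))

  sumOver-upper : ∀ {n} f xs → (∀ x → x ∈ xs → 2 * f x < n) → length xs + 2 * sumOver f xs ≤ length xs * n
  sumOver-upper f []       h = z≤n
  sumOver-upper {n} f (x ∷ xs) h = ≤-trans (≤-reflexive
      (solve 3 (λ l a s → (con 1 :+ l) :+ con 2 :* (a :+ s) := (con 1 :+ con 2 :* a) :+ (l :+ con 2 :* s)) refl (length xs) (f x) (sumOver f xs)))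
    (+-mono-≤ (h x (here refl)) (sumOver-upper f xs (λ y → h y ∘ there)))
    where open +-*-Solver

≤ᵇ-true : ∀ {m n} → (m ≤ᵇ n) ≡ true → m ≤ n
≤ᵇ-true e = ≤ᵇ⇒≤ _ _ (subst Data.Bool.T (sym e) _)

≤ᵇ-false : ∀ {m n} → (m ≤ᵇ n) ≡ false → n < m
≤ᵇ-false {m} {n} e = ≰⇒> λ m≤n → subst Data.Bool.T e (≤⇒≤ᵇ m≤n)

count-sum : ∀ {A C : Set} (P : C → A → Bool) as cs →
            sumOver (λ c → count (P c) as) cs ≡ sumOver (λ a → count (λ c → P c a) cs) as
count-sum P as []       = sym (sumOver-0 as)
count-sum P as (c ∷ cs) = trans (cong₂ _+_ (single as) (count-sum P as cs))
  (sym (sumOver-+ (λ a → if P c a then 1 else 0) (λ a → count (λ c → P c a) cs) as))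
  where
  single : ∀ as → count (P c) as ≡ sumOver (λ a → if P c a then 1 else 0) as
  single []       = refl
  single (a ∷ as) = cong ((if P c a then 1 else 0) +_) (single as)

-- Double counting.
popular : ∀ {A C : Set} (P : C → A → Bool) a as cs →
          (∀ c → c ∈ cs → length (a ∷ as) ≤ 2 * count (P c) (a ∷ as)) →
          ∃[ b ] (b ∈ a ∷ as × length cs ≤ 2 * count (λ c → P c b) cs)
popular P a as cs h with search (λ b → length cs ≤ᵇ 2 * count (λ c → P c b) cs) (a ∷ as)
... | inj₁ (b , b∈ , e) = b , b∈ , ≤ᵇ-true e
-- Otherwise every entry of `a ∷ as` is hit by less than half of `cs`. Counted from `cs`, the
-- incidences make up at least half of all pairs; counted from the nonempty list `a ∷ as`, strictly
-- less.
... | inj₂ none = ⊥-elim (<-irrefl refl (begin-strict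
    length cs * length (a ∷ as)                      ≤⟨ sumOver-lower (λ c → count (P c) (a ∷ as)) cs h ⟩
    2 * sumOver (λ c → count (P c) (a ∷ as)) cs      ≡⟨ cong (2 *_) (count-sum P (a ∷ as) cs) ⟩
    2 * sumOver f (a ∷ as)                           <⟨ m<n+m (2 * sumOver f (a ∷ as)) {length (a ∷ as)} (s≤s z≤n) ⟩
    length (a ∷ as) + 2 * sumOver f (a ∷ as)         ≤⟨ sumOver-upper f (a ∷ as) (λ b b∈ → ≤ᵇ-false (none b b∈)) ⟩
    length (a ∷ as) * length cs                      ≡⟨ *-comm (length (a ∷ as)) (length cs) ⟩
    length cs * length (a ∷ as)                      ∎))
  where
  open ≤-Reasoning
  f = λ b → count (λ c → P c b) cs

Hits : {A C : Set} → (C → A → Bool) → List A → List C → Set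
Hits P as cs = ∀ c → c ∈ cs → ∃[ a ] (a ∈ as × P c a ≡ true)

_⊆_ : {A : Set} → List A → List A → Set
xs ⊆ ys = ∀ x → x ∈ xs → x ∈ ys

halved : ∀ {A : Set} k (P : A → Bool) xs → length xs ≤ 2 * count P xs → length xs < 2 ^ suc k → length (remove P xs) < 2 ^ k
halved k P xs h l = *-cancelˡ-< 2 _ _ (≤-<-trans (+-cancelˡ-≤ (2 * count P xs) _ _ (begin
    2 * count P xs + 2 * length (remove P xs)  ≡⟨ sym (*-distribˡ-+ 2 (count P xs) _) ⟩
    2 * (count P xs + length (remove P xs))    ≡⟨ cong (2 *_) (count-remove P xs) ⟩
    2 * length xs                              ≡⟨ cong (length xs +_) (+-identityʳ _) ⟩
    length xs + length xs                      ≤⟨ +-monoˡ-≤ (length xs) h ⟩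
    2 * count P xs + length xs                 ∎)) l)
  where open ≤-Reasoning

-- Each choice disposes of at least half of what is left, so k choices exhaust a list shorter than
-- `2 ^ k`. The premise ranges over all sublists because the popular element varies with the
-- remainder.
greedy : ∀ {A C : Set} (P : C → A → Bool) as cs →
         (∀ cs′ → cs′ ⊆ cs → ∃[ a ] (a ∈ as × length cs′ ≤ 2 * count (λ c → P c a) cs′)) →
         ∀ k cs′ → cs′ ⊆ cs → length cs′ < 2 ^ k →
         ∃[ as′ ] (as′ ⊆ as × length as′ ≤ k × Hits P as′ cs′)
greedy P as cs h k       []          sub l = [] , (λ _ ()) , z≤n , λ _ ()
greedy P as cs h zero    (c ∷ cs′)   sub (s≤s ())
greedy P as cs h (suc k) cs′@(_ ∷ _) sub l with h cs′ sub
... | a , a∈ , half with greedy P as cs h k (remove (λ c → P c a) cs′) (λ c → sub c ∘ remove-∈ _ cs′) (halved k (λ c → P c a) cs′ half l)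
... | as′ , sub′ , l′ , hits = a ∷ as′ , (λ { _ (here refl) → a∈ ; b (there b∈) → sub′ b b∈ }) , s≤s l′ , hits′
  where
  hits′ : Hits P (a ∷ as′) cs′
  hits′ c c∈ with ∈-remove (λ c → P c a) cs′ c∈
  ... | inj₁ e   = a , here refl , e
  ... | inj₂ c∈′ = let (b , b∈ , e) = hits c c∈′ in b , there b∈ , e

count-∨ : ∀ {A : Set} (P Q : A → Bool) xs → (∀ x → x ∈ xs → P x ∨ Q x ≡ true) → length xs ≤ count P xs + count Q xs
count-∨ P Q []       h = z≤n
count-∨ P Q (x ∷ xs) h with P x | Q x | h x (here refl) | count-∨ P Q xs (λ y → h y ∘ there)
... | true  | true  | _ | ih = s≤s (≤-trans ih (+-monoʳ-≤ (count P xs) (n≤1+n _)))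
... | true  | false | _ | ih = s≤s ih
... | false | true  | _ | ih = ≤-trans (s≤s ih) (≤-reflexive (sym (+-suc (count P xs) _)))

-- As long as some c hits half of the remaining as through P, take it. If this fails, every c
-- hits half of the remaining as through Q, so that greed works on the other side.
domination : ∀ {A C : Set} (P Q : A → C → Bool) as cs {l} →
             (∀ a c → a ∈ as → c ∈ cs → P a c ∨ Q a c ≡ true) → length cs < 2 ^ l →
             ∀ k as′ → as′ ⊆ as → length as′ < 2 ^ k →
             (∃[ cs′ ] (cs′ ⊆ cs × length cs′ ≤ k × Hits P cs′ as′)) ⊎
             (∃[ as″ ] (as″ ⊆ as × length as″ ≤ l × Hits (flip Q) as″ cs))
domination P Q as cs h l< k       []           sub l = inj₁ ([] , (λ _ ()) , z≤n , λ _ ())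
domination P Q as cs h l< zero    (a ∷ as′)    sub (s≤s ())
domination P Q as cs {l} h l< (suc k) (a₀ ∷ as₀) sub len
  with search (λ c → length (a₀ ∷ as₀) ≤ᵇ 2 * count (λ a → P a c) (a₀ ∷ as₀)) cs
... | inj₁ (c , c∈ , e) = extendWith (domination P Q as cs h l< k (remove (λ a → P a c) as′) (λ a → sub a ∘ remove-∈ _ as′)
                                        (halved k (λ a → P a c) as′ (≤ᵇ-true e) len))
  where
  as′ = a₀ ∷ as₀
  extendWith : (∃[ cs′ ] (cs′ ⊆ cs × length cs′ ≤ k × Hits P cs′ (remove (λ a → P a c) as′))) ⊎
               (∃[ as″ ] (as″ ⊆ as × length as″ ≤ l × Hits (flip Q) as″ cs)) →
               (∃[ cs′ ] (cs′ ⊆ cs × length cs′ ≤ suc k × Hits P cs′ as′)) ⊎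
               (∃[ as″ ] (as″ ⊆ as × length as″ ≤ l × Hits (flip Q) as″ cs))
  extendWith (inj₂ r) = inj₂ r
  extendWith (inj₁ (cs′ , sub′ , l′ , hits)) = inj₁ (c ∷ cs′ , (λ { _ (here refl) → c∈ ; d (there d∈) → sub′ d d∈ }) , s≤s l′ , hits′)
    where
    hits′ : Hits P (c ∷ cs′) as′
    hits′ a a∈ with ∈-remove (λ a → P a c) as′ a∈
    ... | inj₁ e   = c , here refl , e
    ... | inj₂ a∈′ = let (d , d∈ , e) = hits a a∈′ in d , there d∈ , e
... | inj₂ none = inj₂ (as″ , (λ a → sub a ∘ proj₁ (proj₂ greed) a) , proj₁ (proj₂ (proj₂ greed)) , proj₂ (proj₂ (proj₂ greed)))
  where
  as′ = a₀ ∷ as₀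
  often : ∀ c → c ∈ cs → length as′ ≤ 2 * count (λ a → Q a c) as′
  often c c∈ = +-cancelˡ-≤ (length as′) _ _ (begin
      length as′ + length as′                                                ≡⟨ cong (length as′ +_) (sym (+-identityʳ _)) ⟩
      2 * length as′                                                         ≤⟨ *-monoʳ-≤ 2 (count-∨ (λ a → P a c) (λ a → Q a c) as′ (λ a a∈ → h a c (sub a a∈) c∈)) ⟩
      2 * (count (λ a → P a c) as′ + count (λ a → Q a c) as′)                ≡⟨ *-distribˡ-+ 2 (count (λ a → P a c) as′) _ ⟩
      2 * count (λ a → P a c) as′ + 2 * count (λ a → Q a c) as′              ≤⟨ +-monoˡ-≤ _ (<⇒≤ (≤ᵇ-false {length as′} {2 * count (λ a → P a c) as′} (none c c∈))) ⟩
      length as′ + 2 * count (λ a → Q a c) as′                               ∎)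
    where open ≤-Reasoning
  -- From here on `as′` is fixed. Every c hits half of it through Q, so `popular` applies to every
  -- sublist of `cs`, and a cover of the whole of `cs` can be chosen inside `as′`.
  greed = greedy (flip Q) as′ cs (λ cs′ sub′ → popular (flip Q) a₀ as₀ cs′ (λ c c∈ → often c (sub′ c c∈))) l cs (λ _ → id) l<
  as″ = proj₁ greed

-- Outputs read at a later time, and lists of words

open Finite using (size)

module _ (M : TM) where

  initTape-blank : ∀ w {j} → length w ≤ j → initTape M w j ≡ zero
  initTape-blank []      l       = refl
  initTape-blank (b ∷ w) (s≤s l) = initTape-blank w l

  run-blank : ∀ k c {n} → proj₁ (proj₂ c) + k ≤ n → (∀ j → n ≤ j → proj₂ (proj₂ c) j ≡ zero) →
              ∀ j → n ≤ j → proj₂ (proj₂ (run M k c)) j ≡ zero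
  run-blank zero    c                      p≤ h = h
  run-blank (suc k) (inj₂ _ , p , t)       p≤ h = run-blank k (inj₂ _ , p , t) (≤-trans (+-monoʳ-≤ p (n≤1+n k)) p≤) h
  run-blank (suc k) (inj₁ q , p , t) {n} p≤ h with TM.δ M q (t p)
  ... | q′ , a , d = run-blank k _ (≤-trans (+-monoˡ-≤ k (move-≤ M d p)) (≤-trans (≤-reflexive (sym (+-suc p k))) p≤)) h′
    where
    h′ : ∀ j → n ≤ j → (if j ≡ᵇ p then a else t j) ≡ zero
    h′ j n≤ with j ≡ᵇ p in e
    ... | false = h j n≤
    ... | true with refl ← ≡ᵇ-sound j p e = ⊥-elim (<-irrefl refl (≤-trans (≤-trans (s≤s (m≤m+n p k)) (≤-reflexive (sym (+-suc p k)))) (≤-trans p≤ n≤)))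

  readBits-fuel : ∀ d {K K′} i t → d < K → d < K′ → t (d + i) ≡ zero → readBits M K i t ≡ readBits M K′ i t
  readBits-fuel zero {suc K} {suc K′} i t _ _ e with t i
  readBits-fuel zero {suc K} {suc K′} i t _ _ refl | zero = refl
  readBits-fuel (suc d) {suc K} {suc K′} i t (s≤s l) (s≤s l′) e with t i
  ... | zero              = refl
  ... | suc zero          = cong (false ∷_) (readBits-fuel d (suc i) t l l′ (trans (cong t (+-suc d i)) e))
  ... | suc (suc zero)    = cong (true ∷_) (readBits-fuel d (suc i) t l l′ (trans (cong t (+-suc d i)) e))
  ... | suc (suc (suc a)) = refl

  -- Time enters an output twice: as the moment of reading and as the number of cells read. The
  -- former is harmless since a halted tape no longer changes. So is the latter, since cell
  -- `j + length w` is blank at time j and ends the reading under either bound.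
  output-later : ∀ {w j k y} → j ≤ k → OutputsWithin M w j y → OutputsWithin M w k y
  output-later {w} {j} {k} {y} j≤k ((h , halts) , out) = (h , halted-later M {w} j≤k halts) ,
    trans (cong (readBits M (suc (k + length w)) 0) (cong (λ c → proj₂ (proj₂ c)) (run-halted-later M {w} j≤k halts)))
      (trans (sym (readBits-fuel (j + length w) 0 (tapeAfter M w j) ≤-refl (s≤s (+-monoˡ-≤ (length w) j≤k)) blank-end)) out)
    where
    blank-end : tapeAfter M w j (j + length w + 0) ≡ zero
    blank-end = run-blank j (initConfig M w) {j + length w} (m≤m+n j _)
      (λ i l → initTape-blank w (≤-trans (m≤n+m _ j) l)) _ (m≤m+n _ 0)

allWords : ℕ → List Word
allWords zero    = [] ∷ []
allWords (suc n) = map (false ∷_) (allWords n) ++ map (true ∷_) (allWords n)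

length-allWords : ∀ n → length (allWords n) ≡ 2 ^ n
length-allWords zero    = refl
length-allWords (suc n) = trans (length-++ (map (false ∷_) (allWords n))) (cong₂ _+_
  (trans (length-map _ (allWords n)) (length-allWords n))
  (trans (trans (length-map _ (allWords n)) (length-allWords n)) (sym (+-identityʳ _))))

∈-allWords : ∀ w → w ∈ allWords (length w)
∈-allWords []          = here refl
∈-allWords (false ∷ w) = ∈-++⁺ˡ (∈-map⁺ _ (∈-allWords w))
∈-allWords (true ∷ w)  = ∈-++⁺ʳ (map (false ∷_) (allWords (length w))) (∈-map⁺ _ (∈-allWords w))

allWords-length : ∀ n {w} → w ∈ allWords n → length w ≡ n
allWords-length zero    (here refl) = refl
allWords-length (suc n) w∈ with ∈-++⁻ (map (false ∷_) (allWords n)) w∈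
... | inj₁ w∈′ with ∈-map⁻ (false ∷_) w∈′
... | w , w∈″ , refl = cong suc (allWords-length n w∈″)
allWords-length (suc n) w∈ | inj₂ w∈′ with ∈-map⁻ (true ∷_) w∈′
... | w , w∈″ , refl = cong suc (allWords-length n w∈″)

remove-false : ∀ {A : Set} (P : A → Bool) xs {x} → x ∈ remove P xs → P x ≡ false
remove-false P (y ∷ xs) x∈ with P y in e
remove-false P (y ∷ xs) x∈          | true  = remove-false P xs x∈
remove-false P (y ∷ xs) (here refl) | false = e
remove-false P (y ∷ xs) (there x∈)  | false = remove-false P xs x∈

wordsWith : Bool → Language → ℕ → List Word
wordsWith true  L m = remove (not ∘ L) (allWords m)
wordsWith false L m = remove L (allWords m)

-- Halving needs a strict bound, and all `2 ^ m` words may be present; hence the exponent `suc m`,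
-- which becomes the size of the covers.
wordsWith-short : ∀ b L m → length (wordsWith b L m) < 2 ^ suc m
wordsWith-short b L m = ≤-trans (s≤s (≤-trans (fewer b) (≤-reflexive (length-allWords m)))) (m<m+n (2 ^ m) (≤-trans (m^n>0 2 m) (m≤m+n _ 0)))
  where
  removed : ∀ P (xs : List Word) → length (remove P xs) ≤ length xs
  removed P xs = ≤-trans (m≤n+m _ (count P xs)) (≤-reflexive (count-remove P xs))
  fewer : ∀ b → length (wordsWith b L m) ≤ length (allWords m)
  fewer true  = removed _ (allWords m)
  fewer false = removed _ (allWords m)

wordsWith-length : ∀ b L m {w} → w ∈ wordsWith b L m → length w ≡ m
wordsWith-length true  L m w∈ = allWords-length m (remove-∈ (not ∘ L) (allWords m) w∈)
wordsWith-length false L m w∈ = allWords-length m (remove-∈ L (allWords m) w∈)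

wordsWith-value : ∀ b L m {w} → w ∈ wordsWith b L m → L w ≡ b
wordsWith-value true  L m w∈ = not-injective (remove-false (not ∘ L) (allWords m) w∈)
wordsWith-value false L m w∈ = remove-false L (allWords m) w∈

∈-wordsWith : ∀ b L w → L w ≡ b → w ∈ wordsWith b L (length w)
∈-wordsWith true L w e with ∈-remove (not ∘ L) (allWords (length w)) (∈-allWords w)
... | inj₁ e′ with () ← trans (sym e′) (cong not e)
... | inj₂ w∈ = w∈
∈-wordsWith false L w e with ∈-remove L (allWords (length w)) (∈-allWords w)
... | inj₁ e′ with () ← trans (sym e′) e
... | inj₂ w∈ = w∈

-- For k = a + b and E = 3 * k, the power `2 ^ E` is the cube of `2 ^ k` and thus at least that of k
-- + 1, whose expansion contains 3 * k * k + k.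
exceeds-linear : ∀ a b → ∃[ E ] (a * E + b ≤ 2 ^ E × a + b ≤ 2 ^ E)
exceeds-linear a b = 3 * k , ≤-trans (begin
    a * (3 * k) + b                   ≤⟨ +-mono-≤ (*-monoˡ-≤ (3 * k) (m≤m+n a b)) (m≤n+m b a) ⟩
    k * (3 * k) + k                   ≤⟨ m≤n+m (k * (3 * k) + k) (k * (k * k) + 2 * k + 1) ⟩
    (k * (k * k) + 2 * k + 1) + (k * (3 * k) + k)  ≡⟨ solve 1 (λ k → (k :* (k :* k) :+ con 2 :* k :+ con 1) :+ (k :* (con 3 :* k) :+ k)
                                          := (con 1 :+ k) :* ((con 1 :+ k) :* ((con 1 :+ k) :* con 1))) refl k ⟩
    suc k ^ 3                         ∎) cube ,
  ≤-trans (n≤1+n k) (≤-trans (m≤m*n (suc k) (suc k ^ 2)) cube)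
  where
  open ≤-Reasoning
  open +-*-Solver
  k = a + b
  cube : suc k ^ 3 ≤ 2 ^ (3 * k)
  cube = ≤-trans (^-monoˡ-≤ 3 (n<2^n k)) (≤-reflexive (trans (^-*-assoc 2 k 3) (cong (2 ^_) (*-comm k 3))))

-- Choice of the advice

module SizeBound (D N : ℕ) where

  private
    E : ℕ
    E = proj₁ (exceeds-linear D (N + 3))

  -- This is the exponent t of the circuit lower bound. By the choice of E, 2 + t is at most
  -- `2 ^ (n + E)`, so a factor `(2 + t) ^ D` takes `D * (n + E)` of the exponent. The summand n + n
  -- pays for the two searches of size about `2 ^ n`, and `suc N` puts t beyond the threshold N and
  -- above zero.
  hardness : ℕ → ℕ
  hardness n = D * (n + E) + (n + n) + suc N

  hardness-≥ : ∀ n → n ≤ hardness n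
  hardness-≥ n = ≤-trans (m≤m+n n n) (≤-trans (m≤n+m (n + n) (D * (n + E))) (m≤m+n _ (suc N)))

  hardness-> : ∀ n → N < hardness n
  hardness-> n = m≤n+m (suc N) (D * (n + E) + (n + n))

  pb-hardness : PolyBounded hardness
  pb-hardness = pb-+ (pb-+ (pb-* (pb-const D) (pb-+ pb-id (pb-const E))) (pb-+ pb-id pb-id)) (pb-const (suc N))

  fits-hardness : ∀ n → 2 ^ (n + n) * (2 + hardness n) ^ D ≤ 2 ^ hardness n
  fits-hardness n = begin
    2 ^ (n + n) * (2 + hardness n) ^ D   ≤⟨ *-monoʳ-≤ (2 ^ (n + n)) (^-monoˡ-≤ D base) ⟩
    2 ^ (n + n) * (2 ^ (n + E)) ^ D      ≡⟨ cong (2 ^ (n + n) *_) (^-*-assoc 2 (n + E) D) ⟩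
    2 ^ (n + n) * 2 ^ ((n + E) * D)      ≡⟨ sym (^-distribˡ-+-* 2 (n + n) ((n + E) * D)) ⟩
    2 ^ (n + n + (n + E) * D)            ≤⟨ ^-monoʳ-≤ 2 (≤-trans (≤-reflexive (trans (+-comm (n + n) _) (cong (_+ (n + n)) (*-comm (n + E) D)))) (m≤m+n _ (suc N))) ⟩
    2 ^ hardness n                       ∎
    where
    open ≤-Reasoning
    open +-*-Solver
    large = proj₂ (exceeds-linear D (N + 3))
    -- The first property of E bounds the constant part by `2 ^ E`, the second one the slope D + 2.
    base : 2 + hardness n ≤ 2 ^ (n + E)
    base = begin
      2 + hardness n                          ≡⟨ solve 4 (λ d n e N → con 2 :+ (d :* (n :+ e) :+ (n :+ n) :+ (con 1 :+ N))
                                                   := (d :* e :+ (N :+ con 3)) :+ (d :+ con 2) :* n) refl D n E N ⟩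
      (D * E + (N + 3)) + (D + 2) * n         ≤⟨ +-mono-≤ (proj₁ large) (*-monoˡ-≤ n (≤-trans (+-monoʳ-≤ D (≤-trans (n≤1+n 2) (m≤n+m 3 N))) (proj₂ large))) ⟩
      2 ^ E + 2 ^ E * n                       ≡⟨ sym (*-suc (2 ^ E) n) ⟩
      2 ^ E * suc n                           ≤⟨ *-monoʳ-≤ (2 ^ E) (n<2^n n) ⟩
      2 ^ E * 2 ^ n                           ≡⟨ *-comm (2 ^ E) (2 ^ n) ⟩
      2 ^ n * 2 ^ E                           ≡⟨ sym (^-distribˡ-+-* 2 n E) ⟩
      2 ^ (n + E)                             ∎

module Reduction {A B L : Language} (B∈NP : InNP B) (L∈NP : InNP L) (q : ℕ) (1≤q : 1 ≤ q) (N : ℕ)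
  (hard : ∀ n → N ≤ n → ∀ s (C : Circuit n s) → Computes C (slice L n) → ∀ t → t ^ q ≤ n → 2 ^ t < s)
  (S≤A : Combination.S B∈NP L∈NP ≤ₚ A) where

  open Combination B∈NP L∈NP using (S; S-query)

  private
    cB = proj₁ (proj₂ B∈NP)
    cL = proj₁ (proj₂ L∈NP)
    f  = proj₁ S≤A
    M  = proj₁ (proj₁ (proj₂ S≤A))
    cM = proj₁ (proj₂ (proj₁ (proj₂ S≤A)))

  f-output : ∀ u → OutputsWithin M u (poly cM (length u)) (f u)
  f-output = proj₂ (proj₂ (proj₁ (proj₂ S≤A)))

  f-correct : ∀ u → S u ≡ A (f u)
  f-correct = proj₂ (proj₂ S≤A)

  hints : ℕ → ℕ → Word → Word → Word
  hints n m = advice (poly cB n) (poly cL m)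

  f-hinted : ∀ {n m} y x z → length y ≡ n → length x ≡ m → length z ≡ m →
             A (f (pair y (hints n m x z))) ≡ (B y ∧ L x) ∨ L z
  f-hinted y x z refl refl |z| = trans (sym (f-correct _)) (S-query y x z |z|)

  hintsLength : ℕ → ℕ
  hintsLength t = m + m + suc (suc (m + m + suc (suc (b + b + suc (suc (a + a + 2))))))
    where
    m = t ^ q
    a = poly cL m
    b = poly cB t

  hints-length : ∀ {n t} x z → n ≤ t → length x ≡ t ^ q → length z ≡ t ^ q → length (hints n (t ^ q) x z) ≤ hintsLength t
  hints-length {n} {t} x z n≤t ex ez
    rewrite length-pair x (pair z (pair (replicate (poly cB n) false) (pair (replicate (poly cL (t ^ q)) false) [])))
          | length-pair z (pair (replicate (poly cB n) false) (pair (replicate (poly cL (t ^ q)) false) []))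
          | length-pair (replicate (poly cB n) false) (pair (replicate (poly cL (t ^ q)) false) [])
          | length-pair (replicate (poly cL (t ^ q)) false) []
          | length-replicate (poly cB n) {false} | length-replicate (poly cL (t ^ q)) {false} | ex | ez
    = +-monoʳ-≤ (t ^ q + t ^ q) (s≤s (s≤s (+-monoʳ-≤ (t ^ q + t ^ q) (s≤s (s≤s (+-monoˡ-≤ _ (+-mono-≤ b≤ b≤)))))))
    where
    b≤ : poly cB n ≤ poly cB t
    b≤ = poly-mono cB n≤t

  -- The summand t ensures that candidate outputs of length up to n fit into the window of the
  -- tableau. Letting the machine run longer does not change its output.
  steps : ℕ → ℕ
  steps t = poly cM (t + t + suc (suc (hintsLength t))) + t

  query-steps : ∀ {t} y x z → length y ≤ t → length x ≡ t ^ q → length z ≡ t ^ q →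
                poly cM (length (pair y (hints (length y) (t ^ q) x z))) ≤ steps t
  query-steps {t} y x z y≤ ex ez = ≤-trans (poly-mono cM (≤-trans (≤-reflexive (length-pair y _))
    (+-mono-≤ (+-mono-≤ y≤ y≤) (s≤s (s≤s (hints-length x z y≤ ex ez)))))) (m≤m+n _ t)

  f-outputAfter : ∀ {n t} y x z → n ≤ t → length y ≡ n → length x ≡ t ^ q → length z ≡ t ^ q →
                  outputAfter M (pair y (hints n (t ^ q) x z)) (steps t) ≡ f (pair y (hints n (t ^ q) x z))
  f-outputAfter y x z n≤ refl ex ez = proj₂ (output-later M {pair y _} (query-steps y x z n≤ ex ez) (f-output _))

  -- This and the next costs restate those of `Tableau` for a window of `suc (steps t)` cells as
  -- functions of t, with which they agree by computation; in this form they can be bounded by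
  -- polynomials.
  variables : ℕ → ℕ
  variables t = suc (steps t) * suc (TM.nQ M) + suc (steps t) * (3 + TM.nΓ M)

  anyCost : ℕ
  anyCost = suc (TM.nQ M) * ((3 + TM.nΓ M) * 4 + 2 + 1) + 2

  stepCost : ℕ → ℕ
  stepCost t = (suc (steps t) * (anyCost + 1) + 2) + (anyCost + ((suc (TM.nQ M) * 1 + 2 + 1) + 1 + 1))

  tableauCost : ℕ → ℕ
  tableauCost t = variables t * 2 + steps t * (variables t * stepCost t)

  -- The circuit size with `2 ^ (n + n)` split off. It is stated in t alone so that its polynomial
  -- exponent is known before t is chosen in terms of that exponent.
  sizeFactor : ℕ → ℕ
  sizeFactor t = suc (t ^ q) * (tableauCost t + 2 * (t + 3 + 2 + 1) + 3 + 1) + 3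

  pb-hintsLength : ∀ {t : ℕ → ℕ} → PolyBounded t → PolyBounded (hintsLength ∘ t)
  pb-hintsLength {t} pt = pb-+ (pb-+ pm pm) (pb-suc (pb-suc (pb-+ (pb-+ pm pm) (pb-suc (pb-suc (pb-+ (pb-+ pb pb)
                            (pb-suc (pb-suc (pb-+ (pb-+ pa pa) (pb-const 2))))))))))
    where
    pm : PolyBounded (λ n → t n ^ q)
    pm = pb-^ q pt
    pa : PolyBounded (λ n → poly cL (t n ^ q))
    pa = pb-poly cL pm
    pb : PolyBounded (λ n → poly cB (t n))
    pb = pb-poly cB pt

  opaque
    pb-sizeFactor : PolyBounded sizeFactor
    pb-sizeFactor = pb-+ (pb-* (pb-suc (pb-^ q pb-id)) (pb-+ (pb-+ (pb-+ pt (pb-* (pb-const 2)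
      (pb-+ (pb-+ (pb-+ pb-id (pb-const 3)) (pb-const 2)) (pb-const 1)))) (pb-const 3)) (pb-const 1))) (pb-const 3)
      where
      ps : PolyBounded steps
      ps = pb-+ (pb-poly cM (pb-+ (pb-+ pb-id pb-id) (pb-suc (pb-suc (pb-hintsLength pb-id))))) pb-id
      pv : PolyBounded variables
      pv = pb-+ (pb-* (pb-suc ps) (pb-const (suc (TM.nQ M)))) (pb-* (pb-suc ps) (pb-const (3 + TM.nΓ M)))
      pc : PolyBounded stepCost
      pc = pb-+ (pb-+ (pb-* (pb-suc ps) (pb-const (anyCost + 1))) (pb-const 2)) (pb-const (anyCost + ((suc (TM.nQ M) * 1 + 2 + 1) + 1 + 1)))
      pt : PolyBounded tableauCost
      pt = pb-+ (pb-* pv (pb-const 2)) (pb-* ps (pb-* pv pc))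

  open SizeBound (proj₁ pb-sizeFactor) N

  module Slice (n : ℕ) where

    -- The length m is the least one with `t ^ q ≤ m`, so the hardness hypothesis yields the bound
    -- `2 ^ t` at this length.
    t m T : ℕ
    t = hardness n
    m = t ^ q
    T = steps t

    open Circuits m
    open Tableau M (suc T) zero using (outputIn; outputCost; cost-output; outputIn-sound; outputIn-complete)

    t≤m : t ≤ m
    t≤m = ≤-trans (≤-reflexive (sym (^-identityʳ t))) (^-monoʳ-≤ t {{>-nonZero (≤-trans (s≤s z≤n) (hardness-> n))}} 1≤q)

    n≤t : n ≤ t
    n≤t = hardness-≥ n

    n≤T : n ≤ T
    n≤T = ≤-trans n≤t (m≤n+m t (poly cM (t + t + suc (suc (hintsLength t)))))

    m₀ : Fin m
    m₀ = fromℕ< {0} (≤-trans (≤-trans (s≤s z≤n) (hardness-> n)) t≤m)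

    no-small-circuit : ∀ {b φ} → Cost inputs b φ → b ≤ 2 ^ t → (∀ x → φ x ≡ L (toList x)) → ⊥
    no-small-circuit C b≤ e with cost⇒circuit C
    ... | s , circ , s≤ , comp = <-irrefl refl (≤-trans (hard m (≤-trans (<⇒≤ (hardness-> n)) t≤m) s circ
            (λ x → trans (comp x) (e x)) t ≤-refl) (≤-trans s≤ b≤))

    searchCost : ℕ
    searchCost = suc m * (2 ^ n * (outputCost n T + 2 + 1) + 1) + 2

    -- The extra gate is the final negation in `no-xs-cover`. All terms are raised to multiples of
    -- `e * e`, one factor `2 ^ n` for the words y and one for the table of outputs, so that
    -- `sizeFactor t` can be factored out.
    searchCost-≤ : searchCost + 1 ≤ 2 ^ t
    searchCost-≤ = begin
      searchCost + 1
        ≡⟨ cong (λ k → suc m * (e * (k + 2 + 1) + 1) + 2 + 1) (sym (+-assoc (variables t * 2) (steps t * (variables t * stepCost t)) (e * d))) ⟩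
      suc m * (e * (c + e * d + 2 + 1) + 1) + 2 + 1
        ≡⟨ cong (λ k → suc m * (e * k + 1) + 2 + 1) (solve 3 (λ c e d → (c :+ e :* d) :+ con 2 :+ con 1 := (c :+ con 3) :+ e :* d) refl c e d) ⟩
      suc m * (e * ((c + 3) + e * d) + 1) + 2 + 1
        ≡⟨ +-assoc (suc m * (e * ((c + 3) + e * d) + 1)) 2 1 ⟩
      suc m * (e * ((c + 3) + e * d) + 1) + 3
        ≤⟨ +-mono-≤ (*-monoʳ-≤ (suc m) (+-mono-≤ (*-monoʳ-≤ e (+-mono-≤ (grow (c + 3)) (*-monoʳ-≤ e d≤))) 1≤ee)) (grow² 3) ⟩
      suc m * (e * (e * (c + 3) + e * d′) + e * e) + e * e * 3
        ≡⟨ solve 4 (λ m e c d → m :* (e :* (e :* (c :+ con 3) :+ e :* d) :+ e :* e) :+ e :* e :* con 3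
                     := e :* e :* (m :* (c :+ d :+ con 3 :+ con 1) :+ con 3)) refl (suc m) e c d′ ⟩
      e * e * sizeFactor t             ≡⟨ cong (_* sizeFactor t) (sym (^-distribˡ-+-* 2 n n)) ⟩
      2 ^ (n + n) * sizeFactor t       ≤⟨ *-monoʳ-≤ (2 ^ (n + n)) (proj₂ pb-sizeFactor t) ⟩
      2 ^ (n + n) * (2 + t) ^ proj₁ pb-sizeFactor ≤⟨ fits-hardness n ⟩
      2 ^ t                            ∎
      where
      open ≤-Reasoning
      open +-*-Solver
      e = 2 ^ n
      c = tableauCost t
      d = 2 * (n + 3 + 2 + 1)
      d′ = 2 * (t + 3 + 2 + 1)
      d≤ : d ≤ d′
      d≤ = *-monoʳ-≤ 2 (+-monoˡ-≤ 1 (+-monoˡ-≤ 2 (+-monoˡ-≤ 3 n≤t)))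
      1≤e : 1 ≤ e
      1≤e = m^n>0 2 n
      1≤ee : 1 ≤ e * e
      1≤ee = *-mono-≤ 1≤e 1≤e
      grow : ∀ k → k ≤ e * k
      grow k = ≤-trans (≤-reflexive (sym (*-identityˡ k))) (*-monoˡ-≤ k 1≤e)
      grow² : ∀ k → k ≤ e * e * k
      grow² k = ≤-trans (≤-reflexive (sym (*-identityˡ k))) (*-monoˡ-≤ k 1≤ee)

    xs zs : List Word
    xs = wordsWith true L m
    zs = wordsWith false L m

    query : Word → Word → Word → Word
    query y x z = pair y (hints n m x z)

    short : Word → Word → Word → Bool
    short y x z = length (f (query y x z)) ≤ᵇ n

    shortIn shortOut : Word → Word → Bool
    shortIn  x z = anyOfLength n (λ y → B y ∧ short y x z)
    shortOut x z = anyOfLength n (λ y → not (B y) ∧ short y x z)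

    template-query : ∀ {x z : Vec Bool m → Word} y → IsTemplate x → IsTemplate z → IsTemplate (λ v → query y (x v) (z v))
    template-query y tx tz = template-pair (template-const y) (template-pair tx (template-pair tz (template-const _)))

    cost-search : ∀ ws (g : Word → Bool) P (U : Word → Word → Vec Bool m → Word) → (∀ w y → IsTemplate (U w y)) →
                  length ws ≤ suc m →
                  Cost inputs searchCost (λ x → any (λ w → anyOfLength n (λ y → g y ∧ outputIn n T P (U w y x))) ws)
    cost-search ws g P U τ l = cost-≤ (+-monoˡ-≤ 2 (*-monoˡ-≤ _ l))
      (cost-any m₀ {P = λ w x → anyOfLength n (λ y → g y ∧ outputIn n T P (U w y x))} ws λ w →
        cost-anyOfLength n {P = λ x y → g y ∧ outputIn n T P (U w y x)} λ y _ →
          cost-guard m₀ (g y) (cost-output m₀ (τ w y) n T P (s≤s n≤T) ≤-refl))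

    output-sound : ∀ P y x z → length y ≡ n → length x ≡ m → length z ≡ m →
                   outputIn n T P (query y x z) ≡ true → P (f (query y x z)) ≡ true
    output-sound P y x z ey ex ez e = subst (λ a → P a ≡ true) (f-outputAfter y x z n≤t ey ex ez)
      (proj₂ (outputIn-sound n T P (query y x z) n≤T e))

    output-complete : ∀ P y x z → length y ≡ n → length x ≡ m → length z ≡ m → short y x z ≡ true →
                      P (f (query y x z)) ≡ true → outputIn n T P (query y x z) ≡ true
    output-complete P y x z ey ex ez s e = outputIn-complete n T P (query y x z) n≤T
      (subst (λ a → length a ≤ n) (sym out) (≤ᵇ-true s)) (trans (cong P out) e)
      where out = f-outputAfter y x z n≤t ey ex ez

    -- The cover promises short outputs for x in L only. The circuit is right for the other x as
    -- well: for y in B and z outside L, whatever short output turns up then lies outside A.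
    no-zs-cover : ∀ ws → ws ⊆ zs → length ws ≤ suc m → Hits shortIn ws xs → ⊥
    no-zs-cover ws sub l hits = no-small-circuit
      (cost-search ws B A (λ z y v → query y (toList v) z)
        (λ z y → template-query y template-inputs (template-const z)) l)
      (≤-trans (m≤m+n searchCost 1) searchCost-≤) (λ v → bool-ext (⇒ v) (⇐ v))
      where
      search-z : Vec Bool m → Word → Bool
      search-z v z = anyOfLength n (λ y → B y ∧ outputIn n T A (query y (toList v) z))
      ⇒ : ∀ v → any (search-z v) ws ≡ true → L (toList v) ≡ true
      ⇒ v e with any-sound {P = search-z v} ws e
      ... | z , z∈ , e₁ with anyOfLength-sound n (λ y → B y ∧ outputIn n T A (query y (toList v) z)) e₁
      ... | y , ey , e₂ with ∧-true {B y} e₂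
      ... | By , out = trans (sym (trans (f-hinted y (toList v) z ey (length-toList v) ez)
              (trans (cong₂ (λ b c → (b ∧ L (toList v)) ∨ c) By (wordsWith-value false L m (sub z z∈))) (∨-identityʳ _))))
              (output-sound A y (toList v) z ey (length-toList v) ez out)
        where ez = wordsWith-length false L m (sub z z∈)
      ⇐ : ∀ v → L (toList v) ≡ true → any (search-z v) ws ≡ true
      ⇐ v e with hits (toList v) (subst (λ k → toList v ∈ wordsWith true L k) (length-toList v) (∈-wordsWith true L (toList v) e))
      ... | z , z∈ , e₁ with anyOfLength-sound n (λ y → B y ∧ short y (toList v) z) e₁
      ... | y , ey , e₂ with ∧-true {B y} e₂
      ... | By , s = any-complete {P = search-z v} z∈ (subst (λ k → anyOfLength k (λ y → B y ∧ outputIn n T A (query y (toList v) z)) ≡ true) ey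
              (anyOfLength-complete y (λ y → B y ∧ outputIn n T A (query y (toList v) z)) (cong₂ _∧_ By (output-complete A y (toList v) z ey (length-toList v) ez s
                (trans (f-hinted y (toList v) z ey (length-toList v) ez) (cong₂ (λ b c → (b ∧ c) ∨ L z) By e))))))
        where ez = wordsWith-length false L m (sub z z∈)

    -- Here the cover speaks about z outside L, so the search recognises the complement of L: with y
    -- outside B the output lies outside A exactly for these z. Hence the table of `not ∘ A` and the
    -- negation at the end.
    no-xs-cover : ∀ ws → ws ⊆ xs → length ws ≤ suc m → Hits (flip shortOut) ws zs → ⊥
    no-xs-cover ws sub l hits = no-small-circuit
      (cost-not (cost-search ws (not ∘ B) (not ∘ A) (λ x y v → query y x (toList v))
        (λ x y → template-query y (template-const x) template-inputs) l))
      searchCost-≤ (λ v → trans (cong not (bool-ext (⇒ v) (⇐ v))) (not-involutive (L (toList v))))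
      where
      search-x : Vec Bool m → Word → Bool
      search-x v x = anyOfLength n (λ y → not (B y) ∧ outputIn n T (not ∘ A) (query y x (toList v)))
      value : ∀ {v x y} → x ∈ ws → length y ≡ n → not (B y) ≡ true → A (f (query y x (toList v))) ≡ L (toList v)
      value {v} {x} {y} x∈ ey By = trans (f-hinted y x (toList v) ey (wordsWith-length true L m (sub x x∈)) (length-toList v))
        (cong (λ b → (b ∧ L x) ∨ L (toList v)) (not-injective By))
      ⇒ : ∀ v → any (search-x v) ws ≡ true → not (L (toList v)) ≡ true
      ⇒ v e with any-sound {P = search-x v} ws e
      ... | x , x∈ , e₁ with anyOfLength-sound n (λ y → not (B y) ∧ outputIn n T (not ∘ A) (query y x (toList v))) e₁
      ... | y , ey , e₂ with ∧-true {not (B y)} e₂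
      ... | By , out = trans (cong not (sym (value x∈ ey By)))
              (output-sound (not ∘ A) y x (toList v) ey (wordsWith-length true L m (sub x x∈)) (length-toList v) out)
      ⇐ : ∀ v → not (L (toList v)) ≡ true → any (search-x v) ws ≡ true
      ⇐ v e with hits (toList v) (subst (λ k → toList v ∈ wordsWith false L k) (length-toList v)
                   (∈-wordsWith false L (toList v) (not-injective e)))
      ... | x , x∈ , e₁ with anyOfLength-sound n (λ y → not (B y) ∧ short y x (toList v)) e₁
      ... | y , ey , e₂ with ∧-true {not (B y)} e₂
      ... | By , s = any-complete {P = search-x v} x∈ (subst (λ k → anyOfLength k (λ y → not (B y) ∧ outputIn n T (not ∘ A) (query y x (toList v))) ≡ true) ey
              (anyOfLength-complete y (λ y → not (B y) ∧ outputIn n T (not ∘ A) (query y x (toList v))) (cong₂ _∧_ By (output-complete (not ∘ A) y x (toList v) ey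
                (wordsWith-length true L m (sub x x∈)) (length-toList v) s (trans (cong not (value x∈ ey By)) e)))))

    -- Exhaustive search either finds the pair or shows that every pair has a short output, which is
    -- the premise of `domination`. If `xs` or `zs` is empty, the covers become vacuous and
    -- contradict hardness all the same.
    goodPair : ∃[ x ] ∃[ z ] (x ∈ xs × z ∈ zs × shortIn x z ∨ shortOut x z ≡ false)
    goodPair with search (λ x → any (λ z → not (shortIn x z ∨ shortOut x z)) zs) xs
    ... | inj₁ (x , x∈ , e) with any-sound {P = λ z → not (shortIn x z ∨ shortOut x z)} zs e
    ... | z , z∈ , e′ = x , z , x∈ , z∈ , not-injective e′
    goodPair | inj₂ none = ⊥-elim (uncovered (domination shortIn shortOut xs zs {suc m} everyPair
                                     (wordsWith-short false L m) (suc m) xs (λ _ → id) (wordsWith-short true L m)))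
      where
      everyPair : ∀ x z → x ∈ xs → z ∈ zs → shortIn x z ∨ shortOut x z ≡ true
      everyPair x z x∈ z∈ with shortIn x z ∨ shortOut x z in e
      ... | true  = refl
      ... | false with () ← trans (sym (none x x∈)) (any-complete {P = λ z → not (shortIn x z ∨ shortOut x z)} z∈ (cong not e))
      uncovered : (∃[ ws ] (ws ⊆ zs × length ws ≤ suc m × Hits shortIn ws xs)) ⊎
                  (∃[ ws ] (ws ⊆ xs × length ws ≤ suc m × Hits (flip shortOut) ws zs)) → ⊥
      uncovered (inj₁ (ws , sub , l , hits)) = no-zs-cover ws sub l hits
      uncovered (inj₂ (ws , sub , l , hits)) = no-xs-cover ws sub l hits

    short-found : ∀ y x z → length y ≡ n → short y x z ≡ true → shortIn x z ∨ shortOut x z ≡ true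
    short-found y x z ey s with B y in By
    ... | true  = ∨-introˡ (subst (λ k → anyOfLength k (λ y → B y ∧ short y x z) ≡ true) ey
                    (anyOfLength-complete y (λ y → B y ∧ short y x z) (cong₂ _∧_ By s)))
    ... | false = ∨-introʳ {shortIn x z} (subst (λ k → anyOfLength k (λ y → not (B y) ∧ short y x z) ≡ true) ey
                    (anyOfLength-complete y (λ y → not (B y) ∧ short y x z) (cong₂ _∧_ (cong not By) s)))

    x₀ z₀ : Word
    x₀ = proj₁ goodPair
    z₀ = proj₁ (proj₂ goodPair)

    x₀∈ : x₀ ∈ xs
    x₀∈ = proj₁ (proj₂ (proj₂ goodPair))

    z₀∈ : z₀ ∈ zs
    z₀∈ = proj₁ (proj₂ (proj₂ (proj₂ goodPair)))

    opaque
      adv : Word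
      adv = hints n m x₀ z₀

      adv-length : length adv ≤ hintsLength t
      adv-length = hints-length x₀ z₀ n≤t (wordsWith-length true L m x₀∈) (wordsWith-length false L m z₀∈)

      adv-correct : ∀ y → length y ≡ n → B y ≡ A (f (pair y adv))
      adv-correct y ey = sym (trans (f-hinted y x₀ z₀ ey (wordsWith-length true L m x₀∈) (wordsWith-length false L m z₀∈))
        (trans (cong₂ (λ b c → (B y ∧ b) ∨ c) (wordsWith-value true L m x₀∈) (wordsWith-value false L m z₀∈))
          (trans (∨-identityʳ _) (∧-identityʳ _))))

      adv-long : ∀ y → length y ≡ n → n < length (f (pair y adv))
      adv-long y ey with short y x₀ z₀ in s
      ... | false = ≤ᵇ-false s
      ... | true with () ← trans (sym (proj₂ (proj₂ (proj₂ (proj₂ goodPair))))) (short-found y x₀ z₀ ey s)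

  lengthIncreasing : Σ (Word → Word) λ g → PPolyComputable g × (∀ y → B y ≡ A (g y)) × (∀ y → length y < length (g y))
  lengthIncreasing = (λ y → f (pair y (adv (length y)))) ,
    -- The query is `pair y adv`, precisely the form in which advice is supplied, so the machine of
    -- f serves unchanged. One exponent bounds both the advice length and the running time.
    (M , proj₁ exponent , adv ,
      (λ n → ≤-trans (adv-length n) (≤-trans (m≤m+n _ (poly cM n)) (proj₂ exponent n))) ,
      (λ y → output-later M {pair y (adv (length y))} (≤-trans (m≤n+m _ (hintsLength (hardness (length (pair y (adv (length y)))))))
               (proj₂ exponent (length (pair y (adv (length y)))))) (f-output (pair y (adv (length y)))))) ,
    (λ y → adv-correct (length y) y refl) , (λ y → adv-long (length y) y refl)
    where
    open Slice using (adv; adv-length; adv-correct; adv-long)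
    opaque
      exponent : ∃[ c ] ∀ n → hintsLength (hardness n) + poly cM n ≤ poly c n
      exponent = pb⇒poly (pb-+ (pb-hintsLength pb-hardness) (pb-poly cM pb-id))

theorem3p1 : ExpHardNP → ∀ A → NPComplete A → NPCompleteLIPPoly A
theorem3p1 (L , L∈NP , q , 1≤q , N , hard) A (_ , complete) B B∈NP =
  Reduction.lengthIncreasing {A} B∈NP L∈NP q 1≤q N hard (complete _ (Combination.S∈NP B∈NP L∈NP))
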